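{- $\textsc{\#Disj2Sat}$ is hard for $\mathsf{\Sigma QSO(\Sigma_2\text{ - }2SAT)}$ under parsimonious reductions: for every relational vocabulary $\sigma$ and every $\mathsf{\Sigma QSO(\Sigma_2\text{ - }2SAT)}$ sentence $\alpha$ over $\sigma$, there is a function, computable in time polynomial in the size of the input structure, mapping each finite ordered $\sigma$-structure $\mathcal{A}$ to a propositional formula $\phi_{\alpha_{\mathcal{A}}}$ that is a disjunction of 2SAT formulae and satisfies $[[\alpha]](\mathcal{A})=\textsc{\#Disj2Sat}(\phi_{\alpha_{\mathcal{A}}})$.
   Context: $\textsc{\#Disj2Sat}$: given a propositional formula that is a disjunction of 2SAT formulae (each a conjunction of clauses with at most two literals), output its number of satisfying assignments. $\mathsf{\Sigma QSO(\Sigma_2\text{ - }2SAT)}$: first-order formulae over a relational vocabulary $\sigma$ are built by $\phi ::= x=y \mid R(\vec x) \mid \neg\phi \mid \phi\vee\phi \mid \exists x\phi \mid \top \mid \bot$ with $R\in\sigma$. A literal is $X(\vec x)$ or $\neg X(\vec x)$ with $X$ a second-order variable. A 2SAT clause over $\sigma$ is $\phi_1\vee\phi_2\vee\phi_3$ where each $\phi_i$ is a literal or a first-order formula over $\sigma$, at least one $\phi_i$ being a first-order formula. A $\Sigma_2$-2SAT formula is $\exists\vec x\forall\vec y\bigwedge_{j=1}^k C_j(\vec x,\vec y)$ with each $C_j$ a 2SAT clause. $\mathsf{\Sigma QSO(\Sigma_2\text{ - }2SAT)}$ formulae: $\alpha ::= \phi \mid s \mid (\alpha+\alpha)\mid \Sigma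 x.\alpha \mid \Sigma X.\alpha$, with $\phi$ a $\Sigma_2$-2SAT formula, $s\in\mathbb{N}$. Semantics: $[[\phi]]=1$ if the structure (with the current assignments) satisfies $\phi$, else $0$; $[[s]]=s$; $+$ is addition; $[[\Sigma x.\alpha]](\mathcal{A},v,V)=\sum_{a\in A}[[\alpha]](\mathcal{A},v[a/x],V)$; $[[\Sigma X.\alpha]](\mathcal{A},v,V)=\sum_{B\subseteq A^{\mathrm{arity}(X)}}[[\alpha]](\mathcal{A},v,V[B/X])$. A sentence (no free variables) $\alpha$ defines the counting function $\mathcal{A}\mapsto[[\alpha]](\mathcal{A})$. A parsimonious reduction from $f$ to $g$ is a polynomial-time computable $h$ with $f(x)=g(h(x))$ for all inputs $x$. -}

module Defs where

open import Data.Nat as ℕ using (ℕ; zero; suc; _+_; _*_; _^_; _≡ᵇ_)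
open import Data.Nat.Binary as ℕᵇ using (ℕᵇ; 2[1+_]; 1+[2_])
open import Data.Bool using (Bool; true; false; _∧_; _∨_; not; if_then_else_; T)
open import Data.Fin using (Fin; toℕ) renaming (zero to fzero; suc to fsuc)
open import Data.List using (List; []; _∷_; _++_; map; length; concatMap; allFin; lookup; replicate)
open import Data.Bool.ListAction using (any; all)
open import Data.Nat.ListAction using (sum)
open import Data.Vec as Vec using (Vec; []; _∷_)
open import Data.Product using (_×_; _,_; Σ-syntax)
open import Data.Sum using (_⊎_; inj₁; inj₂)
open import Data.Maybe using (Maybe; just; nothing)
open import Data.Unit using (⊤)
open import Data.Empty using (⊥)
open import Relation.Nullary using (yes; no)
open import Relation.Binary.PropositionalEquality using (_≡_; refl)

Vocab : Set
Vocab = List ℕ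

RelSym : Vocab → Set
RelSym σ = Fin (length σ)

arity : (σ : Vocab) → RelSym σ → ℕ
arity σ R = lookup σ R

-- A finite ordered σ-structure: universe {0 < 1 < … < size} = Fin (suc size)
-- (non-empty, ordered by the natural order of Fin), with each relation
-- symbol interpreted as a (decidable) set of tuples.
record Structure (σ : Vocab) : Set where
  field
    size : ℕ
    rel  : (R : RelSym σ) → Vec (Fin (suc size)) (arity σ R) → Bool

card : {σ : Vocab} → Structure σ → ℕ
card A = suc (Structure.size A)

Dom : {σ : Vocab} → Structure σ → Set
Dom A = Fin (card A)

allTuples : (n k : ℕ) → List (Vec (Fin n) k)
allTuples n zero    = [] ∷ []
allTuples n (suc k) = concatMap (λ a → map (a ∷_) (allTuples n k)) (allFin n)

-- all sublists (= all subsets, since the list has no duplicates)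
sublists : {A : Set} → List A → List (List A)
sublists []       = [] ∷ []
sublists (x ∷ xs) = map (x ∷_) (sublists xs) ++ sublists xs

eqFin : {n : ℕ} → Fin n → Fin n → Bool
eqFin a b = toℕ a ≡ᵇ toℕ b

eqTuple : {n k : ℕ} → Vec (Fin n) k → Vec (Fin n) k → Bool
eqTuple []       []       = true
eqTuple (a ∷ as) (b ∷ bs) = eqFin a b ∧ eqTuple as bs

member : {n k : ℕ} → List (Vec (Fin n) k) → Vec (Fin n) k → Bool
member B t = any (eqTuple t) B

-- Assignments.  First-order variables and second-order variables are named
-- by natural numbers; a second-order variable is identified by the pair
-- (arity, name).

FOAssign : ℕ → Set
FOAssign n = ℕ → Fin n

SOAssign : ℕ → Set
SOAssign n = (k : ℕ) → ℕ → Vec (Fin n) k → Bool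

update : {D : Set} → (ℕ → D) → ℕ → D → ℕ → D
update v x a y = if x ≡ᵇ y then a else v y

updateSO : {n : ℕ} → SOAssign n → (k : ℕ) → ℕ → (Vec (Fin n) k → Bool) → SOAssign n
updateSO V k X S k' X' with k ℕ.≟ k' | X ≡ᵇ X'
... | yes refl | true = S
... | _        | _    = V k' X'

data FO (σ : Vocab) : Set where
  _≐_  : ℕ → ℕ → FO σ
  rel  : (R : RelSym σ) → Vec ℕ (arity σ R) → FO σ
  ¬ᶠ_  : FO σ → FO σ
  _∨ᶠ_ : FO σ → FO σ → FO σ
  ∃ᶠ   : ℕ → FO σ → FO σ
  ⊤ᶠ   : FO σ
  ⊥ᶠ   : FO σ

evalFO : {σ : Vocab} (A : Structure σ) → FO σ → FOAssign (card A) → Bool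
evalFO A (x ≐ y)   v = eqFin (v x) (v y)
evalFO A (rel R xs) v = Structure.rel A R (Vec.map v xs)
evalFO A (¬ᶠ φ)    v = not (evalFO A φ v)
evalFO A (φ ∨ᶠ ψ)  v = evalFO A φ v ∨ evalFO A ψ v
evalFO A (∃ᶠ x φ)  v = any (λ a → evalFO A φ (update v x a)) (allFin (card A))
evalFO A ⊤ᶠ        v = true
evalFO A ⊥ᶠ        v = false

record SOLit : Set where
  constructor lit
  field
    sign  : Bool
    ar    : ℕ
    name  : ℕ
    args  : Vec ℕ ar

evalLit : {n : ℕ} → SOLit → FOAssign n → SOAssign n → Bool
evalLit (lit s k X xs) v V = if s then V k X (Vec.map v xs) else not (V k X (Vec.map v xs))

Atom : Vocab → Set
Atom σ = SOLit ⊎ FO σ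

IsFO : {σ : Vocab} → Atom σ → Set
IsFO (inj₁ _) = ⊥
IsFO (inj₂ _) = ⊤

record Clause (σ : Vocab) : Set where
  field
    φ₁ φ₂ φ₃ : Atom σ
    hasFO    : IsFO φ₁ ⊎ IsFO φ₂ ⊎ IsFO φ₃

evalAtom : {σ : Vocab} (A : Structure σ) → Atom σ → FOAssign (card A) → SOAssign (card A) → Bool
evalAtom A (inj₁ l) v V = evalLit l v V
evalAtom A (inj₂ φ) v V = evalFO A φ v

evalClause : {σ : Vocab} (A : Structure σ) → Clause σ → FOAssign (card A) → SOAssign (card A) → Bool
evalClause A C v V = evalAtom A (Clause.φ₁ C) v V ∨ evalAtom A (Clause.φ₂ C) v V ∨ evalAtom A (Clause.φ₃ C) v V

record Σ₂2SAT (σ : Vocab) : Set where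
  field
    exVars  : List ℕ
    allVars : List ℕ
    clauses : List (Clause σ)

existsVars : {n : ℕ} → List ℕ → FOAssign n → (FOAssign n → Bool) → Bool
existsVars {n} []       v P = P v
existsVars {n} (x ∷ xs) v P = any (λ a → existsVars xs (update v x a) P) (allFin n)

forallVars : {n : ℕ} → List ℕ → FOAssign n → (FOAssign n → Bool) → Bool
forallVars {n} []       v P = P v
forallVars {n} (x ∷ xs) v P = all (λ a → forallVars xs (update v x a) P) (allFin n)

evalΣ₂ : {σ : Vocab} (A : Structure σ) → Σ₂2SAT σ → FOAssign (card A) → SOAssign (card A) → Bool
evalΣ₂ A φ v V =
  existsVars (Σ₂2SAT.exVars φ) v (λ v₁ →
    forallVars (Σ₂2SAT.allVars φ) v₁ (λ v₂ →
      all (λ C → evalClause A C v₂ V) (Σ₂2SAT.clauses φ)))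

data ΣQSO (σ : Vocab) : Set where
  fml   : Σ₂2SAT σ → ΣQSO σ
  const : ℕ → ΣQSO σ
  _⊕_   : ΣQSO σ → ΣQSO σ → ΣQSO σ
  Σᶠ    : ℕ → ΣQSO σ → ΣQSO σ
  Σˢ    : (k : ℕ) → ℕ → ΣQSO σ → ΣQSO σ

⟦_⟧ : {σ : Vocab} → ΣQSO σ → (A : Structure σ) → FOAssign (card A) → SOAssign (card A) → ℕ
⟦ fml φ ⟧   A v V = if evalΣ₂ A φ v V then 1 else 0
⟦ const s ⟧ A v V = s
⟦ α ⊕ β ⟧   A v V = ⟦ α ⟧ A v V + ⟦ β ⟧ A v V
⟦ Σᶠ x α ⟧  A v V = sum (map (λ a → ⟦ α ⟧ A (update v x a) V) (allFin (card A)))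
⟦ Σˢ k X α ⟧ A v V =
  sum (map (λ B → ⟦ α ⟧ A v (updateSO V k X (member B))) (sublists (allTuples (card A) k)))

elemℕ : ℕ → List ℕ → Bool
elemℕ x = any (x ≡ᵇ_)

elemSO : ℕ × ℕ → List (ℕ × ℕ) → Bool
elemSO (k , X) = any (λ { (k' , X') → (k ≡ᵇ k') ∧ (X ≡ᵇ X') })

closedFO : {σ : Vocab} → List ℕ → FO σ → Bool
closedFO b (x ≐ y)    = elemℕ x b ∧ elemℕ y b
closedFO b (rel R xs) = all (λ x → elemℕ x b) (Vec.toList xs)
closedFO b (¬ᶠ φ)     = closedFO b φ
closedFO b (φ ∨ᶠ ψ)   = closedFO b φ ∧ closedFO b ψ
closedFO b (∃ᶠ x φ)   = closedFO (x ∷ b) φ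
closedFO b ⊤ᶠ         = true
closedFO b ⊥ᶠ         = true

closedAtom : {σ : Vocab} → List ℕ → List (ℕ × ℕ) → Atom σ → Bool
closedAtom b bs (inj₁ (lit s k X xs)) = elemSO (k , X) bs ∧ all (λ x → elemℕ x b) (Vec.toList xs)
closedAtom b bs (inj₂ φ) = closedFO b φ

closedΣ₂ : {σ : Vocab} → List ℕ → List (ℕ × ℕ) → Σ₂2SAT σ → Bool
closedΣ₂ b bs φ =
  all (λ C → closedAtom b' bs (Clause.φ₁ C) ∧ closedAtom b' bs (Clause.φ₂ C) ∧ closedAtom b' bs (Clause.φ₃ C))
      (Σ₂2SAT.clauses φ)
  where b' = Σ₂2SAT.exVars φ ++ Σ₂2SAT.allVars φ ++ b

closedQ : {σ : Vocab} → List ℕ → List (ℕ × ℕ) → ΣQSO σ → Bool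
closedQ b bs (fml φ)    = closedΣ₂ b bs φ
closedQ b bs (const s)  = true
closedQ b bs (α ⊕ β)    = closedQ b bs α ∧ closedQ b bs β
closedQ b bs (Σᶠ x α)   = closedQ (x ∷ b) bs α
closedQ b bs (Σˢ k X α) = closedQ b ((k , X) ∷ bs) α

Sentence : {σ : Vocab} → ΣQSO σ → Set
Sentence α = T (closedQ [] [] α)

-- the counting function defined by a sentence (the assignments are irrelevant
-- for sentences; we use arbitrary fixed ones)
count : {σ : Vocab} → ΣQSO σ → Structure σ → ℕ
count α A = ⟦ α ⟧ A (λ _ → fzero) (λ _ _ _ → false)

PLit : Set
PLit = Bool × ℕ

data Clause2 : Set where
  empty : Clause2
  one   : PLit → Clause2
  two   : PLit → PLit → Clause2

TwoSAT : Set
TwoSAT = List Clause2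

Disj2 : Set
Disj2 = List TwoSAT

litVar : PLit → ℕ
litVar (_ , x) = x

clauseVars : Clause2 → List ℕ
clauseVars empty     = []
clauseVars (one l)   = litVar l ∷ []
clauseVars (two l m) = litVar l ∷ litVar m ∷ []

nub : List ℕ → List ℕ
nub []       = []
nub (x ∷ xs) = if elemℕ x xs then nub xs else x ∷ nub xs

varsD : Disj2 → List ℕ
varsD φ = nub (concatMap (concatMap clauseVars) φ)

allBools : ℕ → List (List Bool)
allBools zero    = [] ∷ []
allBools (suc n) = concatMap (λ bs → (true ∷ bs) ∷ (false ∷ bs) ∷ []) (allBools n)

valOf : List ℕ → List Bool → ℕ → Bool
valOf (y ∷ ys) (b ∷ bs) x = if y ≡ᵇ x then b else valOf ys bs x
valOf _        _        x = false

evalPLit : (ℕ → Bool) → PLit → Bool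
evalPLit a (s , x) = if s then a x else not (a x)

evalClause2 : (ℕ → Bool) → Clause2 → Bool
evalClause2 a empty     = false
evalClause2 a (one l)   = evalPLit a l
evalClause2 a (two l m) = evalPLit a l ∨ evalPLit a m

evalDisj2 : (ℕ → Bool) → Disj2 → Bool
evalDisj2 a φ = any (all (evalClause2 a)) φ

#Disj2Sat : Disj2 → ℕ
#Disj2Sat φ = sum (map (λ bs → if evalDisj2 (valOf vs bs) φ then 1 else 0) (allBools (length vs)))
  where vs = varsD φ

IO : Set
IO = Fin 5

s0 s1 sa sb sc : IO
s0 = fzero
s1 = fsuc fzero
sa = fsuc (fsuc fzero)
sb = fsuc (fsuc (fsuc fzero))
sc = fsuc (fsuc (fsuc (fsuc fzero)))

bit : Bool → IO
bit true  = s1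
bit false = s0

encStructure : {σ : Vocab} → Structure σ → List IO
encStructure {σ} A =
  replicate (card A) s1 ++ sa ∷
  concatMap (λ R → map (λ t → bit (Structure.rel A R t)) (allTuples (card A) (arity σ R)) ++ sa ∷ [])
            (allFin (length σ))

-- bijective base-2 digits of a natural number (least significant first)
digitsᵇ : ℕᵇ → List IO
digitsᵇ ℕᵇ.zero = []
digitsᵇ 1+[2 n ] = s0 ∷ digitsᵇ n
digitsᵇ 2[1+ n ] = s1 ∷ digitsᵇ n

encPLit : PLit → List IO
encPLit (s , x) = bit s ∷ digitsᵇ (ℕᵇ.fromℕ x) ++ sa ∷ []

encClause2 : Clause2 → List IO
encClause2 empty     = sb ∷ []
encClause2 (one l)   = encPLit l ++ sb ∷ []
encClause2 (two l m) = encPLit l ++ encPLit m ++ sb ∷ []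

encTwoSAT : TwoSAT → List IO
encTwoSAT cs = concatMap encClause2 cs ++ sc ∷ []

encDisj2 : Disj2 → List IO
encDisj2 = concatMap encTwoSAT

data Move : Set where
  L R S : Move

-- tape symbols: inj₁ nothing = blank, inj₁ (just s) = I/O symbol s,
-- inj₂ i = auxiliary work symbol
Sym : ℕ → Set
Sym g = Maybe IO ⊎ Fin g

record TM : Set where
  field
    states  : ℕ
    work    : ℕ
    start   : Fin states
    halting : Fin states → Bool
    δ       : Fin states → Sym work → Fin states × Sym work × Move

record Config (M : TM) : Set where
  constructor cfg
  field
    state : Fin (TM.states M)
    left  : List (Sym (TM.work M))   -- cells left of the head, nearest first
    head  : Sym (TM.work M)
    right : List (Sym (TM.work M))   -- cells right of the head, nearest first

blank : {g : ℕ} → Sym g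
blank = inj₁ nothing

step : (M : TM) → Config M → Config M
step M (cfg q l h r) with TM.halting M q
... | true  = cfg q l h r
... | false with TM.δ M q h
...   | (q' , w , L) with l
...     | []      = cfg q' [] blank (w ∷ r)
...     | x ∷ l'  = cfg q' l' x (w ∷ r)
step M (cfg q l h r) | false | (q' , w , R) with r
...     | []      = cfg q' (w ∷ l) blank []
...     | x ∷ r'  = cfg q' (w ∷ l) x r'
step M (cfg q l h r) | false | (q' , w , S) = cfg q' l w r

run : (M : TM) → ℕ → Config M → Config M
run M zero    c = c
run M (suc t) c = run M t (step M c)

initial : (M : TM) → List IO → Config M
initial M []       = cfg (TM.start M) [] blank []
initial M (s ∷ ss) = cfg (TM.start M) [] (inj₁ (just s)) (map (λ x → inj₁ (just x)) ss)

halted : (M : TM) → Config M → Bool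
halted M c = TM.halting M (Config.state c)

takeIO : {g : ℕ} → List (Sym g) → List IO
takeIO (inj₁ (just s) ∷ xs) = s ∷ takeIO xs
takeIO _                    = []

output : (M : TM) → Config M → List IO
output M c = takeIO (Config.head c ∷ Config.right c)

PolyTimeComputable : {X Y : Set} → (X → List IO) → (Y → List IO) → (X → Y) → Set
PolyTimeComputable {X} encX encY f =
  Σ[ M ∈ TM ] Σ[ c ∈ ℕ ] Σ[ k ∈ ℕ ] ((x : X) →
    let fin = run M (c * length (encX x) ^ k + c) (initial M (encX x)) in
    T (halted M fin) × output M fin ≡ encY (f x))

-- A sum operator becomes a block of fresh selector variables.  A disjunct of α + β fixes a
-- selector bit and sets all variables of the other summand to false; a disjunct of Σx.α fixes a
-- one-hot code of the value of x; in ΣX.α the bits of X are variables, which tautologies keep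
-- free but mentioned.  A Σ₂-2SAT formula is the disjunction, over its existential tuple, of the
-- conjunction of the ground clauses whose first-order part is false.  Then every disjunct
-- mentions every variable, the branches of a sum are mutually exclusive, and the number of
-- satisfying assignments follows by induction on α.
--
-- For the running time, variables are named by bit words that loops over the universe can print,
-- so the formula is the output of a fixed program of nested loops, equality tests and relation
-- lookups.  Such a program runs on a Turing machine that represents each loop variable by a mark
-- on the cells of the input and appends its output to the right of the input.

module Submission where

open import Defs
open import Data.Nat as ℕ using (ℕ; zero; suc; _+_; _*_; _∸_; _^_; _≡ᵇ_; _≤_; _<_; z≤n; s≤s)
open import Data.Nat.Properties
open import Data.Nat.Binary as ℕᵇ using (ℕᵇ; 2[1+_]; 1+[2_])
import Data.Nat.Binary.Properties as ℕᵇₚ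
open import Data.Bool using (Bool; true; false; _∧_; _∨_; not; if_then_else_; T)
open import Data.Bool.Properties using (∨-idem; ∨-inverseʳ; ∨-zeroʳ; ∨-identityʳ; ∧-identityʳ; ∧-zeroʳ; ∧-assoc; ∨-assoc; ∨-comm)
open import Data.Fin as Fin using (Fin; toℕ) renaming (zero to fzero; suc to fsuc)
open import Data.Fin.Properties as Finₚ using (toℕ-injective)
open import Data.List as List using (List; []; _∷_; _++_; map; length; concatMap; allFin; concat; _ʳ++_)
open import Data.List.Properties using (map-++; length-map; length-tabulate; map-tabulate; length-replicate; take-suc-tabulate; take-all; reverse-map; ʳ++-defn; reverse-involutive; length-reverse; length-++; ++-ʳ++; map-∘; map-id; map-cong; ++-assoc; ++-cancelˡ; ++-identityʳ; concatMap-++; concatMap-cong; concatMap-map; ∷-injective; ∷-injectiveʳ)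
open import Data.Bool.ListAction using (any; all; and; or)
open import Data.Nat.ListAction using (sum)
open import Data.Nat.ListAction.Properties using (sum-++)
open import Data.Vec as Vec using (Vec; []; _∷_)
import Data.Vec.Properties as Vecₚ
open import Data.Product using (_×_; _,_; Σ-syntax; ∃; proj₁; proj₂; map₂)
open import Data.Sum as Sum using (_⊎_; inj₁; inj₂; [_,_]′)
open import Data.Unit using (⊤)
open import Data.Maybe as Maybe using (Maybe; just; nothing; maybe)
open import Data.Empty using (⊥; ⊥-elim)
open import Data.List.Membership.Propositional using (_∈_; _∉_)
open import Data.List.Membership.Propositional.Properties using (∈-++⁺ˡ; ∈-++⁺ʳ; ∈-++⁻; ∈-map⁺; ∈-map⁻; ∈-allFin; ∈-concatMap⁺)
open import Data.List.Relation.Unary.Any using (here; there)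
import Data.List.Relation.Unary.Any as Any
open import Data.List.Relation.Unary.All as All using (All; []; _∷_)
import Data.List.Relation.Unary.All.Properties as Allₚ
open import Data.List.Relation.Unary.AllPairs as AllPairs using ([]; _∷_)
import Data.List.Relation.Unary.AllPairs.Properties as AllPairsₚ
open import Data.List.Relation.Unary.Unique.Propositional using (Unique)
import Data.List.Relation.Unary.Unique.Propositional.Properties as Uniqueₚ
open import Data.List.Relation.Binary.Permutation.Propositional as Perm using (_↭_)
import Data.List.Relation.Binary.Permutation.Propositional.Properties as Permₚ
open import Data.List.Relation.Binary.Disjoint.Propositional using (Disjoint)
open import Relation.Nullary using (yes; no)
open import Relation.Binary.PropositionalEquality
open import Function using (_∘_; id)
open import Data.Nat.Solver using (module +-*-Solver)
open +-*-Solver using (solve; _:+_; _:*_; _:=_; con)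
open import Data.List.Relation.Binary.BagAndSetEquality using (∼bag⇒↭)
open import Data.List.Membership.Propositional.Properties.WithK using (unique∧set⇒bag)
open import Function.Bundles using (mk⇔)
open import Algebra.Properties.CommutativeSemigroup +-commutativeSemigroup using (interchange)
open ≡-Reasoning

-- Counting assignments

-- `#Disj2Sat` counts only over the variables that occur in the formula, while the induction on the
-- sentence needs a set of variables fixed by the sentence and the size of the structure; hence each
-- disjunct has to mention all of them. The idle summand of a sum is pinned to a single assignment
-- because k unconstrained variables would multiply the count of the other summand by 2 to the k.
-- The induction is stated for a count that branches on a list of variables inside an arbitrary
-- ambient assignment, because the formula below a second-order sum reads the bits of that sum from
-- outside its own variables. The time bound is an obstacle of a different kind: the machine has to
-- produce the encoding of the formula symbol by symbol, so each variable needs a numeral that can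
-- be printed without arithmetic, and the disjuncts have to come in the order in which nested loops
-- print them.

bool→ℕ : Bool → ℕ
bool→ℕ b = if b then 1 else 0

≡ᵇ-refl : ∀ x → (x ≡ᵇ x) ≡ true
≡ᵇ-refl zero    = refl
≡ᵇ-refl (suc x) = ≡ᵇ-refl x

≡ᵇ-true : ∀ x y → (x ≡ᵇ y) ≡ true → x ≡ y
≡ᵇ-true zero    zero    _ = refl
≡ᵇ-true (suc x) (suc y) p = cong suc (≡ᵇ-true x y p)

≢⇒≡ᵇ-false : ∀ {x y} → x ≢ y → (x ≡ᵇ y) ≡ false
≢⇒≡ᵇ-false {x} {y} x≢y with x ≡ᵇ y in eq
... | false = refl
... | true  = ⊥-elim (x≢y (≡ᵇ-true x y eq))

module _ {D : Set} (v : ℕ → D) (x : ℕ) (a : D) where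

  update-same : update v x a x ≡ a
  update-same rewrite ≡ᵇ-refl x = refl

  update-other : ∀ {y} → x ≢ y → update v x a y ≡ v y
  update-other x≢y rewrite ≢⇒≡ᵇ-false x≢y = refl

update-cong : ∀ {D : Set} {v v′ : ℕ → D} x a → v ≗ v′ → update v x a ≗ update v′ x a
update-cong x a v≗v′ y with x ≡ᵇ y
... | true  = refl
... | false = v≗v′ y

update-comm : ∀ {D : Set} (v : ℕ → D) {x y} a b → x ≢ y →
  update (update v x a) y b ≗ update (update v y b) x a
update-comm v {x} {y} a b x≢y z with x ≡ᵇ z in p | y ≡ᵇ z in q
... | true  | true  = ⊥-elim (x≢y (trans (≡ᵇ-true x z p) (sym (≡ᵇ-true y z q))))
... | true  | false = refl
... | false | true  = refl
... | false | false = refl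

-- The ambient `ρ` supplies the variables outside the list, among them the bits of enclosing
-- second-order sums.
cnt : List ℕ → ((ℕ → Bool) → ℕ) → (ℕ → Bool) → ℕ
cnt []       F ρ = F ρ
cnt (x ∷ xs) F ρ = cnt xs F (update ρ x true) + cnt xs F (update ρ x false)

-- Reordering branches preserves assignments only up to pointwise equality, so a summand must be
-- known to respect `≗`.
Ext : ((ℕ → Bool) → ℕ) → Set
Ext F = ∀ {ρ ρ′} → ρ ≗ ρ′ → F ρ ≡ F ρ′

_≈[_]_ : (ℕ → Bool) → List ℕ → (ℕ → Bool) → Set
ρ ≈[ xs ] ρ′ = ∀ y → y ∉ xs → ρ y ≡ ρ′ y

cnt-ext : ∀ xs {F} → Ext F → Ext (cnt xs F)
cnt-ext []       eF e = eF e
cnt-ext (x ∷ xs) eF e = cong₂ _+_ (cnt-ext xs eF (update-cong x true e)) (cnt-ext xs eF (update-cong x false e))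

cnt-++ : ∀ xs ys F ρ → cnt (xs ++ ys) F ρ ≡ cnt xs (cnt ys F) ρ
cnt-++ []       ys F ρ = refl
cnt-++ (x ∷ xs) ys F ρ = cong₂ _+_ (cnt-++ xs ys F _) (cnt-++ xs ys F _)

≈-step : ∀ ρ x xs b {ρ′} → update ρ x b ≈[ xs ] ρ′ → ρ ≈[ x ∷ xs ] ρ′
≈-step ρ x xs b e y y∉ = trans (sym (update-other ρ x b (λ { refl → y∉ (here refl) }))) (e y (y∉ ∘ there))

-- Branching never touches variables outside `xs`, so a summand only sees assignments that agree
-- with `ρ` there. This lets a quantity determined by outside variables be pulled out of a count.
cnt-local : ∀ xs {F G} ρ → (∀ ρ′ → ρ ≈[ xs ] ρ′ → F ρ′ ≡ G ρ′) → cnt xs F ρ ≡ cnt xs G ρ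
cnt-local []       ρ e = e ρ (λ _ _ → refl)
cnt-local (x ∷ xs) ρ e =
  cong₂ _+_ (cnt-local xs _ λ ρ′ a → e ρ′ (≈-step ρ x xs true a))
            (cnt-local xs _ λ ρ′ a → e ρ′ (≈-step ρ x xs false a))

cnt-cong : ∀ xs {F G} ρ → F ≗ G → cnt xs F ρ ≡ cnt xs G ρ
cnt-cong xs ρ e = cnt-local xs ρ (λ ρ′ _ → e ρ′)

cnt-0 : ∀ xs ρ → cnt xs (λ _ → 0) ρ ≡ 0
cnt-0 []       ρ = refl
cnt-0 (x ∷ xs) ρ = cong₂ _+_ (cnt-0 xs _) (cnt-0 xs _)

cnt-+ : ∀ xs F G ρ → cnt xs (λ ρ → F ρ + G ρ) ρ ≡ cnt xs F ρ + cnt xs G ρ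
cnt-+ []       F G ρ = refl
cnt-+ (x ∷ xs) F G ρ = trans (cong₂ _+_ (cnt-+ xs F G _) (cnt-+ xs F G _))
  (interchange (cnt xs F (update ρ x true)) _ (cnt xs F (update ρ x false)) _)

cnt-* : ∀ xs c G ρ → cnt xs (λ ρ → c * G ρ) ρ ≡ c * cnt xs G ρ
cnt-* []       c G ρ = refl
cnt-* (x ∷ xs) c G ρ = trans (cong₂ _+_ (cnt-* xs c G _) (cnt-* xs c G _)) (sym (*-distribˡ-+ c _ _))

cnt-sum : ∀ {I : Set} xs (is : List I) (F : I → (ℕ → Bool) → ℕ) ρ →
  cnt xs (λ ρ → sum (map (λ i → F i ρ) is)) ρ ≡ sum (map (λ i → cnt xs (F i) ρ) is)
cnt-sum xs []       F ρ = cnt-0 xs ρ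
cnt-sum xs (i ∷ is) F ρ = trans (cnt-+ xs (F i) _ ρ) (cong (cnt xs (F i) ρ +_) (cnt-sum xs is F ρ))

cnt-swap : ∀ x y F → Ext F → ∀ ρ → cnt (x ∷ y ∷ []) F ρ ≡ cnt (y ∷ x ∷ []) F ρ
cnt-swap x y F eF ρ with x ≟ y
... | yes refl = refl
... | no x≢y = trans
  (cong₂ _+_ (cong₂ _+_ (eF (update-comm ρ _ _ x≢y)) (eF (update-comm ρ _ _ x≢y)))
             (cong₂ _+_ (eF (update-comm ρ _ _ x≢y)) (eF (update-comm ρ _ _ x≢y))))
  (interchange (F (update (update ρ y true) x true)) _ _ _)

cnt-↭ : ∀ {xs ys} → xs ↭ ys → ∀ {F} → Ext F → ∀ ρ → cnt xs F ρ ≡ cnt ys F ρ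
cnt-↭ Perm.refl eF ρ = refl
cnt-↭ (Perm.prep x p) eF ρ = cong₂ _+_ (cnt-↭ p eF _) (cnt-↭ p eF _)
cnt-↭ {x ∷ y ∷ xs} {y ∷ x ∷ ys} (Perm.swap x y p) {F} eF ρ = trans
  (cnt-swap x y (cnt xs F) (cnt-ext xs eF) ρ)
  (cnt-cong (y ∷ x ∷ []) ρ (cnt-↭ p eF))
cnt-↭ (Perm.trans p q) eF ρ = trans (cnt-↭ p eF ρ) (cnt-↭ q eF ρ)

units : List PLit → TwoSAT
units = map one

-- Distinct variables make the unit clauses independent: at each variable one branch satisfies its
-- literal and the other contributes 0, so exactly one assignment survives.
cnt-units : ∀ P → Unique (map litVar P) → ∀ c ρ →
  cnt (map litVar P) (λ ρ → bool→ℕ (all (evalClause2 ρ) (units P)) * c) ρ ≡ c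
cnt-units []            []       c ρ = *-identityˡ c
cnt-units ((s , x) ∷ P) (x∉ ∷ u) c ρ = begin
  cnt xs F (update ρ x true) + cnt xs F (update ρ x false)
    ≡⟨ cong₂ _+_ (branch true) (branch false) ⟩
  bool→ℕ (if s then true else false) * c + bool→ℕ (if s then false else true) * c
    ≡⟨ total s ⟩
  c ∎
  where
  xs = map litVar P
  F  = λ ρ → bool→ℕ (all (evalClause2 ρ) (units ((s , x) ∷ P))) * c
  total : ∀ s → bool→ℕ (if s then true else false) * c + bool→ℕ (if s then false else true) * c ≡ c
  total true  = trans (+-identityʳ _) (*-identityˡ c)
  total false = *-identityˡ c
  x∉xs : x ∉ xs
  x∉xs x∈ = Allₚ.All¬⇒¬Any x∉ x∈
  factor : ∀ b m → bool→ℕ (b ∧ m) * c ≡ bool→ℕ b * (bool→ℕ m * c)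
  factor true  m = sym (*-identityˡ _)
  factor false m = refl
  sign-value : ∀ s b → (if s then b else not b) ≡ (if b then (if s then true else false) else (if s then false else true))
  sign-value true  true  = refl
  sign-value true  false = refl
  sign-value false true  = refl
  sign-value false false = refl
  branch : ∀ b → cnt xs F (update ρ x b) ≡ bool→ℕ (if b then (if s then true else false) else (if s then false else true)) * c
  branch b = begin
    cnt xs F (update ρ x b)
      -- `x` does not occur in `xs`, so the value `b` set by this branch is still in place when the
      -- inner count evaluates the literal.
      ≡⟨ cnt-local xs _ (λ ρ′ e → trans
           (cong (λ z → bool→ℕ ((if s then z else not z) ∧ all (evalClause2 ρ′) (units P)) * c)
             (trans (sym (e x x∉xs)) (update-same ρ x b)))
           (trans (factor (if s then b else not b) _) (cong (λ z → bool→ℕ z * _) (sign-value s b)))) ⟩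
    cnt xs (λ ρ′ → k * (bool→ℕ (all (evalClause2 ρ′) (units P)) * c)) (update ρ x b)
      ≡⟨ cnt-* xs k _ _ ⟩
    k * cnt xs (λ ρ′ → bool→ℕ (all (evalClause2 ρ′) (units P)) * c) (update ρ x b)
      ≡⟨ cong (k *_) (cnt-units P u c _) ⟩
    k * c ∎
    where k = bool→ℕ (if b then (if s then true else false) else (if s then false else true))

all-units-cong : ∀ P {ρ ρ′} → (∀ x → x ∈ map litVar P → ρ x ≡ ρ′ x) →
  all (evalClause2 ρ) (units P) ≡ all (evalClause2 ρ′) (units P)
all-units-cong []            e = refl
all-units-cong ((s , x) ∷ P) e =
  cong₂ _∧_ (cong (λ z → if s then z else not z) (e x (here refl))) (all-units-cong P (λ y → e y ∘ there))

-- Once the unit clauses P fix their variables, only the count over the remaining variables is left.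
cnt-units-++ : ∀ P {xs} ys → map litVar P ≡ xs → Unique xs → Disjoint xs ys → ∀ G c ρ →
  (∀ ρ′ → ρ ≈[ xs ] ρ′ → cnt ys G ρ′ ≡ c) →
  cnt (xs ++ ys) (λ ρ → bool→ℕ (all (evalClause2 ρ) (units P)) * G ρ) ρ ≡ c
cnt-units-++ P ys refl u d G c ρ h = begin
  cnt (xs ++ ys) (λ ρ → M ρ * G ρ) ρ          ≡⟨ cnt-++ xs ys _ ρ ⟩
  cnt xs (cnt ys (λ ρ → M ρ * G ρ)) ρ
    ≡⟨ cnt-cong xs ρ (λ ρ′ → cnt-local ys {F = λ ρ → M ρ * G ρ} {G = λ ρ″ → M ρ′ * G ρ″} ρ′ (λ ρ″ e →
         cong (λ z → bool→ℕ z * G ρ″) (all-units-cong P (λ x x∈ → sym (e x (λ x∈ys → d (x∈ , x∈ys))))))) ⟩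
  cnt xs (λ ρ′ → cnt ys (λ ρ″ → M ρ′ * G ρ″) ρ′) ρ ≡⟨ cnt-cong xs ρ (λ ρ′ → cnt-* ys (M ρ′) G ρ′) ⟩
  cnt xs (λ ρ′ → M ρ′ * cnt ys G ρ′) ρ         ≡⟨ cnt-local xs ρ (λ ρ′ e → cong (M ρ′ *_) (h ρ′ e)) ⟩
  cnt xs (λ ρ′ → M ρ′ * c) ρ                   ≡⟨ cnt-units P u c ρ ⟩
  c ∎
  where
  xs = map litVar P
  M  = λ ρ → bool→ℕ (all (evalClause2 ρ) (units P))

-- The reduction

Word : Set
Word = List Bool

fromBits : Word → ℕᵇ
fromBits []          = ℕᵇ.zero
fromBits (false ∷ w) = 1+[2 fromBits w ]
fromBits (true ∷ w)  = 2[1+ fromBits w ]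

-- Bijective base 2 makes every bit word the numeral of a variable.
nm : Word → ℕ
nm w = ℕᵇ.toℕ (fromBits w)

digits-nm : ∀ w → digitsᵇ (ℕᵇ.fromℕ (nm w)) ≡ map bit w
digits-nm w = trans (cong digitsᵇ (ℕᵇₚ.fromℕ-toℕ (fromBits w))) (go w)
  where
  go : ∀ w → digitsᵇ (fromBits w) ≡ map bit w
  go []          = refl
  go (false ∷ w) = cong (s0 ∷_) (go w)
  go (true ∷ w)  = cong (s1 ∷_) (go w)

fromBits-injective : ∀ u w → fromBits u ≡ fromBits w → u ≡ w
fromBits-injective []          []          _ = refl
fromBits-injective []          (false ∷ w) ()
fromBits-injective []          (true ∷ w)  ()
fromBits-injective (false ∷ u) []          ()
fromBits-injective (true ∷ u)  []          ()
fromBits-injective (false ∷ u) (false ∷ w) e = cong (false ∷_) (fromBits-injective u w (ℕᵇₚ.1+[2_]-injective e))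
fromBits-injective (true ∷ u)  (true ∷ w)  e = cong (true ∷_) (fromBits-injective u w (ℕᵇₚ.2[1+_]-injective e))
fromBits-injective (false ∷ u) (true ∷ w)  ()
fromBits-injective (true ∷ u)  (false ∷ w) ()

nm-injective : ∀ u w → nm u ≡ nm w → u ≡ w
nm-injective u w e = fromBits-injective u w (ℕᵇₚ.toℕ-injective e)

eqFin-refl : ∀ {n} (a : Fin n) → eqFin a a ≡ true
eqFin-refl a = ≡ᵇ-refl (toℕ a)

eqFin-true : ∀ {n} {a b : Fin n} → eqFin a b ≡ true → a ≡ b
eqFin-true e = toℕ-injective (≡ᵇ-true _ _ e)

eqTuple-refl : ∀ {n k} (t : Vec (Fin n) k) → eqTuple t t ≡ true
eqTuple-refl []      = refl
eqTuple-refl (a ∷ t) rewrite eqFin-refl a = eqTuple-refl t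

eqTuple-true : ∀ {n k} (t u : Vec (Fin n) k) → eqTuple t u ≡ true → t ≡ u
eqTuple-true []      []      _ = refl
eqTuple-true (a ∷ t) (b ∷ u) e with eqFin a b in p
... | true = cong₂ _∷_ (eqFin-true p) (eqTuple-true t u e)

-- All one-hot codes have length n, so tuples are uniquely decodable from their concatenation,
-- and a loop with equality tests can print it.
hot : ∀ {n} → Fin n → Word
hot {n} a = map (λ b → eqFin b a) (allFin n)

hots : ∀ {n k} → Vec (Fin n) k → Word
hots []      = []
hots (a ∷ t) = hot a ++ hots t

-- After the address `w` of an operator, the bit `true` introduces its own variables, while the bit
-- `false` leads on to its operands; the two kinds of names can therefore never coincide.
vn : ∀ {n k} → Word → Vec (Fin n) k → ℕ
vn w t = nm (w ++ true ∷ hots t)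

map-≡⇒pointwise : ∀ {A B : Set} {f g : A → B} xs → map f xs ≡ map g xs → ∀ {x} → x ∈ xs → f x ≡ g x
map-≡⇒pointwise (x ∷ xs) e (here refl) = proj₁ (∷-injective e)
map-≡⇒pointwise (x ∷ xs) e (there x∈)  = map-≡⇒pointwise xs (proj₂ (∷-injective e)) x∈

hot-injective : ∀ {n} {a b : Fin n} → hot a ≡ hot b → a ≡ b
hot-injective {n} {a} e = eqFin-true (trans (sym (map-≡⇒pointwise (allFin n) e (∈-allFin a))) (eqFin-refl a))

++-split : ∀ {A : Set} (xs ys : List A) {us vs} → length xs ≡ length ys → xs ++ us ≡ ys ++ vs → xs ≡ ys × us ≡ vs
++-split []       []       _ e = refl , e
++-split (x ∷ xs) (y ∷ ys) l e with refl , e′ ← ∷-injective e with refl , e″ ← ++-split xs ys (suc-injective l) e′ = refl , e″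

hots-injective : ∀ {n k} (t u : Vec (Fin n) k) → hots t ≡ hots u → t ≡ u
hots-injective []      []      _ = refl
hots-injective {n} (a ∷ t) (b ∷ u) e
  with p , q ← ++-split (hot a) (hot b) (trans (length-map (λ c → eqFin c a) (allFin n)) (sym (length-map (λ c → eqFin c b) (allFin n)))) e
  = cong₂ _∷_ (hot-injective p) (hots-injective t u q)

vn-injective : ∀ {n k} w {t u : Vec (Fin n) k} → vn w t ≡ vn w u → t ≡ u
vn-injective w {t} {u} e =
  hots-injective t u (∷-injectiveʳ (++-cancelˡ w _ _ (nm-injective (w ++ true ∷ hots t) (w ++ true ∷ hots u) e)))

∈-allTuples : ∀ {n k} (t : Vec (Fin n) k) → t ∈ allTuples n k
∈-allTuples []      = here refl
∈-allTuples (a ∷ t) = ∈-concatMap⁺ _ (Any.map (λ { refl → ∈-map⁺ (a ∷_) (∈-allTuples t) }) (∈-allFin a))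

allTuples-unique : ∀ n k → Unique (allTuples n k)
allTuples-unique n zero    = [] ∷ []
allTuples-unique n (suc k) = Uniqueₚ.concat⁺
  (Allₚ.map⁺ (All.universal (λ a → Uniqueₚ.map⁺ (λ { refl → refl }) (allTuples-unique n k)) (allFin n)))
  (AllPairsₚ.map⁺ (AllPairs.map (λ a≢b → λ { (p , q) → disjoint a≢b p q }) (Uniqueₚ.allFin⁺ n)))
  where
  disjoint : ∀ {a b : Fin n} → a ≢ b → ∀ {t} → t ∈ map (a ∷_) (allTuples n k) → t ∈ map (b ∷_) (allTuples n k) → ⊥
  disjoint a≢b p q with ∈-map⁻ _ p | ∈-map⁻ _ q
  ... | _ , _ , refl | _ , _ , refl = a≢b refl

-- Sums without number constants: s is replaced by a sum of s true formulae.
data Q (σ : Vocab) : Set where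
  leaf : Σ₂2SAT σ → Q σ
  plus : Q σ → Q σ → Q σ
  sumF : ℕ → Q σ → Q σ
  sumS : ℕ → ℕ → Q σ → Q σ

trueφ falseφ : ∀ {σ} → Σ₂2SAT σ
trueφ  = record { exVars = [] ; allVars = [] ; clauses = [] }
falseφ = record { exVars = [] ; allVars = [] ; clauses = record { φ₁ = inj₂ ⊥ᶠ ; φ₂ = inj₂ ⊥ᶠ ; φ₃ = inj₂ ⊥ᶠ ; hasFO = inj₁ _ } ∷ [] }

constQ : ∀ {σ} → ℕ → Q σ
constQ zero    = leaf falseφ
constQ (suc s) = plus (leaf trueφ) (constQ s)

desugar : ∀ {σ} → ΣQSO σ → Q σ
desugar (fml φ)    = leaf φ
desugar (const s)  = constQ s
desugar (α ⊕ β)    = plus (desugar α) (desugar β)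
desugar (Σᶠ x α)   = sumF x (desugar α)
desugar (Σˢ k X α) = sumS k X (desugar α)

-- The word of the binder of a second-order variable, if it is bound.
Env : Set
Env = ℕ → ℕ → Maybe Word

extend : Env → ℕ → ℕ → Word → Env
extend E k X w k′ X′ with k ℕ.≟ k′ | X ≡ᵇ X′
... | yes refl | true = just w
... | _        | _    = E k′ X′

record WLit : Set where
  constructor wlit
  field
    sign : Bool
    word : Word
    {ar} : ℕ
    args : Vec ℕ ar

data Lits : Set where
  none    : Lits
  single  : WLit → Lits
  double  : WLit → WLit → Lits

-- An unbound second-order variable is read as the empty relation, the value that `count` gives to
-- every second-order variable at the start.
resolveLit : ∀ {σ k} → Bool → Vec ℕ k → Maybe Word → FO σ ⊎ WLit
resolveLit s     xs (just w) = inj₂ (wlit s w xs)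
resolveLit true  xs nothing  = inj₁ ⊥ᶠ
resolveLit false xs nothing  = inj₁ ⊤ᶠ

resolve : ∀ {σ} → Env → Atom σ → FO σ ⊎ WLit
resolve E (inj₁ (lit s k X xs)) = resolveLit s xs (E k X)
resolve E (inj₂ φ)              = inj₁ φ

-- This is where clauses become 2SAT: `ψ` is the atom guaranteed to be first-order, so once all
-- first-order atoms are merged at most two literals are left.
join : ∀ {σ} → FO σ → FO σ ⊎ WLit → FO σ ⊎ WLit → FO σ × Lits
join ψ (inj₁ φ) (inj₁ χ) = ψ ∨ᶠ (φ ∨ᶠ χ) , none
join ψ (inj₁ φ) (inj₂ l) = ψ ∨ᶠ φ , single l
join ψ (inj₂ l) (inj₁ φ) = ψ ∨ᶠ φ , single l
join ψ (inj₂ l) (inj₂ m) = ψ , double l m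

theFO : ∀ {σ} (a : Atom σ) → IsFO a → FO σ
theFO (inj₂ ψ) _ = ψ

split : ∀ {σ} → Env → Clause σ → FO σ × Lits
split E record { φ₁ = a ; φ₂ = b ; φ₃ = c ; hasFO = inj₁ p }        = join (theFO a p) (resolve E b) (resolve E c)
split E record { φ₁ = a ; φ₂ = b ; φ₃ = c ; hasFO = inj₂ (inj₁ p) } = join (theFO b p) (resolve E a) (resolve E c)
split E record { φ₁ = a ; φ₂ = b ; φ₃ = c ; hasFO = inj₂ (inj₂ p) } = join (theFO c p) (resolve E a) (resolve E b)

-- One traversal for both quantifier blocks: over the existential variables it lists disjuncts, over
-- the universal ones it concatenates clauses.
overVars : ∀ {n} {B : Set} → List ℕ → FOAssign n → (FOAssign n → List B) → List B
overVars {n} []       v f = f v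
overVars {n} (x ∷ xs) v f = concatMap (λ a → overVars xs (update v x a) f) (allFin n)

-- A leaf owns no variables, since its literals refer to the bits of enclosing second-order sums.
vars : ∀ {σ} (n : ℕ) → Q σ → Word → List ℕ
vars n (leaf φ)     w = []
vars n (plus α β)   w = vn {n} w [] ∷ vars n α (w ++ false ∷ false ∷ []) ++ vars n β (w ++ false ∷ true ∷ [])
vars n (sumF x α)   w = map (λ a → vn w (a ∷ [])) (allFin n) ++ vars n α (w ++ false ∷ [])
vars n (sumS k X α) w = map (vn w) (allTuples n k) ++ vars n α (w ++ false ∷ [])

neg : ℕ → PLit
neg x = false , x

choose : ∀ {σ} (n : ℕ) → Word → Bool → Q σ → Word → List PLit
choose n w b β u = (b , vn {n} w []) ∷ map neg (vars n β u)

pick : ∀ {n} → Word → Fin n → List PLit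
pick {n} w a = map (λ b → eqFin b a , vn w (b ∷ [])) (allFin n)

tauts : (n k : ℕ) → Word → TwoSAT
tauts n k w = map (λ t → two (true , vn w t) (false , vn w t)) (allTuples n k)

instLit : ∀ {n} → FOAssign n → WLit → PLit
instLit v (wlit s w xs) = s , vn w (Vec.map v xs)

inst : ∀ {n} → FOAssign n → Lits → Clause2
inst v none         = empty
inst v (single l)   = one (instLit v l)
inst v (double l m) = two (instLit v l) (instLit v m)

module Disjuncts {σ : Vocab} (A : Structure σ) where

  private n = card A

  instClause : Env → FOAssign n → Clause σ → TwoSAT
  instClause E v C = if evalFO A (proj₁ (split E C)) v then [] else inst v (proj₂ (split E C)) ∷ []

  D : Q σ → Env → Word → FOAssign n → Disj2
  D (leaf φ) E w v = overVars (Σ₂2SAT.exVars φ) v λ v₁ →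
    overVars (Σ₂2SAT.allVars φ) v₁ (λ v₂ → concatMap (instClause E v₂) (Σ₂2SAT.clauses φ)) ∷ []
  D (plus α β) E w v =
    map (_++ units (choose n w true  β (w ++ false ∷ true ∷ [])))  (D α E (w ++ false ∷ false ∷ []) v) ++
    map (_++ units (choose n w false α (w ++ false ∷ false ∷ []))) (D β E (w ++ false ∷ true ∷ []) v)
  D (sumF x α) E w v =
    concatMap (λ a → map (_++ units (pick w a)) (D α E (w ++ false ∷ []) (update v x a))) (allFin n)
  D (sumS k X α) E w v = map (_++ tauts n k w) (D α (extend E k X w) (w ++ false ∷ []) v)

open Disjuncts

-- Correctness of the reduction

evalDisj2-ext : ∀ φ {ρ ρ′ : ℕ → Bool} → ρ ≗ ρ′ → evalDisj2 ρ φ ≡ evalDisj2 ρ′ φ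
evalDisj2-ext φ {ρ} {ρ′} e = cong or (map-cong (λ d → cong and (map-cong clause d)) φ)
  where
  literal : ∀ l → evalPLit ρ l ≡ evalPLit ρ′ l
  literal (s , x) = cong (λ b → if s then b else not b) (e x)
  clause : ∀ c → evalClause2 ρ c ≡ evalClause2 ρ′ c
  clause empty     = refl
  clause (one l)   = literal l
  clause (two l m) = cong₂ _∨_ (literal l) (literal m)

module _ {A : Set} (p : A → Bool) where

  all-++ : ∀ xs ys → all p (xs ++ ys) ≡ all p xs ∧ all p ys
  all-++ []       ys = refl
  all-++ (x ∷ xs) ys = trans (cong (p x ∧_) (all-++ xs ys)) (sym (∧-assoc (p x) _ _))

  any-++ : ∀ xs ys → any p (xs ++ ys) ≡ any p xs ∨ any p ys
  any-++ []       ys = refl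
  any-++ (x ∷ xs) ys = trans (cong (p x ∨_) (any-++ xs ys)) (sym (∨-assoc (p x) _ _))

  all-concatMap : ∀ {B : Set} (f : B → List A) xs → all p (concatMap f xs) ≡ all (all p ∘ f) xs
  all-concatMap f []       = refl
  all-concatMap f (x ∷ xs) = trans (all-++ (f x) _) (cong (all p (f x) ∧_) (all-concatMap f xs))

  any-concatMap : ∀ {B : Set} (f : B → List A) xs → any p (concatMap f xs) ≡ any (any p ∘ f) xs
  any-concatMap f []       = refl
  any-concatMap f (x ∷ xs) = trans (any-++ (f x) _) (cong (any p (f x) ∨_) (any-concatMap f xs))

  all-lookup : ∀ {xs x} → all p xs ≡ true → x ∈ xs → p x ≡ true
  all-lookup {y ∷ _} e (here refl) with p y
  ... | true = refl
  all-lookup {y ∷ _} e (there x∈) with p y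
  ... | true = all-lookup e x∈

  any-∈ : ∀ {xs x} → x ∈ xs → p x ≡ true → any p xs ≡ true
  any-∈ {y ∷ _}  (here refl) e rewrite e = refl
  any-∈ {y ∷ ys} (there x∈)  e = trans (cong (p y ∨_) (any-∈ x∈ e)) (∨-zeroʳ (p y))

  any-∈⁻ : ∀ xs → any p xs ≡ true → ∃ λ x → x ∈ xs × p x ≡ true
  any-∈⁻ (x ∷ xs) e with p x in px
  ... | true  = x , here refl , px
  ... | false with y , y∈ , py ← any-∈⁻ xs e = y , there y∈ , py

  any-map-++ : ∀ ds u → any (all p) (map (_++ u) ds) ≡ any (all p) ds ∧ all p u
  any-map-++ []       u = refl
  any-map-++ (d ∷ ds) u rewrite all-++ d u | any-map-++ ds u with all p d | any (all p) ds
  ... | true  | true  = ∨-idem (all p u)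
  ... | true  | false = ∨-identityʳ (all p u)
  ... | false | b     = refl

bool→ℕ-disjoint : ∀ a b l r → l ∧ r ≡ false →
  bool→ℕ ((a ∧ l) ∨ (b ∧ r)) ≡ bool→ℕ l * bool→ℕ a + bool→ℕ r * bool→ℕ b
bool→ℕ-disjoint true  true  true  false _ = refl
bool→ℕ-disjoint true  true  false true  _ = refl
bool→ℕ-disjoint true  true  false false _ = refl
bool→ℕ-disjoint true  false true  false _ = refl
bool→ℕ-disjoint true  false false true  _ = refl
bool→ℕ-disjoint true  false false false _ = refl
bool→ℕ-disjoint false true  true  false _ = refl
bool→ℕ-disjoint false true  false true  _ = refl
bool→ℕ-disjoint false true  false false _ = refl
bool→ℕ-disjoint false false true  false _ = refl
bool→ℕ-disjoint false false false true  _ = refl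
bool→ℕ-disjoint false false false false _ = refl

-- At most one index satisfies `m`, and it occurs at most once in `xs`, so at most one summand is
-- nonzero and the disjunction adds up like a sum.
bool→ℕ-any : ∀ {I : Set} (e m : I → Bool) xs → Unique xs →
  (∀ {i j} → m i ≡ true → m j ≡ true → i ≡ j) →
  bool→ℕ (any (λ i → e i ∧ m i) xs) ≡ sum (map (λ i → bool→ℕ (m i) * bool→ℕ (e i)) xs)
bool→ℕ-any e m []       _        excl = refl
bool→ℕ-any e m (x ∷ xs) (x∉ ∷ u) excl = trans
  (cong (λ b → bool→ℕ ((e x ∧ m x) ∨ b)) (sym (∧-identityʳ (any em xs))))
  (trans (head-tail (m x) refl) (cong (bool→ℕ (m x) * bool→ℕ (e x) +_) (bool→ℕ-any e m xs u excl)))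
  where
  em = λ i → e i ∧ m i
  tail-false : m x ≡ true → ∀ ys → All (x ≢_) ys → any em ys ≡ false
  tail-false mx []       []         = refl
  tail-false mx (y ∷ ys) (x≢y ∷ x∉) with m y in my
  ... | true  = ⊥-elim (x≢y (excl mx my))
  ... | false rewrite ∧-zeroʳ (e y) = tail-false mx ys x∉
  head-tail : ∀ b → m x ≡ b → bool→ℕ ((e x ∧ m x) ∨ (any em xs ∧ true)) ≡ bool→ℕ (m x) * bool→ℕ (e x) + bool→ℕ (any em xs)
  head-tail true  mx rewrite mx | tail-false mx xs x∉ with e x
  ... | true  = refl
  ... | false = refl
  head-tail false mx rewrite mx | ∧-zeroʳ (e x) = cong bool→ℕ (∧-identityʳ (any em xs))

any-overVars : ∀ {n} {B : Set} (p : B → Bool) xs (v : FOAssign n) f → any p (overVars xs v f) ≡ existsVars xs v (any p ∘ f)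
any-overVars p []       v f = refl
any-overVars p (x ∷ xs) v f = trans (any-concatMap p (λ a → overVars xs (update v x a) f) (allFin _)) (cong or (map-cong (λ a → any-overVars p xs (update v x a) f) (allFin _)))

all-overVars : ∀ {n} {B : Set} (p : B → Bool) xs (v : FOAssign n) f → all p (overVars xs v f) ≡ forallVars xs v (all p ∘ f)
all-overVars p []       v f = refl
all-overVars p (x ∷ xs) v f = trans (all-concatMap p (λ a → overVars xs (update v x a) f) (allFin _)) (cong and (map-cong (λ a → all-overVars p xs (update v x a) f) (allFin _)))

existsVars-cong : ∀ {n} xs (v : FOAssign n) {P P′ : FOAssign n → Bool} → P ≗ P′ → existsVars xs v P ≡ existsVars xs v P′
existsVars-cong []       v e = e v
existsVars-cong (x ∷ xs) v e = cong or (map-cong (λ a → existsVars-cong xs (update v x a) e) (allFin _))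

forallVars-cong : ∀ {n} xs (v : FOAssign n) {P P′ : FOAssign n → Bool} → P ≗ P′ → forallVars xs v P ≡ forallVars xs v P′
forallVars-cong []       v e = e v
forallVars-cong (x ∷ xs) v e = cong and (map-cong (λ a → forallVars-cong xs (update v x a) e) (allFin _))

_≗ₛ_ : ∀ {n} → SOAssign n → SOAssign n → Set
V ≗ₛ V′ = ∀ k X t → V k X t ≡ V′ k X t

updateSO-cong : ∀ {n} {V V′ : SOAssign n} k X {B B′} → V ≗ₛ V′ → B ≗ B′ → updateSO V k X B ≗ₛ updateSO V′ k X B′
updateSO-cong k X e f k′ X′ t with k ℕ.≟ k′ | X ≡ᵇ X′
... | yes refl | true  = f t
... | yes refl | false = e k X′ t
... | no _     | _     = e k′ X′ t

member-∈ : ∀ {n k} (ts : List (Vec (Fin n) k)) {t} → member ts t ≡ true → t ∈ ts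
member-∈ ts {t} e with u , u∈ , p ← any-∈⁻ (eqTuple t) ts e with refl ← eqTuple-true t u p = u∈

member-allTuples : ∀ {n k} (t : Vec (Fin n) k) → member (allTuples n k) t ≡ true
member-allTuples t = any-∈ _ (∈-allTuples t) (eqTuple-refl t)

-- The branch `true` at `t` corresponds to the sublists containing `t`, which `sublists` puts first.
-- For the induction, tuples outside `ts` keep the values given by `ρ`; this part vanishes once `ts`
-- contains every tuple.
cnt-subsets : ∀ {n k} w (g : (Vec (Fin n) k → Bool) → ℕ) → (∀ {B B′} → B ≗ B′ → g B ≡ g B′) →
  ∀ ts → Unique ts → ∀ ρ →
  cnt (map (vn w) ts) (λ ρ → g (λ t → ρ (vn w t))) ρ ≡
  sum (map (λ B → g (λ u → member B u ∨ (not (member ts u) ∧ ρ (vn w u)))) (sublists ts))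
cnt-subsets w g g-ext []       _        ρ = sym (+-identityʳ _)
cnt-subsets w g g-ext (t ∷ ts) (t∉ ∷ u) ρ = begin
  _ ≡⟨ cong₂ _+_ (cnt-subsets w g g-ext ts u _) (cnt-subsets w g g-ext ts u _) ⟩
  sum (map (h true) Ss) + sum (map (h false) Ss)
    ≡⟨ cong₂ _+_ (cong sum (trans (map-cong (λ B → g-ext (with-t B)) Ss) (map-∘ Ss)))
                 (cong sum (map-cong (λ B → g-ext (without-t B)) Ss)) ⟩
  sum (map H (map (t ∷_) Ss)) + sum (map H Ss) ≡⟨ sum-++ (map H (map (t ∷_) Ss)) (map H Ss) ⟨
  sum (map H (map (t ∷_) Ss) ++ map H Ss)      ≡⟨ cong sum (map-++ H (map (t ∷_) Ss) Ss) ⟨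
  sum (map H (map (t ∷_) Ss ++ Ss))            ∎
  where
  Ss = sublists ts
  h = λ b B → g (λ u → member B u ∨ (not (member ts u) ∧ update ρ (vn w t) b (vn w u)))
  H = λ B → g (λ u → member B u ∨ (not (member (t ∷ ts) u) ∧ ρ (vn w u)))
  t∉ts : member ts t ≡ false
  t∉ts with member ts t in e
  ... | false = refl
  ... | true  = ⊥-elim (Allₚ.All¬⇒¬Any t∉ (member-∈ ts e))
  other : ∀ u b → eqTuple u t ≡ false → update ρ (vn w t) b (vn w u) ≡ ρ (vn w u)
  other u b e = update-other ρ (vn w t) b λ p → t≢u (vn-injective w p)
    where
    t≢u : t ≢ u
    t≢u refl with () ← trans (sym (eqTuple-refl t)) e
  with-t : ∀ B u → member B u ∨ (not (member ts u) ∧ update ρ (vn w t) true (vn w u)) ≡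
                   member (t ∷ B) u ∨ (not (member (t ∷ ts) u) ∧ ρ (vn w u))
  with-t B u with eqTuple u t in e
  ... | false = cong (λ b → member B u ∨ (not (member ts u) ∧ b)) (other u true e)
  ... | true with refl ← eqTuple-true u t e
    rewrite t∉ts | update-same ρ (vn w t) true = ∨-zeroʳ (member B t)
  without-t : ∀ B u → member B u ∨ (not (member ts u) ∧ update ρ (vn w t) false (vn w u)) ≡
                      member B u ∨ (not (member (t ∷ ts) u) ∧ ρ (vn w u))
  without-t B u with eqTuple u t in e
  ... | false = cong (λ b → member B u ∨ (not (member ts u) ∧ b)) (other u false e)
  ... | true with refl ← eqTuple-true u t e
    rewrite t∉ts | update-same ρ (vn w t) false = refl

-- Disjointness of variable names by prefixes

Below : Word → Word → List ℕ → Set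
Below w p xs = ∀ {x} → x ∈ xs → ∃ λ u → x ≡ nm (w ++ p ++ u)

below-sub : ∀ w p {xs} → Below (w ++ p) [] xs → Below w p xs
below-sub w p b x∈ with u , refl ← b x∈ = u , cong nm (++-assoc w p u)

below-root : ∀ w p {xs} → Below w p xs → Below w [] xs
below-root w p b x∈ with u , refl ← b x∈ = p ++ u , refl

below-++ : ∀ w p {xs ys} → Below w p xs → Below w p ys → Below w p (xs ++ ys)
below-++ w p {xs} bx by x∈ with ∈-++⁻ xs x∈
... | inj₁ x∈xs = bx x∈xs
... | inj₂ x∈ys = by x∈ys

below-∷ : ∀ w p {x xs} → (∃ λ u → x ≡ nm (w ++ p ++ u)) → Below w p xs → Below w p (x ∷ xs)
below-∷ w p b bs (here refl) = b
below-∷ w p b bs (there x∈)  = bs x∈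

below-map-vn : ∀ {I : Set} {n k} w (f : I → Vec (Fin n) k) is → Below w (true ∷ []) (map (vn w ∘ f) is)
below-map-vn w f is x∈ with i , _ , refl ← ∈-map⁻ _ x∈ = hots (f i) , refl

-- `nm` is injective, so equal names have equal words; cancelling the common prefix `w` leaves
-- continuations of `p` and of `q`, which `ne` rules out.
below-disjoint : ∀ w p q {xs ys} → (∀ u u′ → p ++ u ≢ q ++ u′) → Below w p xs → Below w q ys → Disjoint xs ys
below-disjoint w p q ne bx by (x∈ , y∈) with bx x∈ | by y∈
... | u , refl | u′ , e = ne u u′ (++-cancelˡ w _ _ (nm-injective (w ++ p ++ u) (w ++ q ++ u′) e))

vars-below : ∀ {σ} n (α : Q σ) w → Below w [] (vars n α w)
vars-below n (leaf φ)     w ()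
vars-below n (plus α β)   w = below-∷ w [] (_ , refl) (below-++ w []
  (below-root w (false ∷ false ∷ []) (below-sub w _ (vars-below n α _)))
  (below-root w (false ∷ true ∷ []) (below-sub w _ (vars-below n β _))))
vars-below n (sumF x α)   w = below-++ w [] (below-root w (true ∷ []) (below-map-vn w (_∷ []) (allFin n)))
  (below-root w (false ∷ []) (below-sub w _ (vars-below n α _)))
vars-below n (sumS k X α) w = below-++ w [] (below-root w (true ∷ []) (below-map-vn w id (allTuples n k)))
  (below-root w (false ∷ []) (below-sub w _ (vars-below n α _)))

selector-disjoint : ∀ {σ} n (α : Q σ) w p {xs} → Below w (true ∷ []) xs → Disjoint xs (vars n α (w ++ false ∷ p))
selector-disjoint n α w p b = below-disjoint w (true ∷ []) (false ∷ p) (λ _ _ ()) b (below-sub w _ (vars-below n α _))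

single-below : ∀ {n} w → Below w (true ∷ []) (vn {n} w [] ∷ [])
single-below w (here refl) = [] , refl

summands-disjoint : ∀ {σ} n (α β : Q σ) w → Disjoint (vars n α (w ++ false ∷ false ∷ [])) (vars n β (w ++ false ∷ true ∷ []))
summands-disjoint n α β w = below-disjoint w (false ∷ false ∷ []) (false ∷ true ∷ []) (λ _ _ ())
  (below-sub w _ (vars-below n α _)) (below-sub w _ (vars-below n β _))

∷-unique : ∀ {x : ℕ} {xs} → Disjoint (x ∷ []) xs → Unique xs → Unique (x ∷ xs)
∷-unique d u = Uniqueₚ.++⁺ ([] ∷ []) u d

disjoint-++ : ∀ {xs ys zs : List ℕ} → Disjoint xs ys → Disjoint xs zs → Disjoint xs (ys ++ zs)
disjoint-++ {ys = ys} d e (x∈ , y∈) with ∈-++⁻ ys y∈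
... | inj₁ p = d (x∈ , p)
... | inj₂ p = e (x∈ , p)

selectors-unique : ∀ n w → Unique (map (λ a → vn w (a ∷ [])) (allFin n))
selectors-unique n w = Uniqueₚ.map⁺ (λ e → cong Vec.head (vn-injective w {_ ∷ []} {_ ∷ []} e)) (Uniqueₚ.allFin⁺ n)

tuples-unique : ∀ n k w → Unique (map (vn w) (allTuples n k))
tuples-unique n k w = Uniqueₚ.map⁺ {f = vn w} (vn-injective w) (allTuples-unique n k)

vars-unique : ∀ {σ} n (α : Q σ) w → Unique (vars n α w)
vars-unique n (leaf φ)     w = []
vars-unique n (plus α β)   w = ∷-unique
  (disjoint-++ (selector-disjoint n α w _ (single-below {n} w)) (selector-disjoint n β w _ (single-below {n} w)))
  (Uniqueₚ.++⁺ (vars-unique n α _) (vars-unique n β _) (summands-disjoint n α β w))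
vars-unique n (sumF x α)   w = Uniqueₚ.++⁺ (selectors-unique n w) (vars-unique n α _)
  (selector-disjoint n α w [] (below-map-vn w (_∷ []) (allFin n)))
vars-unique n (sumS k X α) w = Uniqueₚ.++⁺ (tuples-unique n k w) (vars-unique n α _)
  (selector-disjoint n α w [] (below-map-vn w id (allTuples n k)))

choose-vars : ∀ {σ} n w b (β : Q σ) u → map litVar (choose n w b β u) ≡ vn {n} w [] ∷ vars n β u
choose-vars n w b β u = cong (vn {n} w [] ∷_) (trans (sym (map-∘ (vars n β u))) (map-id _))

-- The two blocks force the variable at position `a` to `eqFin a a` and to `eqFin a b`, so this
-- single position decides.
pick-exclusive : ∀ {n} w ρ {a b : Fin n} → all (evalClause2 ρ) (units (pick w a)) ≡ true →
  all (evalClause2 ρ) (units (pick w b)) ≡ true → a ≡ b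
pick-exclusive {n} w ρ {a} {b} ea eb = eqFin-true (trans (sym (at b eb)) (trans (at a ea) (eqFin-refl a)))
  where
  value : ∀ s x → (if s then x else not x) ≡ true → x ≡ s
  value true  true  _ = refl
  value false false _ = refl
  at : ∀ c → all (evalClause2 ρ) (units (pick w c)) ≡ true → ρ (vn w (a ∷ [])) ≡ eqFin a c
  at c e = value (eqFin a c) _ (all-lookup (evalClause2 ρ) e (∈-map⁺ one (∈-map⁺ _ (∈-allFin a))))

-- The count of satisfying assignments by induction on the sentence

module Counting {σ : Vocab} (A : Structure σ) where

  private n = card A

  ⟦_⟧Q : Q σ → FOAssign n → SOAssign n → ℕ
  ⟦ leaf φ ⟧Q     v V = bool→ℕ (evalΣ₂ A φ v V)
  ⟦ plus α β ⟧Q   v V = ⟦ α ⟧Q v V + ⟦ β ⟧Q v V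
  ⟦ sumF x α ⟧Q   v V = sum (map (λ a → ⟦ α ⟧Q (update v x a) V) (allFin n))
  ⟦ sumS k X α ⟧Q v V = sum (map (λ B → ⟦ α ⟧Q v (updateSO V k X (member B))) (sublists (allTuples n k)))

  desugar-correct : ∀ α v V → ⟦ desugar α ⟧Q v V ≡ ⟦ α ⟧ A v V
  desugar-correct (fml φ)    v V = refl
  desugar-correct (const s)  v V = go s
    where
    go : ∀ s → ⟦ constQ s ⟧Q v V ≡ s
    go zero    = refl
    go (suc s) = cong suc (go s)
  desugar-correct (α ⊕ β)    v V = cong₂ _+_ (desugar-correct α v V) (desugar-correct β v V)
  desugar-correct (Σᶠ x α)   v V = cong sum (map-cong (λ a → desugar-correct α (update v x a) V) (allFin n))
  desugar-correct (Σˢ k X α) v V = cong sum (map-cong (λ B → desugar-correct α v (updateSO V k X (member B))) (sublists (allTuples n k)))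

  evalAtom-cong : ∀ a v {V V′} → V ≗ₛ V′ → evalAtom A a v V ≡ evalAtom A a v V′
  evalAtom-cong (inj₁ (lit s k X xs)) v e = cong (λ b → if s then b else not b) (e k X _)
  evalAtom-cong (inj₂ φ)              v e = refl

  ⟦⟧Q-cong : ∀ α v {V V′} → V ≗ₛ V′ → ⟦ α ⟧Q v V ≡ ⟦ α ⟧Q v V′
  ⟦⟧Q-cong (leaf φ)     v e = cong bool→ℕ
    (existsVars-cong (Σ₂2SAT.exVars φ) v λ v₁ → forallVars-cong (Σ₂2SAT.allVars φ) v₁ λ v₂ →
      cong and (map-cong (λ C → cong₂ _∨_ (evalAtom-cong (Clause.φ₁ C) v₂ e)
        (cong₂ _∨_ (evalAtom-cong (Clause.φ₂ C) v₂ e) (evalAtom-cong (Clause.φ₃ C) v₂ e))) (Σ₂2SAT.clauses φ)))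
  ⟦⟧Q-cong (plus α β)   v e = cong₂ _+_ (⟦⟧Q-cong α v e) (⟦⟧Q-cong β v e)
  ⟦⟧Q-cong (sumF x α)   v e = cong sum (map-cong (λ a → ⟦⟧Q-cong α _ e) (allFin n))
  ⟦⟧Q-cong (sumS k X α) v e =
    cong sum (map-cong (λ B → ⟦⟧Q-cong α v (updateSO-cong k X e (λ _ → refl))) (sublists (allTuples n k)))

  -- The relation of a bound second-order variable is read off the bits of its binder, so the
  -- induction carries one propositional assignment instead of a separate second-order one.
  Vof : Env → (ℕ → Bool) → SOAssign n
  Vof E ρ k X t = maybe (λ w → ρ (vn w t)) false (E k X)

  Vof-extend : ∀ E ρ k X w → updateSO (Vof E ρ) k X (λ t → ρ (vn w t)) ≗ₛ Vof (extend E k X w) ρ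
  Vof-extend E ρ k X w k′ X′ t with k ℕ.≟ k′ | X ≡ᵇ X′
  ... | yes refl | true  = refl
  ... | yes refl | false = refl
  ... | no _     | _     = refl

  evalRes : FO σ ⊎ WLit → FOAssign n → (ℕ → Bool) → Bool
  evalRes (inj₁ φ) v ρ = evalFO A φ v
  evalRes (inj₂ l) v ρ = evalPLit ρ (instLit v l)

  resolve-correct : ∀ E a v ρ → evalRes (resolve E a) v ρ ≡ evalAtom A a v (Vof E ρ)
  resolve-correct E (inj₂ φ)                  v ρ = refl
  resolve-correct E (inj₁ (lit s k X xs))     v ρ with E k X
  ... | just w = refl
  resolve-correct E (inj₁ (lit true k X xs))  v ρ | nothing = refl
  resolve-correct E (inj₁ (lit false k X xs)) v ρ | nothing = refl

  evalSplit : FO σ × Lits → FOAssign n → (ℕ → Bool) → Bool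
  evalSplit (ψ , ls) v ρ = evalFO A ψ v ∨ evalClause2 ρ (inst v ls)

  join-correct : ∀ ψ a b v ρ → evalSplit (join ψ a b) v ρ ≡ evalFO A ψ v ∨ (evalRes a v ρ ∨ evalRes b v ρ)
  join-correct ψ (inj₁ φ) (inj₁ χ) v ρ = ∨-identityʳ _
  join-correct ψ (inj₁ φ) (inj₂ l) v ρ = ∨-assoc (evalFO A ψ v) _ _
  join-correct ψ (inj₂ l) (inj₁ φ) v ρ = trans (∨-assoc (evalFO A ψ v) _ _) (cong (evalFO A ψ v ∨_) (∨-comm (evalFO A φ v) _))
  join-correct ψ (inj₂ l) (inj₂ m) v ρ = refl

  split-correct : ∀ E C v ρ → evalSplit (split E C) v ρ ≡ evalClause A C v (Vof E ρ)
  split-correct E C v ρ = go C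
    where
    value : Atom σ → Bool
    value a = evalAtom A a v (Vof E ρ)
    joined : ∀ a p b c → evalSplit (join (theFO a p) (resolve E b) (resolve E c)) v ρ ≡ value a ∨ (value b ∨ value c)
    joined (inj₂ ψ) p b c = trans (join-correct ψ (resolve E b) (resolve E c) v ρ)
      (cong (evalFO A ψ v ∨_) (cong₂ _∨_ (resolve-correct E b v ρ) (resolve-correct E c v ρ)))
    exchange : ∀ x y z → x ∨ (y ∨ z) ≡ y ∨ (x ∨ z)
    exchange x y z = trans (sym (∨-assoc x y z)) (trans (cong (_∨ z) (∨-comm x y)) (∨-assoc y x z))
    go : ∀ C → evalSplit (split E C) v ρ ≡ evalClause A C v (Vof E ρ)
    go record { φ₁ = a ; φ₂ = b ; φ₃ = c ; hasFO = inj₁ p }        = joined a p b c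
    go record { φ₁ = a ; φ₂ = b ; φ₃ = c ; hasFO = inj₂ (inj₁ p) } =
      trans (joined b p a c) (exchange (value b) (value a) (value c))
    go record { φ₁ = a ; φ₂ = b ; φ₃ = c ; hasFO = inj₂ (inj₂ p) } =
      trans (joined c p a b) (trans (∨-comm (value c) _) (∨-assoc (value a) _ _))

  instClause-correct : ∀ E C v ρ → all (evalClause2 ρ) (instClause A E v C) ≡ evalClause A C v (Vof E ρ)
  instClause-correct E C v ρ = trans (conditional (evalFO A (proj₁ (split E C)) v)) (split-correct E C v ρ)
    where
    conditional : ∀ b {c} → all (evalClause2 ρ) (if b then [] else c ∷ []) ≡ b ∨ evalClause2 ρ c
    conditional true  = refl
    conditional false = ∧-identityʳ _

  -- The words `w′ ++ true ∷ u` include those of the bits of a bound relation. Keeping them apart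
  -- from everything below `w` means that counting over variables below `w` leaves the relations of
  -- the environment unchanged.
  Fresh : Env → Word → Set
  Fresh E w = ∀ k X {w′} → E k X ≡ just w′ → ∀ u u′ → w′ ++ true ∷ u ≢ w ++ u′

  fresh-sub : ∀ {E} w p → Fresh E w → Fresh E (w ++ p)
  fresh-sub w p f k X e u u′ q = f k X e u (p ++ u′) (trans q (++-assoc w p u′))

  fresh-extend : ∀ {E} k X w → Fresh E w → Fresh (extend E k X w) (w ++ false ∷ [])
  fresh-extend {E} k X w f k′ X′ e u u′ q with k ℕ.≟ k′ | X ≡ᵇ X′
  fresh-extend {E} k X w f k′ X′ refl u u′ q | yes refl | true
    -- After `w`, the bits of the new binder continue with `true` and the names of its body with
    -- `false`.
    with () ← ++-cancelˡ w _ _ (trans q (++-assoc w (false ∷ []) u′))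
  fresh-extend {E} k X w f k′ X′ e u u′ q | yes refl | false = fresh-sub w (false ∷ []) f k′ X′ e u u′ q
  fresh-extend {E} k X w f k′ X′ e u u′ q | no _ | _ = fresh-sub w (false ∷ []) f k′ X′ e u u′ q

  Vof-local : ∀ E w {xs ρ ρ′} → Fresh E w → Below w [] xs → ρ ≈[ xs ] ρ′ → Vof E ρ ≗ₛ Vof E ρ′
  Vof-local E w f b e k X t with E k X in eq
  ... | nothing = refl
  ... | just w′ = e _ λ x∈ → let (u , p) = b x∈ in f k X eq (hots t) u (nm-injective (w′ ++ true ∷ hots t) (w ++ u) p)

  sat : Disj2 → (ℕ → Bool) → ℕ
  sat φ ρ = bool→ℕ (evalDisj2 ρ φ)

  sat-ext : ∀ φ → Ext (sat φ)
  sat-ext φ e = cong bool→ℕ (evalDisj2-ext φ e)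

  -- `ρ` is arbitrary because enclosing second-order sums have already fixed their bits in it;
  -- freshness ensures that counting over the variables owned below `w` does not alter those bits.
  cnt-D : ∀ α E w v ρ → Fresh E w → cnt (vars n α w) (sat (D A α E w v)) ρ ≡ ⟦ α ⟧Q v (Vof E ρ)
  cnt-D (leaf φ) E w v ρ f = cong bool→ℕ (trans (any-overVars _ (Σ₂2SAT.exVars φ) v _)
    (existsVars-cong (Σ₂2SAT.exVars φ) v λ v₁ → trans (∨-identityʳ _)
      (trans (all-overVars _ (Σ₂2SAT.allVars φ) v₁ _)
        (forallVars-cong (Σ₂2SAT.allVars φ) v₁ λ v₂ → trans (all-concatMap _ _ (Σ₂2SAT.clauses φ))
          (cong and (map-cong (λ C → instClause-correct E C v₂ ρ) (Σ₂2SAT.clauses φ)))))))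
  cnt-D (plus α β) E w v ρ f = begin
    cnt (t ∷ Vα ++ Vβ) (sat (D A (plus α β) E w v)) ρ
      ≡⟨ cnt-cong (t ∷ Vα ++ Vβ) ρ decompose ⟩
    cnt (t ∷ Vα ++ Vβ) (λ ρ → mL ρ * sα ρ + mR ρ * sβ ρ) ρ
      ≡⟨ cnt-+ (t ∷ Vα ++ Vβ) (λ ρ → mL ρ * sα ρ) (λ ρ → mR ρ * sβ ρ) ρ ⟩
    cnt (t ∷ Vα ++ Vβ) (λ ρ → mL ρ * sα ρ) ρ + cnt ((t ∷ Vα) ++ Vβ) (λ ρ → mR ρ * sβ ρ) ρ
      -- The disjuncts of `α` fix `t` and `Vβ`, so these are moved to the front, where
      -- `cnt-units-++` expects the fixed variables.
      ≡⟨ cong (_+ cnt ((t ∷ Vα) ++ Vβ) (λ ρ → mR ρ * sβ ρ) ρ) (cnt-↭ (Perm.prep t (Permₚ.++-comm Vα Vβ)) {λ ρ → mL ρ * sα ρ} (λ e → cong₂ _*_ (m-ext Lᵤ e) (sat-ext (D A α E wα v) e)) ρ) ⟩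
    cnt ((t ∷ Vβ) ++ Vα) (λ ρ → mL ρ * sα ρ) ρ + cnt ((t ∷ Vα) ++ Vβ) (λ ρ → mR ρ * sβ ρ) ρ
      ≡⟨ cong₂ _+_
         (cnt-units-++ Lᵤ Vα (choose-vars n w true β wβ)
           (∷-unique (selector-disjoint n β w _ (single-below {n} w)) (vars-unique n β _))
           (λ { (here refl , q) → selector-disjoint n α w _ (single-below {n} w) (here refl , q)
              ; (there p , q) → summands-disjoint n α β w (q , p) })
           sα _ ρ (λ ρ′ e → trans (cnt-D α E wα v ρ′ (fresh-sub w _ f)) (⟦⟧Q-cong α v (λ k X u → sym (Vof-local E w f
             (below-∷ w [] (_ , refl) (below-root w (false ∷ true ∷ []) (below-sub w _ (vars-below n β _)))) e k X u)))))
         (cnt-units-++ Rᵤ Vβ (choose-vars n w false α wα)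
           (∷-unique (selector-disjoint n α w _ (single-below {n} w)) (vars-unique n α _))
           (λ { (here refl , q) → selector-disjoint n β w _ (single-below {n} w) (here refl , q)
              ; (there p , q) → summands-disjoint n α β w (p , q) })
           sβ _ ρ (λ ρ′ e → trans (cnt-D β E wβ v ρ′ (fresh-sub w _ f)) (⟦⟧Q-cong β v (λ k X u → sym (Vof-local E w f
             (below-∷ w [] (_ , refl) (below-root w (false ∷ false ∷ []) (below-sub w _ (vars-below n α _)))) e k X u))))) ⟩
    ⟦ α ⟧Q v (Vof E ρ) + ⟦ β ⟧Q v (Vof E ρ) ∎
    where
    t  = vn {n} w []
    wα = w ++ false ∷ false ∷ []
    wβ = w ++ false ∷ true ∷ []
    Vα = vars n α wα
    Vβ = vars n β wβ
    Lᵤ  = choose n w true β wβ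
    Rᵤ  = choose n w false α wα
    sα = sat (D A α E wα v)
    sβ = sat (D A β E wβ v)
    mL mR : (ℕ → Bool) → ℕ
    mL ρ = bool→ℕ (all (evalClause2 ρ) (units Lᵤ))
    mR ρ = bool→ℕ (all (evalClause2 ρ) (units Rᵤ))
    m-ext : ∀ P {ρ ρ′} → ρ ≗ ρ′ → bool→ℕ (all (evalClause2 ρ) (units P)) ≡ bool→ℕ (all (evalClause2 ρ′) (units P))
    m-ext P e = cong bool→ℕ (all-units-cong P (λ x _ → e x))
    -- The selector `t` heads both unit blocks with opposite signs, which already makes them
    -- incompatible.
    exclusive : ∀ b x y → (b ∧ x) ∧ (not b ∧ y) ≡ false
    exclusive true  x y = ∧-zeroʳ x
    exclusive false x y = refl
    decompose : ∀ ρ → sat (D A (plus α β) E w v) ρ ≡ mL ρ * sα ρ + mR ρ * sβ ρ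
    decompose ρ = trans
      (cong bool→ℕ (trans (any-++ _ (map (_++ units Lᵤ) (D A α E wα v)) _)
        (cong₂ _∨_ (any-map-++ (evalClause2 ρ) (D A α E wα v) (units Lᵤ)) (any-map-++ (evalClause2 ρ) (D A β E wβ v) (units Rᵤ)))))
      (bool→ℕ-disjoint (evalDisj2 ρ (D A α E wα v)) (evalDisj2 ρ (D A β E wβ v)) _ _ (exclusive (ρ t) _ _))
  cnt-D (sumF x α) E w v ρ f = begin
    cnt (Ts ++ Vα) (sat (D A (sumF x α) E w v)) ρ
      ≡⟨ cnt-cong (Ts ++ Vα) ρ decompose ⟩
    cnt (Ts ++ Vα) (λ ρ → sum (map (λ a → m a ρ * s a ρ) (allFin n))) ρ
      ≡⟨ cnt-sum (Ts ++ Vα) (allFin n) (λ a ρ → m a ρ * s a ρ) ρ ⟩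
    sum (map (λ a → cnt (Ts ++ Vα) (λ ρ → m a ρ * s a ρ) ρ) (allFin n))
      -- The one-hot block of `a` fixes every selector, so only the count over `Vα` is left; the
      -- selectors are not bits of any relation in `E`.
      ≡⟨ cong sum (map-cong (λ a → cnt-units-++ (pick w a) Vα (sym (map-∘ (allFin n)))
           (selectors-unique n w) (selector-disjoint n α w [] Ts-below) (s a) _ ρ
           (λ ρ′ e → trans (cnt-D α E _ _ ρ′ (fresh-sub w _ f))
             (⟦⟧Q-cong α _ (λ k X u → sym (Vof-local E w f (below-root w (true ∷ []) Ts-below) e k X u))))) (allFin n)) ⟩
    sum (map (λ a → ⟦ α ⟧Q (update v x a) (Vof E ρ)) (allFin n)) ∎
    where
    Ts  = map (λ a → vn w (a ∷ [])) (allFin n)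
    Vα = vars n α (w ++ false ∷ [])
    Dα = λ a → D A α E (w ++ false ∷ []) (update v x a)
    s  = λ a → sat (Dα a)
    m : Fin n → (ℕ → Bool) → ℕ
    m a ρ = bool→ℕ (all (evalClause2 ρ) (units (pick w a)))
    Ts-below : Below w (true ∷ []) Ts
    Ts-below = below-map-vn w (_∷ []) (allFin n)
    decompose : ∀ ρ → sat (D A (sumF x α) E w v) ρ ≡ sum (map (λ a → m a ρ * s a ρ) (allFin n))
    decompose ρ = trans
      (cong bool→ℕ (trans (any-concatMap (all (evalClause2 ρ)) (λ a → map (_++ units (pick w a)) (Dα a)) (allFin n))
        (cong or (map-cong (λ a → any-map-++ (evalClause2 ρ) (Dα a) (units (pick w a))) (allFin n)))))
      (bool→ℕ-any (λ a → evalDisj2 ρ (Dα a)) _ (allFin n) (Uniqueₚ.allFin⁺ n) (pick-exclusive w ρ))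
  cnt-D (sumS k X α) E w v ρ f = begin
    cnt (Ts ++ Vα) (sat (D A (sumS k X α) E w v)) ρ
      ≡⟨ cnt-cong (Ts ++ Vα) ρ decompose ⟩
    cnt (Ts ++ Vα) (sat Dα) ρ
      ≡⟨ cnt-++ Ts Vα (sat Dα) ρ ⟩
    cnt Ts (cnt Vα (sat Dα)) ρ
      -- Once `ρ′` has fixed the bits in `Ts`, the body sees the relation that they spell out at `X`
      -- and the relations of `E` unchanged elsewhere.
      ≡⟨ cnt-local Ts ρ (λ ρ′ e → trans (cnt-D α E′ _ v ρ′ (fresh-extend k X w f)) (⟦⟧Q-cong α v (λ k′ X′ u →
           trans (sym (Vof-extend E ρ′ k X w k′ X′ u))
             (updateSO-cong k X (λ k X u → sym (Vof-local E w f (below-root w (true ∷ []) Ts-below) e k X u)) (λ _ → refl) k′ X′ u)))) ⟩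
    cnt Ts (λ ρ′ → g (λ t → ρ′ (vn w t))) ρ
      ≡⟨ cnt-subsets w g g-ext (allTuples n k) (allTuples-unique n k) ρ ⟩
    sum (map (λ B → g (λ u → member B u ∨ (not (member (allTuples n k) u) ∧ ρ (vn w u)))) (sublists (allTuples n k)))
      -- Every tuple is listed in `allTuples n k`, so nothing is left to the ambient assignment.
      ≡⟨ cong sum (map-cong (λ B → g-ext (λ u → trans (cong (λ b → member B u ∨ (not b ∧ ρ (vn w u))) (member-allTuples u))
           (∨-identityʳ _))) (sublists (allTuples n k))) ⟩
    sum (map (λ B → g (member B)) (sublists (allTuples n k))) ∎
    where
    Ts  = map (vn w) (allTuples n k)
    Vα = vars n α (w ++ false ∷ [])
    E′ = extend E k X w
    Dα = D A α E′ (w ++ false ∷ []) v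
    Ts-below : Below w (true ∷ []) Ts
    Ts-below = below-map-vn w id (allTuples n k)
    g : (Vec (Fin n) k → Bool) → ℕ
    g B = ⟦ α ⟧Q v (updateSO (Vof E ρ) k X B)
    g-ext : ∀ {B B′} → B ≗ B′ → g B ≡ g B′
    g-ext e = ⟦⟧Q-cong α v (updateSO-cong k X (λ _ _ _ → refl) e)
    tauts-true : ∀ ρ (ts : List (Vec (Fin n) k)) →
      all (evalClause2 ρ) (map (λ t → two (true , vn w t) (false , vn w t)) ts) ≡ true
    tauts-true ρ []       = refl
    tauts-true ρ (t ∷ ts) = cong₂ _∧_ (∨-inverseʳ (ρ (vn w t))) (tauts-true ρ ts)
    decompose : sat (D A (sumS k X α) E w v) ≗ sat Dα
    decompose ρ = cong bool→ℕ (trans (any-map-++ (evalClause2 ρ) Dα _)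
      (trans (cong (evalDisj2 ρ Dα ∧_) (tauts-true ρ (allTuples n k))) (∧-identityʳ _)))

open Counting

-- From branching counts to `#Disj2Sat`

elemℕ-∈ : ∀ x xs → elemℕ x xs ≡ true → x ∈ xs
elemℕ-∈ x xs e with y , y∈ , p ← any-∈⁻ (x ≡ᵇ_) xs e with refl ← ≡ᵇ-true x y p = y∈

nub-⊆ : ∀ xs {x} → x ∈ nub xs → x ∈ xs
nub-⊆ (y ∷ ys) x∈ with elemℕ y ys
nub-⊆ (y ∷ ys) x∈         | true  = there (nub-⊆ ys x∈)
nub-⊆ (y ∷ ys) (here p)   | false = here p
nub-⊆ (y ∷ ys) (there x∈) | false = there (nub-⊆ ys x∈)

⊆-nub : ∀ xs {x} → x ∈ xs → x ∈ nub xs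
⊆-nub (y ∷ ys) x∈ with elemℕ y ys in e
⊆-nub (y ∷ ys) (here refl) | true  = ⊆-nub ys (elemℕ-∈ y ys e)
⊆-nub (y ∷ ys) (there x∈)  | true  = ⊆-nub ys x∈
⊆-nub (y ∷ ys) (here p)    | false = here p
⊆-nub (y ∷ ys) (there x∈)  | false = there (⊆-nub ys x∈)

nub-unique : ∀ xs → Unique (nub xs)
nub-unique []       = []
nub-unique (y ∷ ys) with elemℕ y ys in e
... | true  = nub-unique ys
... | false = ∷-unique (λ { (here refl , y∈) → y∉ (nub-⊆ ys y∈) }) (nub-unique ys)
  where
  y∉ : y ∉ ys
  y∉ y∈ with () ← trans (sym e) (any-∈ (y ≡ᵇ_) y∈ (≡ᵇ-refl y))

-- `allBools` varies the first bit fastest, so the first variable branches last; moving it from the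
-- end of the list to the front restores the order of `cnt`.
sum-allBools : ∀ vs F → Ext F → sum (map (λ bs → F (valOf vs bs)) (allBools (length vs))) ≡ cnt vs F (λ _ → false)
sum-allBools []       F eF = +-identityʳ _
sum-allBools (y ∷ ys) F eF = begin
  sum (map (λ bs → F (valOf (y ∷ ys) bs)) (allBools (suc (length ys))))
    ≡⟨ sum-pairs (λ bs → F (valOf (y ∷ ys) bs)) (allBools (length ys)) ⟩
  sum (map (λ bs → cnt (y ∷ []) F (valOf ys bs)) (allBools (length ys)))
    ≡⟨ sum-allBools ys (cnt (y ∷ []) F) (cnt-ext (y ∷ []) eF) ⟩
  cnt ys (cnt (y ∷ []) F) (λ _ → false)
    ≡⟨ cnt-++ ys (y ∷ []) F _ ⟨
  cnt (ys ++ y ∷ []) F (λ _ → false)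
    ≡⟨ cnt-↭ (Permₚ.++-comm ys (y ∷ [])) eF _ ⟩
  cnt (y ∷ ys) F (λ _ → false) ∎
  where
  sum-pairs : ∀ (G : List Bool → ℕ) bss → sum (map G (concatMap (λ bs → (true ∷ bs) ∷ (false ∷ bs) ∷ []) bss)) ≡
                                          sum (map (λ bs → G (true ∷ bs) + G (false ∷ bs)) bss)
  sum-pairs G []         = refl
  sum-pairs G (bs ∷ bss) = trans (cong (λ s → G (true ∷ bs) + (G (false ∷ bs) + s)) (sum-pairs G bss))
    (sym (+-assoc (G (true ∷ bs)) _ _))

varsC : TwoSAT → List ℕ
varsC = concatMap clauseVars

varsC-++ : ∀ d u → varsC (d ++ u) ≡ varsC d ++ varsC u
varsC-++ d u = concatMap-++ clauseVars d u

varsC-units : ∀ P → varsC (units P) ≡ map litVar P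
varsC-units []      = refl
varsC-units (l ∷ P) = cong (litVar l ∷_) (varsC-units P)

∈-append : ∀ d u {x} → x ∈ varsC u → x ∈ varsC (d ++ u)
∈-append d u x∈ = subst (_ ∈_) (sym (varsC-++ d u)) (∈-++⁺ʳ (varsC d) x∈)

∈-prepend : ∀ d u {x} → x ∈ varsC d → x ∈ varsC (d ++ u)
∈-prepend d u x∈ = subst (_ ∈_) (sym (varsC-++ d u)) (∈-++⁺ˡ x∈)

∈-units : ∀ P {xs x} → map litVar P ≡ xs → x ∈ xs → x ∈ varsC (units P)
∈-units P refl x∈ = subst (_ ∈_) (sym (varsC-units P)) x∈

all-overVars⁺ : ∀ {n} {B : Set} {P : B → Set} xs (v : FOAssign n) {f} → (∀ v → All P (f v)) → All P (overVars xs v f)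
all-overVars⁺ []       v h = h v
all-overVars⁺ (x ∷ xs) v h = Allₚ.concat⁺ (Allₚ.map⁺ (All.universal (λ a → all-overVars⁺ xs (update v x a) h) (allFin _)))

module Reduction {σ : Vocab} (A : Structure σ) where

  private n = card A

  Covers : List ℕ → TwoSAT → Set
  Covers xs d = ∀ x → x ∈ xs → x ∈ varsC d

  covers-units : ∀ P {xs} → map litVar P ≡ xs → Covers xs (units P)
  covers-units P e x = ∈-units P e

  covers-++ : ∀ d u xs ys zs → (∀ {x} → x ∈ zs → x ∈ xs ⊎ x ∈ ys) → Covers xs d → Covers ys u → Covers zs (d ++ u)
  covers-++ d u xs ys zs split c c′ x x∈ with split x∈
  ... | inj₁ p = ∈-prepend d u (c x p)
  ... | inj₂ p = ∈-append d u (c′ x p)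

  -- The appended block mentions the variables of the operator itself and those of a summand that is
  -- switched off; the others occur in the disjuncts of the body.
  vars-covered : ∀ α E w v → All (Covers (vars n α w)) (D A α E w v)
  vars-covered (leaf φ)   E w v = All.universal (λ _ _ ()) _
  vars-covered (plus α β) E w v = Allₚ.++⁺
    (Allₚ.map⁺ (All.map (λ {d} c → covers-++ d (units (choose n w true β wβ)) Vα (t ∷ Vβ) (t ∷ Vα ++ Vβ) left c
      (covers-units (choose n w true β wβ) (choose-vars n w true β wβ))) (vars-covered α E wα v)))
    (Allₚ.map⁺ (All.map (λ {d} c → covers-++ d (units (choose n w false α wα)) Vβ (t ∷ Vα) (t ∷ Vα ++ Vβ) right c
      (covers-units (choose n w false α wα) (choose-vars n w false α wα))) (vars-covered β E wβ v)))
    where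
    t  = vn {n} w []
    wα = w ++ false ∷ false ∷ []
    wβ = w ++ false ∷ true ∷ []
    Vα = vars n α wα
    Vβ = vars n β wβ
    left : ∀ {x} → x ∈ t ∷ Vα ++ Vβ → x ∈ Vα ⊎ x ∈ t ∷ Vβ
    left (here p)   = inj₂ (here p)
    left (there x∈) = [ inj₁ , inj₂ ∘ there ]′ (∈-++⁻ Vα x∈)
    right : ∀ {x} → x ∈ t ∷ Vα ++ Vβ → x ∈ Vβ ⊎ x ∈ t ∷ Vα
    right x∈ = [ inj₂ , inj₁ ]′ (∈-++⁻ (t ∷ Vα) x∈)
  vars-covered (sumF x α) E w v = Allₚ.concat⁺ (Allₚ.map⁺ (All.universal (λ a → Allₚ.map⁺ (All.map
    (λ {d} c → covers-++ d (units (pick w a)) Vα Ts (Ts ++ Vα) (λ x∈ → [ inj₂ , inj₁ ]′ (∈-++⁻ Ts x∈)) c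
      (covers-units (pick w a) (sym (map-∘ (allFin n)))))
    (vars-covered α E (w ++ false ∷ []) (update v x a)))) (allFin n)))
    where
    Ts = map (λ a → vn w (a ∷ [])) (allFin n)
    Vα = vars n α (w ++ false ∷ [])
  vars-covered (sumS k X α) E w v = Allₚ.map⁺ (All.map
    (λ {d} c → covers-++ d (tauts n k w) Vα Ts (Ts ++ Vα) (λ x∈ → [ inj₂ , inj₁ ]′ (∈-++⁻ Ts x∈)) c (λ x → ∈-tauts (allTuples n k)))
    (vars-covered α (extend E k X w) (w ++ false ∷ []) v))
    where
    Ts = map (vn w) (allTuples n k)
    Vα = vars n α (w ++ false ∷ [])
    ∈-tauts : ∀ (ts : List (Vec (Fin n) k)) {x} → x ∈ map (vn w) ts →
      x ∈ varsC (map (λ t → two (true , vn w t) (false , vn w t)) ts)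
    ∈-tauts (t ∷ ts) (here p)   = here p
    ∈-tauts (t ∷ ts) (there x∈) = there (there (∈-tauts ts x∈))

  module _ (P : ℕ → Set) where

    -- The predicate `P` stands in for membership in a fixed list, so that the assumption on all
    -- variables splits along the recursion. Literals at a leaf name bits of enclosing binders,
    -- hence the condition on the environment.
    Binds : Env → Set
    Binds E = ∀ k X {w} → E k X ≡ just w → ∀ (t : Vec (Fin n) k) → P (vn w t)

    WithinRes : FO σ ⊎ WLit → Set
    WithinRes (inj₁ _) = ⊤
    WithinRes (inj₂ l) = ∀ (v : FOAssign n) → P (litVar (instLit v l))

    within-resolve : ∀ {E} → Binds E → ∀ a → WithinRes (resolve E a)
    within-resolve {E} b (inj₁ (lit s k X xs)) with E k X in e
    within-resolve {E} b (inj₁ (lit s k X xs))     | just w  = λ v → b k X e (Vec.map v xs)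
    within-resolve {E} b (inj₁ (lit true k X xs))  | nothing = _
    within-resolve {E} b (inj₁ (lit false k X xs)) | nothing = _
    within-resolve b (inj₂ _) = _

    within-join : ∀ ψ a b → WithinRes a → WithinRes b → ∀ (v : FOAssign n) → All P (clauseVars (inst v (proj₂ (join ψ a b))))
    within-join ψ (inj₁ φ) (inj₁ χ) p q v = []
    within-join ψ (inj₁ φ) (inj₂ l) p q v = q v ∷ []
    within-join ψ (inj₂ l) (inj₁ φ) p q v = p v ∷ []
    within-join ψ (inj₂ l) (inj₂ m) p q v = p v ∷ q v ∷ []

    within-split : ∀ {E} → Binds E → ∀ C (v : FOAssign n) → All P (clauseVars (inst v (proj₂ (split E C))))
    within-split b record { φ₁ = x ; φ₂ = y ; φ₃ = z ; hasFO = inj₁ p } =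
      within-join (theFO x p) _ _ (within-resolve b y) (within-resolve b z)
    within-split b record { φ₁ = x ; φ₂ = y ; φ₃ = z ; hasFO = inj₂ (inj₁ p) } =
      within-join (theFO y p) _ _ (within-resolve b x) (within-resolve b z)
    within-split b record { φ₁ = x ; φ₂ = y ; φ₃ = z ; hasFO = inj₂ (inj₂ p) } =
      within-join (theFO z p) _ _ (within-resolve b x) (within-resolve b y)

    within-instClause : ∀ {E} → Binds E → ∀ v C → All P (varsC (instClause A E v C))
    within-instClause {E} b v C with evalFO A (proj₁ (split E C)) v
    ... | true  = []
    ... | false = subst (All P) (sym (++-identityʳ _)) (within-split b C v)

    within-concatMap : ∀ {B : Set} (f : B → TwoSAT) bs → (∀ b → All P (varsC (f b))) → All P (varsC (concatMap f bs))
    within-concatMap f []       h = []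
    within-concatMap f (b ∷ bs) h = subst (All P) (sym (varsC-++ (f b) _)) (Allₚ.++⁺ (h b) (within-concatMap f bs h))

    within-overVars : ∀ xs (v : FOAssign n) f → (∀ v → All P (varsC (f v))) → All P (varsC (overVars xs v f))
    within-overVars []       v f h = h v
    within-overVars (x ∷ xs) v f h = within-concatMap (λ a → overVars xs (update v x a) f) (allFin n) (λ a → within-overVars xs (update v x a) f h)

    within-++ : ∀ u {d} → All P (varsC u) → All P (varsC d) → All P (varsC (d ++ u))
    within-++ u {d} pu pd = subst (All P) (sym (varsC-++ d u)) (Allₚ.++⁺ pd pu)

    within-units : ∀ Q {xs} → map litVar Q ≡ xs → All P xs → All P (varsC (units Q))
    within-units Q refl = subst (All P) (sym (varsC-units Q))

    within-tauts : ∀ {k} w (ts : List (Vec (Fin n) k)) → All P (map (vn w) ts) →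
      All P (varsC (map (λ t → two (true , vn w t) (false , vn w t)) ts))
    within-tauts w []       []       = []
    within-tauts w (t ∷ ts) (p ∷ ps) = p ∷ p ∷ within-tauts w ts ps

    binds-extend : ∀ {E} k X w → Binds E → All P (map (vn w) (allTuples n k)) → Binds (extend E k X w)
    binds-extend {E} k X w b ps k′ X′ e t with k ℕ.≟ k′ | X ≡ᵇ X′
    binds-extend k X w b ps k′ X′ refl t | yes refl | true  = All.lookup ps (∈-map⁺ _ (∈-allTuples t))
    binds-extend k X w b ps k′ X′ e    t | yes refl | false = b k′ X′ e t
    binds-extend k X w b ps k′ X′ e    t | no _     | _     = b k′ X′ e t

    D-within : ∀ α E w v → Binds E → All P (vars n α w) → All (λ d → All P (varsC d)) (D A α E w v)
    D-within (leaf φ)   E w v b _ = all-overVars⁺ (Σ₂2SAT.exVars φ) v λ v₁ →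
      within-overVars (Σ₂2SAT.allVars φ) v₁ _ (λ v₂ → within-concatMap _ (Σ₂2SAT.clauses φ) (within-instClause b v₂)) ∷ []
    D-within (plus α β) E w v b (p ∷ ps) with Allₚ.++⁻ (vars n α _) ps
    ... | pα , pβ = Allₚ.++⁺
      (Allₚ.map⁺ (All.map (λ {d} → within-++ (units (choose n w true β _)) {d} (within-units (choose n w true β _) (choose-vars n w true β _) (p ∷ pβ))) (D-within α E _ v b pα)))
      (Allₚ.map⁺ (All.map (λ {d} → within-++ (units (choose n w false α _)) {d} (within-units (choose n w false α _) (choose-vars n w false α _) (p ∷ pα))) (D-within β E _ v b pβ)))
    D-within (sumF x α) E w v b ps with Allₚ.++⁻ (map (λ a → vn w (a ∷ [])) (allFin n)) ps
    ... | pT , pα = Allₚ.concat⁺ (Allₚ.map⁺ (All.universal (λ a → Allₚ.map⁺ (All.map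
      (λ {d} → within-++ (units (pick w a)) {d} (within-units (pick w a) (sym (map-∘ (allFin n))) pT)) (D-within α E _ _ b pα))) (allFin n)))
    D-within (sumS k X α) E w v b ps with Allₚ.++⁻ (map (vn w) (allTuples n k)) ps
    ... | pT , pα = Allₚ.map⁺ (All.map (λ {d} → within-++ (tauts n k w) {d} (within-tauts w (allTuples n k) pT))
      (D-within α _ _ v (binds-extend k X w b pT) pα))

  reduce : ΣQSO σ → Disj2
  reduce α = D A (desugar α) (λ _ _ → nothing) [] (λ _ → fzero)

  reduce-correct : ∀ α → count α A ≡ #Disj2Sat (reduce α)
  reduce-correct α = begin
    count α A                                    ≡⟨ desugar-correct A α _ _ ⟨
    ⟦_⟧Q A (desugar α) _ (λ _ _ _ → false)       ≡⟨ cnt-D A (desugar α) (λ _ _ → nothing) [] _ (λ _ → false) (λ _ _ ()) ⟨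
    cnt V (sat A (reduce α)) (λ _ → false)       ≡⟨ same-variables (reduce α) (vars-covered (desugar α) (λ _ _ → nothing) [] _)
                                                      (D-within (_∈ V) (desugar α) (λ _ _ → nothing) [] _ (λ _ _ ()) (All.tabulate id)) ⟩
    cnt (varsD (reduce α)) (sat A (reduce α)) (λ _ → false)
      ≡⟨ sum-allBools (varsD (reduce α)) (sat A (reduce α)) (sat-ext A (reduce α)) ⟨
    #Disj2Sat (reduce α)                         ∎
    where
    V = vars n (desugar α) []
    same-variables : ∀ φ → All (Covers V) φ → All (λ d → All (_∈ V) (varsC d)) φ →
      cnt V (sat A φ) (λ _ → false) ≡ cnt (varsD φ) (sat A φ) (λ _ → false)
    -- Without disjuncts no variable occurs, but then both counts are 0.
    same-variables []      _        _  = cnt-0 V _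
    same-variables (d ∷ φ) (p ∷ _) qs = cnt-↭ V↭ (sat-ext A (d ∷ φ)) _
      where
      V↭ : V ↭ varsD (d ∷ φ)
      -- A single disjunct that mentions all of `V` gives one inclusion, and duplicate-free lists
      -- with the same elements are permutations of each other.
      V↭ = ∼bag⇒↭ (unique∧set⇒bag (vars-unique n (desugar α) []) (nub-unique (concatMap varsC (d ∷ φ)))
        (mk⇔ (λ x∈ → ⊆-nub (concatMap varsC (d ∷ φ)) (∈-++⁺ˡ (p _ x∈)))
             (λ x∈ → All.lookup (Allₚ.concat⁺ (Allₚ.map⁺ qs)) (nub-⊆ (concatMap varsC (d ∷ φ)) x∈))))

open Reduction

-- Turing machines from structured programs

-- A retraction is enough: the machine only meets codes of actual elements, so spare codes do no
-- harm.
record Finite (X : Set) : Set where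
  field
    size    : ℕ
    to      : X → Fin size
    from    : Fin size → X
    from-to : ∀ x → from (to x) ≡ x

open Finite

finite-Fin : ∀ k → Finite (Fin k)
finite-Fin k = record { size = k ; to = id ; from = id ; from-to = λ _ → refl }

finite-⊎ : ∀ {X Y} → Finite X → Finite Y → Finite (X ⊎ Y)
finite-⊎ {X} {Y} F G = record
  { size    = size F + size G
  ; to      = λ z → Fin.join (size F) (size G) (Sum.map (to F) (to G) z)
  ; from    = λ i → Sum.map (from F) (from G) (Fin.splitAt (size F) i)
  ; from-to = λ z → trans (cong (Sum.map (from F) (from G)) (Finₚ.splitAt-join (size F) (size G) (Sum.map (to F) (to G) z))) (inner z) }
  where
  inner : ∀ (z : X ⊎ Y) → Sum.map (from F) (from G) (Sum.map (to F) (to G) z) ≡ z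
  inner (inj₁ x) = cong inj₁ (from-to F x)
  inner (inj₂ y) = cong inj₂ (from-to G y)

finite-× : ∀ {X Y} → Finite X → Finite Y → Finite (X × Y)
finite-× F G = record
  { size    = size F * size G
  ; to      = λ (x , y) → Fin.combine (to F x) (to G y)
  ; from    = λ i → from F (proj₁ (Fin.remQuot {size F} (size G) i)) , from G (proj₂ (Fin.remQuot {size F} (size G) i))
  ; from-to = λ (x , y) → cong₂ _,_
      (trans (cong (from F ∘ proj₁) (Finₚ.remQuot-combine (to F x) (to G y))) (from-to F x))
      (trans (cong (from G ∘ proj₂) (Finₚ.remQuot-combine (to F x) (to G y))) (from-to G y)) }

finite-retract : ∀ {X Y} → Finite Y → (f : X → Y) (g : Y → X) → g ∘ f ≗ id → Finite X
finite-retract F f g gf = record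
  { size = size F ; to = to F ∘ f ; from = g ∘ from F
  ; from-to = λ x → trans (cong g (from-to F (f x))) (gf x) }

finite-Bool : Finite Bool
finite-Bool = finite-retract (finite-Fin 2) (λ { true → fzero ; false → fsuc fzero })
  (λ { fzero → true ; (fsuc fzero) → false }) (λ { true → refl ; false → refl })

finite-Vec : ∀ m → Finite (Vec Bool m)
finite-Vec zero    = finite-retract (finite-Fin 1) (λ _ → fzero) (λ _ → []) (λ { [] → refl })
finite-Vec (suc m) = finite-retract (finite-× finite-Bool (finite-Vec m))
  (λ { (b ∷ bs) → b , bs }) (λ (b , bs) → b ∷ bs) (λ { (b ∷ bs) → refl })

-- The last stage of `step` on its own: it computes as soon as the transition is known, outside the
-- nested case distinctions of `step`.
place : ∀ {M} → Fin (TM.states M) → Move → List (Sym (TM.work M)) → Sym (TM.work M) → List (Sym (TM.work M)) → Config M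
place q L []      w r       = cfg q [] blank (w ∷ r)
place q L (x ∷ l) w r       = cfg q l x (w ∷ r)
place q R l       w []      = cfg q (w ∷ l) blank []
place q R l       w (x ∷ r) = cfg q (w ∷ l) x r
place q S l       w r       = cfg q l w r

step-place : ∀ M q l h r {q′ w m} → TM.halting M q ≡ false → TM.δ M q h ≡ (q′ , w , m) →
  step M (cfg q l h r) ≡ place q′ m l w r
step-place M q l h r eh ed with TM.halting M q | eh
step-place M q l h r eh ed | false | _ with TM.δ M q h | ed
step-place M q []      h r       {m = L} eh ed | false | _ | _ | refl = refl
step-place M q (_ ∷ _) h r       {m = L} eh ed | false | _ | _ | refl = refl
step-place M q l       h []      {m = R} eh ed | false | _ | _ | refl = refl
step-place M q l       h (_ ∷ _) {m = R} eh ed | false | _ | _ | refl = refl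
step-place M q l       h r       {m = S} eh ed | false | _ | _ | refl = refl

run-+ : ∀ M a b c → run M (a + b) c ≡ run M b (run M a c)
run-+ M zero    b c = refl
run-+ M (suc a) b c = run-+ M a b (step M c)

run-halted : ∀ M t c → TM.halting M (Config.state c) ≡ true → run M t c ≡ c
run-halted M zero    c               e = refl
run-halted M (suc t) (cfg q l h r) e = trans (cong (run M t) (stays e)) (run-halted M t (cfg q l h r) e)
  where
  stays : TM.halting M q ≡ true → step M (cfg q l h r) ≡ cfg q l h r
  stays e with TM.halting M q
  stays refl | true = refl

-- Structured programs and their control flow

module Machine (C : Set) (finite-C : Finite C) where

  Γ : Set
  Γ = IO ⊎ C

  -- One operation is a left-to-right pass of a two-state Mealy machine over the
  -- non-blank tape, which may append one symbol, followed by a rewind.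
  record Op : Set where
    field
      pass   : Bool → Γ → Γ × Bool
      begin₀ : Bool
      append : Maybe Γ
      result : Bool → Bool

  mealy : (Bool → Γ → Γ × Bool) → Bool → List Γ → List Γ × Bool
  mealy f q []      = [] , q
  mealy f q (s ∷ T) = proj₁ (f q s) ∷ proj₁ (mealy f (proj₂ (f q s)) T) , proj₂ (mealy f (proj₂ (f q s)) T)

  exec : Op → List Γ → List Γ × Bool
  exec o T = proj₁ m ++ List.fromMaybe (Op.append o) , Op.result o (proj₂ m)
    where m = mealy (Op.pass o) (Op.begin₀ o) T

  -- loop p q repeats p; q until p returns false (then the loop returns false)
  -- or q returns true (then the loop returns true).
  data Prog : Set where
    op   : Op → Prog
    ite  : Prog → Prog → Prog → Prog
    loop : Prog → Prog → Prog

  -- Only operations get control points; tests and loops live in `next` and cost no machine steps of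
  -- their own.
  ctl : Prog → ℕ
  ctl (op _)      = 1
  ctl (ite p q r) = ctl p + (ctl q + ctl r)
  ctl (loop p q)  = ctl p + ctl q

  entry : (p : Prog) → Fin (ctl p)
  entry (op _)      = fzero
  entry (ite p q r) = entry p Fin.↑ˡ _
  entry (loop p q)  = entry p Fin.↑ˡ _

  opAt : (p : Prog) → Fin (ctl p) → Op
  opAt (op o)      _ = o
  opAt (ite p q r) c = [ opAt p , (λ d → [ opAt q , opAt r ]′ (Fin.splitAt (ctl q) d)) ]′ (Fin.splitAt (ctl p) c)
  opAt (loop p q)  c = [ opAt p , opAt q ]′ (Fin.splitAt (ctl p) c)

  next : (p : Prog) → Fin (ctl p) → Bool → Fin (ctl p) ⊎ Bool
  next (op _)      c b = inj₂ b
  next (ite p q r) c b =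
    [ (λ d → [ inj₁ ∘ (Fin._↑ˡ _) , (λ x → inj₁ (ctl p Fin.↑ʳ (if x then entry q Fin.↑ˡ _ else ctl q Fin.↑ʳ entry r))) ]′ (next p d b))
    , (λ d → [ (λ e → [ inj₁ ∘ (ctl p Fin.↑ʳ_) ∘ (Fin._↑ˡ _) , inj₂ ]′ (next q e b))
             , (λ e → [ inj₁ ∘ (ctl p Fin.↑ʳ_) ∘ (ctl q Fin.↑ʳ_) , inj₂ ]′ (next r e b)) ]′ (Fin.splitAt (ctl q) d)) ]′
    (Fin.splitAt (ctl p) c)
  next (loop p q)  c b =
    [ (λ d → [ inj₁ ∘ (Fin._↑ˡ _) , (λ x → if x then inj₁ (ctl p Fin.↑ʳ entry q) else inj₂ false) ]′ (next p d b))
    , (λ d → [ inj₁ ∘ (ctl p Fin.↑ʳ_) , (λ x → if x then inj₂ true else inj₁ (entry p Fin.↑ˡ _)) ]′ (next q d b)) ]′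
    (Fin.splitAt (ctl p) c)

  -- The index of Reach is only an upper bound on the number of operations.
  data Reach (p : Prog) (c : Fin (ctl p)) (T : List Γ) (b : Bool) (T′ : List Γ) : ℕ → Set where
    stop : ∀ {N x} → exec (opAt p c) T ≡ (T′ , x) → next p c x ≡ inj₂ b → Reach p c T b T′ (suc N)
    more : ∀ {N x c′ T″} → exec (opAt p c) T ≡ (T″ , x) → next p c x ≡ inj₁ c′ → Reach p c′ T″ b T′ N → Reach p c T b T′ (suc N)

  Runs : Prog → List Γ → Bool → List Γ → ℕ → Set
  Runs p = Reach p (entry p)

  weaken : ∀ {p c T b T′ N N′} → N ≤ N′ → Reach p c T b T′ N → Reach p c T b T′ N′
  weaken (s≤s le) (stop e n)   = stop e n
  weaken (s≤s le) (more e n r) = more e n (weaken le r)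

  runs-op : ∀ o {T b T′} → exec o T ≡ (T′ , b) → Runs (op o) T b T′ 1
  runs-op o e = stop e refl

  -- Inside `P` the part `p` behaves as it does alone: `ι` relocates its control points, and `κ`
  -- tells how `P` goes on once `p` exits with a Boolean.
  record Embeds (p P : Prog) (ι : Fin (ctl p) → Fin (ctl P)) (κ : Bool → Fin (ctl P) ⊎ Bool) : Set where
    field
      op-eq   : ∀ c → opAt P (ι c) ≡ opAt p c
      next-eq : ∀ c x → next P (ι c) x ≡ [ inj₁ ∘ ι , κ ]′ (next p c x)

  module _ {p P ι κ} (E : Embeds p P ι κ) where
    open Embeds E

    embed-exit : ∀ {c T b T₁ b′ N} → Reach p c T b T₁ N → κ b ≡ inj₂ b′ → Reach P (ι c) T b′ T₁ N
    embed-exit {c} {T} (stop e n)   k = stop (trans (cong (λ o → exec o T) (op-eq c)) e) (trans (next-eq c _) (trans (cong [ _ , κ ]′ n) k))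
    embed-exit {c} {T} (more e n r) k = more (trans (cong (λ o → exec o T) (op-eq c)) e) (trans (next-eq c _) (cong [ _ , κ ]′ n)) (embed-exit r k)

    embed-then : ∀ {c T b T₁ d b′ T₂ N N′} → Reach p c T b T₁ N → κ b ≡ inj₁ d → Reach P d T₁ b′ T₂ N′ → Reach P (ι c) T b′ T₂ (N + N′)
    embed-then {c} {T} {N′ = N′} (stop {N} e n) k r′ =
      more (trans (cong (λ o → exec o T) (op-eq c)) e) (trans (next-eq c _) (trans (cong [ _ , κ ]′ n) k)) (weaken (m≤n+m N′ N) r′)
    embed-then {c} {T} (more e n r) k r′ =
      more (trans (cong (λ o → exec o T) (op-eq c)) e) (trans (next-eq c _) (cong [ _ , κ ]′ n)) (embed-then r k r′)

  module _ (p q r : Prog) where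

    embeds-test : Embeds p (ite p q r) (Fin._↑ˡ _) (λ x → inj₁ (ctl p Fin.↑ʳ (if x then entry q Fin.↑ˡ _ else ctl q Fin.↑ʳ entry r)))
    embeds-test .Embeds.op-eq c rewrite Finₚ.splitAt-↑ˡ (ctl p) c (ctl q + ctl r) = refl
    embeds-test .Embeds.next-eq c x rewrite Finₚ.splitAt-↑ˡ (ctl p) c (ctl q + ctl r) = refl

    embeds-then : Embeds q (ite p q r) ((ctl p Fin.↑ʳ_) ∘ (Fin._↑ˡ _)) inj₂
    embeds-then .Embeds.op-eq c rewrite Finₚ.splitAt-↑ʳ (ctl p) (ctl q + ctl r) (c Fin.↑ˡ ctl r) | Finₚ.splitAt-↑ˡ (ctl q) c (ctl r) = refl
    embeds-then .Embeds.next-eq c x rewrite Finₚ.splitAt-↑ʳ (ctl p) (ctl q + ctl r) (c Fin.↑ˡ ctl r) | Finₚ.splitAt-↑ˡ (ctl q) c (ctl r) = refl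

    embeds-else : Embeds r (ite p q r) ((ctl p Fin.↑ʳ_) ∘ (ctl q Fin.↑ʳ_)) inj₂
    embeds-else .Embeds.op-eq c rewrite Finₚ.splitAt-↑ʳ (ctl p) (ctl q + ctl r) (ctl q Fin.↑ʳ c) | Finₚ.splitAt-↑ʳ (ctl q) (ctl r) c = refl
    embeds-else .Embeds.next-eq c x rewrite Finₚ.splitAt-↑ʳ (ctl p) (ctl q + ctl r) (ctl q Fin.↑ʳ c) | Finₚ.splitAt-↑ʳ (ctl q) (ctl r) c = refl

    runs-then : ∀ {T T₁ b T₂ N N′} → Runs p T true T₁ N → Runs q T₁ b T₂ N′ → Runs (ite p q r) T b T₂ (N + N′)
    runs-then h h′ = embed-then embeds-test h refl (embed-exit embeds-then h′ refl)

    runs-else : ∀ {T T₁ b T₂ N N′} → Runs p T false T₁ N → Runs r T₁ b T₂ N′ → Runs (ite p q r) T b T₂ (N + N′)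
    runs-else h h′ = embed-then embeds-test h refl (embed-exit embeds-else h′ refl)

  module _ (p q : Prog) where

    embeds-guard : Embeds p (loop p q) (Fin._↑ˡ _) (λ x → if x then inj₁ (ctl p Fin.↑ʳ entry q) else inj₂ false)
    embeds-guard .Embeds.op-eq c rewrite Finₚ.splitAt-↑ˡ (ctl p) c (ctl q) = refl
    embeds-guard .Embeds.next-eq c x rewrite Finₚ.splitAt-↑ˡ (ctl p) c (ctl q) = refl

    embeds-body : Embeds q (loop p q) (ctl p Fin.↑ʳ_) (λ x → if x then inj₂ true else inj₁ (entry p Fin.↑ˡ _))
    embeds-body .Embeds.op-eq c rewrite Finₚ.splitAt-↑ʳ (ctl p) (ctl q) c = refl
    embeds-body .Embeds.next-eq c x rewrite Finₚ.splitAt-↑ʳ (ctl p) (ctl q) c = refl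

    runs-loop-end : ∀ {T T₁ N} → Runs p T false T₁ N → Runs (loop p q) T false T₁ N
    runs-loop-end h = embed-exit embeds-guard h refl

    runs-loop-break : ∀ {T T₁ T₂ N N′} → Runs p T true T₁ N → Runs q T₁ true T₂ N′ → Runs (loop p q) T true T₂ (N + N′)
    runs-loop-break h h′ = embed-then embeds-guard h refl (embed-exit embeds-body h′ refl)

    runs-loop-again : ∀ {T T₁ T₂ b T₃ N N′ N″} → Runs p T true T₁ N → Runs q T₁ false T₂ N′ →
      Runs (loop p q) T₂ b T₃ N″ → Runs (loop p q) T b T₃ (N + (N′ + N″))
    runs-loop-again h h′ h″ = embed-then embeds-guard h refl (embed-then embeds-body h′ refl h″)

  -- Execution of programs by a one-tape machine

  Cell : Set
  Cell = Maybe Γ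

  -- `home` stands on the blank left of the contents; `right` and `left` are the two sweeps of an
  -- operation and carry its Mealy state; `fin₀` and `fin₁` bring the head to the output.
  data State (k : ℕ) : Set where
    init fin₀ fin₁ halt : State k
    home : Fin k → State k
    right over left : Fin k → Bool → State k

  finite-State : ∀ k → Finite (State k)
  finite-State k = finite-retract
    (finite-⊎ (finite-Fin 4) (finite-× (finite-Fin k) (finite-⊎ (finite-Fin 1) (finite-× (finite-Fin 3) finite-Bool))))
    f g gf
    where
    Code = Fin 4 ⊎ Fin k × (Fin 1 ⊎ Fin 3 × Bool)
    f : State k → Code
    f init        = inj₁ fzero
    f fin₀        = inj₁ (fsuc fzero)
    f fin₁        = inj₁ (fsuc (fsuc fzero))
    f halt        = inj₁ (fsuc (fsuc (fsuc fzero)))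
    f (home c)    = inj₂ (c , inj₁ fzero)
    f (right c q) = inj₂ (c , inj₂ (fzero , q))
    f (over c q)  = inj₂ (c , inj₂ (fsuc fzero , q))
    f (left c q)  = inj₂ (c , inj₂ (fsuc (fsuc fzero) , q))
    g : Code → State k
    g (inj₁ fzero)                              = init
    g (inj₁ (fsuc fzero))                       = fin₀
    g (inj₁ (fsuc (fsuc fzero)))                = fin₁
    g (inj₁ (fsuc (fsuc (fsuc fzero))))         = halt
    g (inj₂ (c , inj₁ _))                       = home c
    g (inj₂ (c , inj₂ (fzero , q)))             = right c q
    g (inj₂ (c , inj₂ (fsuc fzero , q)))        = over c q
    g (inj₂ (c , inj₂ (fsuc (fsuc fzero) , q))) = left c q
    gf : g ∘ f ≗ id
    gf init        = refl
    gf fin₀        = refl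
    gf fin₁        = refl
    gf halt        = refl
    gf (home c)    = refl
    gf (right c q) = refl
    gf (over c q)  = refl
    gf (left c q)  = refl

  module Compiled (p : Prog) where

    afterOp : Fin (ctl p) ⊎ Bool → State (ctl p)
    afterOp (inj₁ c) = home c
    afterOp (inj₂ _) = fin₀

    endOfTape : Fin (ctl p) → Bool → Cell → State (ctl p) × Cell × Move
    endOfTape c q nothing  = left c q , nothing , L
    -- The extra step right visits the blank behind the appended symbol, so the tape ends in the
    -- same way whether or not something was appended.
    endOfTape c q (just a) = over c q , just a , R

    δ′ : State (ctl p) → Cell → State (ctl p) × Cell × Move
    -- Moving left off the first input cell creates the blank that marks the left end from now on.
    δ′ init        x                = home (entry p) , x , L
    δ′ (home c)    x                = right c (Op.begin₀ (opAt p c)) , x , R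
    δ′ (right c q) (just s)         = right c (proj₂ (Op.pass (opAt p c) q s)) , just (proj₁ (Op.pass (opAt p c) q s)) , R
    δ′ (right c q) nothing          = endOfTape c q (Op.append (opAt p c))
    δ′ (over c q)  x                = left c q , x , L
    δ′ (left c q)  (just s)         = left c q , just s , L
    δ′ (left c q)  nothing          = afterOp (next p c (Op.result (opAt p c) q)) , nothing , S
    δ′ fin₀        x                = fin₁ , x , R
    δ′ fin₁        (just (inj₂ a))  = fin₁ , just (inj₂ a) , R
    δ′ fin₁        (just (inj₁ s))  = halt , just (inj₁ s) , S
    δ′ fin₁        nothing          = halt , nothing , S
    δ′ halt        x                = halt , x , S

    isHalt : State (ctl p) → Bool
    isHalt halt = true
    isHalt _    = false

    enc : Cell → Sym (size finite-C)
    enc nothing         = inj₁ nothing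
    enc (just (inj₁ s)) = inj₁ (just s)
    enc (just (inj₂ a)) = inj₂ (to finite-C a)

    dec : Sym (size finite-C) → Cell
    dec (inj₁ nothing)  = nothing
    dec (inj₁ (just s)) = just (inj₁ s)
    dec (inj₂ i)        = just (inj₂ (from finite-C i))

    dec-enc : dec ∘ enc ≗ id
    dec-enc nothing         = refl
    dec-enc (just (inj₁ s)) = refl
    dec-enc (just (inj₂ a)) = cong (just ∘ inj₂) (from-to finite-C a)

    F = finite-State (ctl p)

    machine : TM
    machine = record
      { states  = size F
      ; work    = size finite-C
      ; start   = to F init
      ; halting = isHalt ∘ from F
      ; δ       = λ i s → let (q , x , m) = δ′ (from F i) (dec s) in to F q , enc x , m }

    ⟨_∣_∣_∣_⟩ : State (ctl p) → List Cell → Cell → List Cell → Config machine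
    ⟨ q ∣ l ∣ x ∣ r ⟩ = cfg (to F q) (map enc l) (enc x) (map enc r)

    goL goR : State (ctl p) → List Cell → List Cell → Config machine
    goL q []      r = ⟨ q ∣ [] ∣ nothing ∣ r ⟩
    goL q (x ∷ l) r = ⟨ q ∣ l ∣ x ∣ r ⟩
    goR q l []      = ⟨ q ∣ l ∣ nothing ∣ [] ⟩
    goR q l (x ∷ r) = ⟨ q ∣ l ∣ x ∣ r ⟩

    moved : State (ctl p) × Cell × Move → List Cell → List Cell → Config machine
    moved (q , x , L) l r = goL q l (x ∷ r)
    moved (q , x , R) l r = goR q (x ∷ l) r
    moved (q , x , S) l r = ⟨ q ∣ l ∣ x ∣ r ⟩

    step-δ′ : ∀ q l x r → isHalt q ≡ false → step machine ⟨ q ∣ l ∣ x ∣ r ⟩ ≡ moved (δ′ q x) l r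
    step-δ′ q l x r nh = trans
      (step-place machine (to F q) (map enc l) (enc x) (map enc r) (trans (cong isHalt (from-to F q)) nh)
        (cong₂ (λ q x → to F (proj₁ (δ′ q x)) , enc (proj₁ (proj₂ (δ′ q x))) , proj₂ (proj₂ (δ′ q x))) (from-to F q) (dec-enc x)))
      (moved-place (δ′ q x) l r)
      where
      moved-place : ∀ t l r → place (to F (proj₁ t)) (proj₂ (proj₂ t)) (map enc l) (enc (proj₁ (proj₂ t))) (map enc r) ≡ moved t l r
      moved-place (q , x , L) []      r       = refl
      moved-place (q , x , L) (_ ∷ _) r       = refl
      moved-place (q , x , R) l       []      = refl
      moved-place (q , x , R) l       (_ ∷ _) = refl
      moved-place (q , x , S) l       r       = refl

    -- A record, so that configurations and times are found by unification without unfolding `run`.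
    record _⟶[_]_ (c : Config machine) (t : ℕ) (c′ : Config machine) : Set where
      constructor by
      field run-eq : run machine t c ≡ c′

    _⨟_ : ∀ {c c′ c″ t t′} → c ⟶[ t ] c′ → c′ ⟶[ t′ ] c″ → c ⟶[ t + t′ ] c″
    _⨟_ {c} {t = t} {t′} (by e) (by e′) = by (trans (run-+ machine t t′ c) (trans (cong (run machine t′) e) e′))

    δ-step : ∀ q l x r → isHalt q ≡ false → ⟨ q ∣ l ∣ x ∣ r ⟩ ⟶[ 1 ] moved (δ′ q x) l r
    δ-step q l x r nh = by (step-δ′ q l x r nh)

    ending : ∀ {c t c′ c″} → c′ ≡ c″ → c ⟶[ t ] c′ → c ⟶[ t ] c″
    ending refl h = h

    scan-right : ∀ c T q l r → let (T′ , q′) = mealy (Op.pass (opAt p c)) q T in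
      goR (right c q) l (map just T ++ r) ⟶[ length T ] goR (right c q′) (map just T′ ʳ++ l) r
    scan-right c []      q l r = by refl
    scan-right c (s ∷ T) q l r = δ-step (right c q) l (just s) (map just T ++ r) refl ⨟ scan-right c T _ _ r

    scan-left : ∀ c q U r → goL (left c q) (map just U ++ nothing ∷ []) r ⟶[ length U ] ⟨ left c q ∣ [] ∣ nothing ∣ map just U ʳ++ r ⟩
    scan-left c q []      r = by refl
    scan-left c q (u ∷ U) r = δ-step (left c q) (map just U ++ nothing ∷ []) (just u) r refl ⨟ scan-left c q U (just u ∷ r)

    -- Cells left of the head are stored nearest first, so the sweep back meets the contents
    -- reversed and reverses them again.
    rewind : ∀ c q T r → goL (left c q) (map just T ʳ++ (nothing ∷ [])) r ⟶[ length T ] ⟨ left c q ∣ [] ∣ nothing ∣ map just T ++ r ⟩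
    rewind c q T r = subst₂ (λ l r′ → goL (left c q) l r ⟶[ length T ] ⟨ left c q ∣ [] ∣ nothing ∣ r′ ⟩)
      (trans (cong (_++ nothing ∷ []) (reverse-map just T)) (sym (ʳ++-defn (map just T))))
      (trans (ʳ++-defn (map just (List.reverse T))) (cong (_++ r)
        (trans (sym (reverse-map just (List.reverse T))) (cong (map just) (reverse-involutive T)))))
      (subst (λ k → goL (left c q) (map just (List.reverse T) ++ nothing ∷ []) r ⟶[ k ] ⟨ left c q ∣ [] ∣ nothing ∣ map just (List.reverse T) ʳ++ r ⟩)
        (length-reverse T) (scan-left c q (List.reverse T) r))

    -- Whether or not the blank behind the tape contents has been visited makes no difference.
    data Blank : List Cell → Set where
      []ᵇ : Blank []
      ␣ᵇ  : Blank (nothing ∷ [])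

    goR-blank : ∀ {r} → Blank r → ∀ q l → goR q l r ≡ ⟨ q ∣ l ∣ nothing ∣ [] ⟩
    goR-blank []ᵇ q l = refl
    goR-blank ␣ᵇ  q l = refl

    turn : ∀ c q l a → Op.append (opAt p c) ≡ a → ∃ λ t → t ≤ 2 ×
      (⟨ right c q ∣ l ∣ nothing ∣ [] ⟩ ⟶[ t ] goL (left c q) (map just (List.fromMaybe a) ʳ++ l) (nothing ∷ []))
    turn c q l nothing  e = 1 , s≤s z≤n ,
      ending (cong (λ a → moved (endOfTape c q a) l []) e) (δ-step (right c q) l nothing [] refl)
    turn c q l (just a) e = 2 , s≤s (s≤s z≤n) ,
      (ending (cong (λ a → moved (endOfTape c q a) l []) e) (δ-step (right c q) l nothing [] refl) ⨟
        δ-step (over c q) (just a ∷ l) nothing [] refl)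

    mealy-length : ∀ f q T → length (proj₁ (mealy f q T)) ≡ length T
    mealy-length f q []      = refl
    mealy-length f q (s ∷ T) = cong suc (mealy-length f _ T)

    exec-length : ∀ o T → length (proj₁ (exec o T)) ≤ suc (length T)
    exec-length o T = ≤-trans (≤-reflexive (length-++ T′)) (≤-trans
      (+-mono-≤ (≤-reflexive (mealy-length (Op.pass o) (Op.begin₀ o) T)) (short (Op.append o)))
      (≤-reflexive (+-comm (length T) 1)))
      where
      T′ = proj₁ (mealy (Op.pass o) (Op.begin₀ o) T)
      a  = List.fromMaybe (Op.append o)
      short : ∀ (m : Maybe Γ) → length (List.fromMaybe m) ≤ 1
      short nothing  = z≤n
      short (just _) = s≤s z≤n

    run-op : ∀ c T r → Blank r → let (T′ , b) = exec (opAt p c) T in ∃ λ t → t ≤ 2 * length T + 5 ×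
      (⟨ home c ∣ [] ∣ nothing ∣ map just T ++ r ⟩ ⟶[ t ] ⟨ afterOp (next p c b) ∣ [] ∣ nothing ∣ map just T′ ++ nothing ∷ [] ⟩)
    run-op c T r blank =
      1 + (length T + (proj₁ turned + (length T″ + 1))) ,
      bound ,
      (δ-step (home c) [] nothing (map just T ++ r) refl ⨟
        (ending (goR-blank blank (right c q′) (map just T′ ʳ++ (nothing ∷ []))) (scan-right c T q₀ (nothing ∷ []) r) ⨟
        (proj₂ (proj₂ turned) ⨟
        (subst (λ l → goL (left c q′) l (nothing ∷ []) ⟶[ length T″ ] ⟨ left c q′ ∣ [] ∣ nothing ∣ map just T″ ++ nothing ∷ [] ⟩)
          reversed (rewind c q′ T″ (nothing ∷ [])) ⨟
        δ-step (left c q′) [] nothing (map just T″ ++ nothing ∷ []) refl))))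
      where
      o  = opAt p c
      q₀ = Op.begin₀ o
      T′ = proj₁ (mealy (Op.pass o) q₀ T)
      q′ = proj₂ (mealy (Op.pass o) q₀ T)
      T″ = proj₁ (exec o T)
      turned = turn c q′ (map just T′ ʳ++ (nothing ∷ [])) (Op.append o) refl
      reversed : map just T″ ʳ++ (nothing ∷ []) ≡ map just (List.fromMaybe (Op.append o)) ʳ++ (map just T′ ʳ++ (nothing ∷ []))
      reversed = trans (cong (_ʳ++ (nothing ∷ [])) (map-++ just T′ _)) (++-ʳ++ (map just T′))
      -- The 5 is one step off the left blank, at most two to turn round, one for a possibly
      -- appended symbol on the way back, and one for the transition at the left end.
      bound : 1 + (length T + (proj₁ turned + (length T″ + 1))) ≤ 2 * length T + 5
      bound = ≤-trans
        (+-monoʳ-≤ 1 (+-monoʳ-≤ (length T) (+-mono-≤ (proj₁ (proj₂ turned)) (+-monoˡ-≤ 1 (exec-length o T)))))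
        (≤-reflexive (solve 1 (λ n → con 1 :+ (n :+ (con 2 :+ ((con 1 :+ n) :+ con 1))) := con 2 :* n :+ con 5) refl (length T)))

    -- `m` is to bound the tape length throughout the run; as each operation appends at most one
    -- symbol, `length T + N` will do.
    opTime : ℕ → ℕ → ℕ
    opTime N m = N * (2 * m + 5)

    run-reach : ∀ {c T b T′ N} r → Blank r → Reach p c T b T′ N → ∃ λ t → t ≤ opTime N (length T + N) ×
      (⟨ home c ∣ [] ∣ nothing ∣ map just T ++ r ⟩ ⟶[ t ] ⟨ fin₀ ∣ [] ∣ nothing ∣ map just T′ ++ nothing ∷ [] ⟩)
    run-reach {c} {T} r blank (stop {N} refl n) with t , t≤ , e ← run-op c T r blank =
      t ,
      ≤-trans t≤ (≤-trans (+-monoˡ-≤ 5 (*-monoʳ-≤ 2 (m≤m+n (length T) (suc N)))) (m≤m+n (2 * (length T + suc N) + 5) _)) ,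
      ending (cong (λ d → ⟨ afterOp d ∣ [] ∣ nothing ∣ map just (proj₁ (exec (opAt p c) T)) ++ nothing ∷ [] ⟩) n) e
    run-reach {c} {T} r blank (more {N} {T″ = T″} refl n h) with t , t≤ , e ← run-op c T r blank | t′ , t′≤ , e′ ← run-reach (nothing ∷ []) ␣ᵇ h =
      t + t′ ,
      +-mono-≤ (≤-trans t≤ (+-monoˡ-≤ 5 (*-monoʳ-≤ 2 (m≤m+n (length T) (suc N)))))
        (≤-trans t′≤ (*-monoʳ-≤ N (+-monoˡ-≤ 5 (*-monoʳ-≤ 2 (≤-trans (+-monoˡ-≤ N (exec-length (opAt p c) T)) (≤-reflexive (sym (+-suc (length T) N)))))))) ,
      (ending (cong (λ d → ⟨ afterOp d ∣ [] ∣ nothing ∣ map just (proj₁ (exec (opAt p c) T)) ++ nothing ∷ [] ⟩) n) e ⨟ e′)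

    skip-marked : ∀ cs l r → goR fin₁ l (map just (map inj₂ cs) ++ r) ⟶[ length cs ] goR fin₁ (map just (map inj₂ cs) ʳ++ l) r
    skip-marked []       l r = by refl
    skip-marked (a ∷ cs) l r = δ-step fin₁ l (just (inj₂ a)) (map just (map inj₂ cs) ++ r) refl ⨟ skip-marked cs _ r

    takeIO-plain : ∀ out → takeIO (map enc (map just (map inj₁ out) ++ nothing ∷ [])) ≡ out
    takeIO-plain []        = refl
    takeIO-plain (s ∷ out) = cong (s ∷_) (takeIO-plain out)

    halt-here : ∀ out l → ∃ λ r → ∃ λ x → (goR fin₁ l (map just (map inj₁ out) ++ nothing ∷ []) ⟶[ 1 ] ⟨ halt ∣ l ∣ x ∣ r ⟩) ×
      takeIO (map enc (x ∷ r)) ≡ out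
    halt-here []        l = [] , nothing , δ-step fin₁ l nothing [] refl , refl
    halt-here (s ∷ out) l = _ , just (inj₁ s) , δ-step fin₁ l (just (inj₁ s)) _ refl , cong (s ∷_) (takeIO-plain out)

    -- Besides the operations, one step creates the left blank, one leaves it at the end, `cells`
    -- steps cross the marked input and one halts.
    totalTime : ℕ → ℕ → ℕ → ℕ
    totalTime N len cells = 1 + (opTime N (len + N) + (1 + (cells + 1)))

    -- Every `t` from the total time on is allowed, because `PolyTimeComputable` looks at the
    -- configuration after exactly as many steps as its bound says; a halted configuration no longer
    -- changes.
    machine-correct : ∀ s ss cs out b N → Runs p (map inj₁ (s ∷ ss)) b (map inj₂ cs ++ map inj₁ out) N →
      ∀ t → totalTime N (suc (length ss)) (length cs) ≤ t →
      let fin = run machine t (initial machine (s ∷ ss)) in T (halted machine fin) × output machine fin ≡ out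
    machine-correct s ss cs out b N h t t≥
      with t₁ , t₁≤ , e₁ ← run-reach [] []ᵇ h | r , x , e₂ , o ← halt-here out (map just (map inj₂ cs) ʳ++ (nothing ∷ [])) =
      subst (λ c → T (halted machine c) × output machine c ≡ out) (sym final-config)
        (subst T (sym (cong isHalt (from-to F halt))) _ , o)
      where
      input = map inj₁ (s ∷ ss)
      start-config : initial machine (s ∷ ss) ≡ ⟨ init ∣ [] ∣ just (inj₁ s) ∣ map just (map inj₁ ss) ⟩
      start-config = cong (cfg _ [] _) (trans (map-cong (λ _ → refl) ss) (trans (map-∘ ss) (map-∘ (map inj₁ ss))))
      l′ = map just (map inj₂ cs) ʳ++ (nothing ∷ [])
      total = 1 + (t₁ + (1 + (length cs + 1)))
      total≤ : total ≤ t
      total≤ = ≤-trans (s≤s (+-monoˡ-≤ _ (≤-trans t₁≤ (≤-reflexive (cong (λ k → opTime N (k + N)) (length-map inj₁ (s ∷ ss))))))) t≥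
      tape = map just (map inj₂ cs ++ map inj₁ out) ++ nothing ∷ []
      after = ⟨ fin₀ ∣ [] ∣ nothing ∣ tape ⟩
      whole : ⟨ init ∣ [] ∣ just (inj₁ s) ∣ map just (map inj₁ ss) ⟩ ⟶[ total ] ⟨ halt ∣ l′ ∣ x ∣ r ⟩
      whole = δ-step init [] (just (inj₁ s)) (map just (map inj₁ ss)) refl ⨟
        (subst (λ r → ⟨ home (entry p) ∣ [] ∣ nothing ∣ r ⟩ ⟶[ t₁ ] after) (++-identityʳ (map just input)) e₁ ⨟
        (δ-step fin₀ [] nothing tape refl ⨟
        (subst (λ r → goR fin₁ (nothing ∷ []) r ⟶[ length cs ] goR fin₁ l′ (map just (map inj₁ out) ++ nothing ∷ []))
          (trans (sym (++-assoc (map just (map inj₂ cs)) _ _)) (cong (_++ nothing ∷ []) (sym (map-++ just (map inj₂ cs) _))))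
          (skip-marked cs (nothing ∷ []) (map just (map inj₁ out) ++ nothing ∷ [])) ⨟ e₂)))
      final-config : run machine t (initial machine (s ∷ ss)) ≡ ⟨ halt ∣ l′ ∣ x ∣ r ⟩
      final-config = begin
        run machine t (initial machine (s ∷ ss))                       ≡⟨ cong₂ (run machine) (sym (m+[n∸m]≡n total≤)) start-config ⟩
        run machine (total + (t ∸ total)) ⟨ init ∣ [] ∣ just (inj₁ s) ∣ map just (map inj₁ ss) ⟩ ≡⟨ run-+ machine total (t ∸ total) ⟨ init ∣ [] ∣ just (inj₁ s) ∣ map just (map inj₁ ss) ⟩ ⟩
        run machine (t ∸ total) (run machine total ⟨ init ∣ [] ∣ just (inj₁ s) ∣ map just (map inj₁ ss) ⟩)                  ≡⟨ cong (run machine (t ∸ total)) (_⟶[_]_.run-eq whole) ⟩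
        run machine (t ∸ total) ⟨ halt ∣ l′ ∣ x ∣ r ⟩                  ≡⟨ run-halted machine (t ∸ total) ⟨ halt ∣ l′ ∣ x ∣ r ⟩ (cong isHalt (from-to F halt)) ⟩
        ⟨ halt ∣ l′ ∣ x ∣ r ⟩                                          ∎


-- Tapes with marked cells

marks : ∀ M → (ℕ → Bool) → Vec Bool M
marks zero    P = []
marks (suc M) P = P 0 ∷ marks M (P ∘ suc)

marks-cong : ∀ M {P P′} → P ≗ P′ → marks M P ≡ marks M P′
marks-cong zero    e = refl
marks-cong (suc M) e = cong₂ _∷_ (e 0) (marks-cong M (e ∘ suc))

get : ∀ {M} → ℕ → Vec Bool M → Bool
get x       []       = false
get zero    (b ∷ bs) = b
get (suc x) (b ∷ bs) = get x bs

set : ∀ {M} → ℕ → Bool → Vec Bool M → Vec Bool M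
set x       b []       = []
set zero    b (_ ∷ bs) = b ∷ bs
set (suc x) b (c ∷ bs) = c ∷ set x b bs

get-marks : ∀ {M x} P → x < M → get x (marks M P) ≡ P x
get-marks {suc M} {zero}  P _       = refl
get-marks {suc M} {suc x} P (s≤s p) = get-marks (P ∘ suc) p

set-marks : ∀ M x b P → set x b (marks M P) ≡ marks M (update P x b)
set-marks zero    x       b P = refl
set-marks (suc M) zero    b P = refl
set-marks (suc M) (suc x) b P = cong (P 0 ∷_) (set-marks M x b (P ∘ suc))

isS1 : IO → Bool
isS1 (fsuc fzero) = true
isS1 _            = false

module Heads (M : ℕ) where

  Cl : Set
  Cl = IO × Vec Bool M

  finite-Cl : Finite Cl
  finite-Cl = finite-× (finite-Fin 5) (finite-Vec M)

  open Machine Cl finite-Cl public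

  -- Each cell has one bit per head, so heads may share a cell and equality of two positions shows
  -- in a single cell.
  cells : (ℕ → ℕ) → ℕ → List IO → List Cl
  cells pos j []       = []
  cells pos j (s ∷ ss) = (s , marks M (λ x → pos x ≡ᵇ j)) ∷ cells pos (suc j) ss

  passC : (Bool → Cl → Cl × Bool) → Bool → Γ → Γ × Bool
  passC f q (inj₁ s) = inj₁ s , q
  passC f q (inj₂ c) = inj₂ (proj₁ (f q c)) , proj₂ (f q c)

  mealyC : (Bool → Cl → Cl × Bool) → Bool → List Cl → List Cl × Bool
  mealyC f q []       = [] , q
  mealyC f q (c ∷ cs) = proj₁ (f q c) ∷ proj₁ (mealyC f (proj₂ (f q c)) cs) , proj₂ (mealyC f (proj₂ (f q c)) cs)

  mealy-tape : ∀ f q cs out → mealy (passC f) q (map inj₂ cs ++ map inj₁ out) ≡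
    (map inj₂ (proj₁ (mealyC f q cs)) ++ map inj₁ out , proj₂ (mealyC f q cs))
  mealy-tape f q []       []        = refl
  mealy-tape f q []       (s ∷ out) = cong (λ (T , r) → inj₁ s ∷ T , r) (mealy-tape f q [] out)
  mealy-tape f q (c ∷ cs) out       = cong (λ (T , r) → inj₂ (proj₁ (f q c)) ∷ T , r) (mealy-tape f (proj₂ (f q c)) cs out)

  -- In `advance` the Mealy state remembers whether the previous cell carried the mark, so one pass
  -- shifts it by one cell; in `reset` only the first cell sees the initial state `true`.
  advance reset : ℕ → Op
  advance x = record { pass = passC (λ q (s , bs) → (s , set x q bs) , get x bs) ; begin₀ = false ; append = nothing ; result = λ _ → false }
  reset x   = record { pass = passC (λ q (s , bs) → (s , set x q bs) , false) ; begin₀ = true ; append = nothing ; result = λ _ → false }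

  probe : ℕ → (IO → Vec Bool M → Bool) → Op
  probe x g = record { pass = passC (λ q (s , bs) → (s , bs) , q ∨ (get x bs ∧ g s bs)) ; begin₀ = false ; append = nothing ; result = id }

  emitO : IO → Op
  emitO s = record { pass = passC (λ q c → c , q) ; begin₀ = false ; append = just (inj₁ s) ; result = λ _ → false }

  retO : Bool → Op
  retO b = record { pass = passC (λ q c → c , q) ; begin₀ = false ; append = nothing ; result = λ _ → b }

  -- The first cell receives all marks: every head starts at position 0.
  markO : Op
  markO = record { pass = λ { q (inj₁ s) → inj₂ (s , marks M (λ _ → q)) , false ; q (inj₂ c) → inj₂ c , q }
                 ; begin₀ = true ; append = nothing ; result = λ _ → false }

  seq : Prog → Prog → Prog
  seq p q = ite p q q

  -- A body that returns `true` ends the loop with `true`, as the search for a witness requires;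
  -- loops that only move heads or print have bodies that return `false`.
  scan : ℕ → Op → Prog → Prog
  scan h guard body = loop (op guard) (ite body (op (retO true)) (op (advance h)))

  -- A round costs its guard, its body and one closing operation; the last guard, which fails, comes
  -- on top.
  scanTime : ℕ → ℕ → ℕ
  scanTime k N = suc (k * (2 + N))

  module On (inp : List IO) where

    tape : (ℕ → ℕ) → List IO → List Γ
    tape pos out = map inj₂ (cells pos 0 inp) ++ map inj₁ out

    record Does (p : Prog) (pos : ℕ → ℕ) (out : List IO) (b : Bool) (pos′ : ℕ → ℕ) (out′ : List IO) (N : ℕ) : Set where
      constructor does
      field runs : Runs p (tape pos out) b (tape pos′ out′) N

    ≡ᵇ-update : ∀ pos x j k y → update (λ z → pos z ≡ᵇ j) x (k ≡ᵇ j) y ≡ (update pos x k y ≡ᵇ j)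
    ≡ᵇ-update pos x j k y with x ≡ᵇ y
    ... | true  = refl
    ... | false = refl

    set-cell : ∀ pos x k j → set x (k ≡ᵇ j) (marks M (λ y → pos y ≡ᵇ j)) ≡ marks M (λ y → update pos x k y ≡ᵇ j)
    set-cell pos x k j = trans (set-marks M x (k ≡ᵇ j) _) (marks-cong M (≡ᵇ-update pos x j k))

    does-cellwise : ∀ f q r {pos pos′ out b} app → proj₁ (mealyC f q (cells pos 0 inp)) ≡ cells pos′ 0 inp →
      r (proj₂ (mealyC f q (cells pos 0 inp))) ≡ b →
      Does (op (record { pass = passC f ; begin₀ = q ; append = Maybe.map inj₁ app ; result = r })) pos out b pos′ (out ++ List.fromMaybe app) 1
    does-cellwise f q r {pos} {pos′} {out} app e e′ = does (runs-op _ (trans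
      (cong (λ (T , b) → T ++ List.fromMaybe (Maybe.map inj₁ app) , r b) (mealy-tape f q (cells pos 0 inp) out))
      (cong₂ _,_ (trans (++-assoc (map inj₂ (proj₁ (mealyC f q (cells pos 0 inp)))) _ _)
        (cong₂ _++_ (cong (map inj₂) e) (trans (cong (map inj₁ out ++_) (fromMaybe-map app)) (sym (map-++ inj₁ out _))))) e′)))
      where
      fromMaybe-map : ∀ (app : Maybe IO) → List.fromMaybe (Maybe.map inj₁ app) ≡ map inj₁ (List.fromMaybe app)
      fromMaybe-map nothing  = refl
      fromMaybe-map (just _) = refl

    does-silent : ∀ f q r {pos pos′ out b} → proj₁ (mealyC f q (cells pos 0 inp)) ≡ cells pos′ 0 inp →
      r (proj₂ (mealyC f q (cells pos 0 inp))) ≡ b →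
      Does (op (record { pass = passC f ; begin₀ = q ; append = nothing ; result = r })) pos out b pos′ out 1
    does-silent f q r {out = out} e e′ = subst (λ o → Does _ _ out _ _ o 1) (++-identityʳ out) (does-cellwise f q r nothing e e′)

    does-advance : ∀ {x pos out} → x < M → Does (op (advance x)) pos out false (update pos x (suc (pos x))) out 1
    does-advance {x} {pos} x<M = does-silent _ false (λ _ → false) (go 0 inp) refl
      where
      go : ∀ j ss → proj₁ (mealyC (λ q (s , bs) → (s , set x q bs) , get x bs) (suc (pos x) ≡ᵇ j) (cells pos j ss)) ≡
                    cells (update pos x (suc (pos x))) j ss
      go j []       = refl
      go j (s ∷ ss) = cong₂ _∷_ (cong (s ,_) (set-cell pos x (suc (pos x)) j))
        (trans (cong (λ q → proj₁ (mealyC _ q (cells pos (suc j) ss))) (get-marks (λ y → pos y ≡ᵇ j) x<M)) (go (suc j) ss))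

    does-reset : ∀ {x pos out} → Does (op (reset x)) pos out false (update pos x 0) out 1
    does-reset {x} {pos} = does-silent _ true (λ _ → false) (go 0 inp) refl
      where
      go : ∀ j ss → proj₁ (mealyC (λ q (s , bs) → (s , set x q bs) , false) (0 ≡ᵇ j) (cells pos j ss)) ≡
                    cells (update pos x 0) j ss
      go j []       = refl
      go j (s ∷ ss) = cong₂ _∷_ (cong (s ,_) (set-cell pos x 0 j)) (go (suc j) ss)

    identity-cells : ∀ q cs → mealyC (λ q c → c , q) q cs ≡ (cs , q)
    identity-cells q []       = refl
    identity-cells q (c ∷ cs) = cong (λ (T , r) → c ∷ T , r) (identity-cells q cs)

    does-emit : ∀ {s pos out} → Does (op (emitO s)) pos out false pos (out ++ s ∷ []) 1
    does-emit {s} = does-cellwise _ false (λ _ → false) (just s) (cong proj₁ (identity-cells false _)) refl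

    does-ret : ∀ {b pos out} → Does (op (retO b)) pos out b pos out 1
    does-ret {b} = does-silent _ false (λ _ → b) (cong proj₁ (identity-cells false _)) refl

    runs-mark : Runs (op markO) (map inj₁ inp) false (tape (λ _ → 0) []) 1
    runs-mark = runs-op markO (cong (λ T → T ++ [] , false) (go 0 inp))
      where
      go : ∀ j ss → proj₁ (mealy (Op.pass markO) (0 ≡ᵇ j) (map inj₁ ss)) ≡ map inj₂ (cells (λ _ → 0) j ss)
      go j []       = refl
      go j (s ∷ ss) = cong (_ ∷_) (go (suc j) ss)

    module _ (x : ℕ) (x<M : x < M) (g : IO → Vec Bool M → Bool) (pos : ℕ → ℕ) where

      private
        f : Bool → Cl → Cl × Bool
        f q (s , bs) = (s , bs) , q ∨ (get x bs ∧ g s bs)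

      probe-keeps : ∀ q j ss → proj₁ (mealyC f q (cells pos j ss)) ≡ cells pos j ss
      probe-keeps q j []       = refl
      probe-keeps q j (s ∷ ss) = cong (_ ∷_) (probe-keeps _ (suc j) ss)

      probe-past : ∀ q j ss → pos x < j → proj₂ (mealyC f q (cells pos j ss)) ≡ q
      probe-past q j []       lt = refl
      probe-past q j (s ∷ ss) lt rewrite get-marks {M} (λ y → pos y ≡ᵇ j) x<M | ≢⇒≡ᵇ-false (<⇒≢ lt) =
        trans (probe-past (q ∨ false) (suc j) ss (m≤n⇒m≤1+n lt)) (∨-identityʳ q)

      -- Only the cell at `pos x` carries the mark of `x`, so the cells before and after it leave
      -- the collected Boolean unchanged.
      probe-at : ∀ j pre s post → pos x ≡ j + length pre →
        proj₂ (mealyC f false (cells pos j (pre ++ s ∷ post))) ≡ g s (marks M (λ y → pos y ≡ᵇ pos x))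
      probe-at j []        s post e rewrite get-marks {M} (λ y → pos y ≡ᵇ j) x<M | trans e (+-identityʳ j) | ≡ᵇ-refl j =
        probe-past _ (suc j) post (s≤s (≤-reflexive (trans e (+-identityʳ j))))
      probe-at j (u ∷ pre) s post e
        rewrite get-marks {M} (λ y → pos y ≡ᵇ j) x<M | ≢⇒≡ᵇ-false (λ p → m≢1+m+n j (trans (sym p) (trans e (+-suc j (length pre))))) =
        probe-at (suc j) pre s post (trans e (+-suc j (length pre)))

      does-probe : ∀ pre s post {out} → inp ≡ pre ++ s ∷ post → pos x ≡ length pre →
        Does (op (probe x g)) pos out (g s (marks M (λ y → pos y ≡ᵇ pos x))) pos out 1
      does-probe pre s post refl e = does-silent f false id (probe-keeps false 0 _) (probe-at 0 pre s post e)

    does-seq : ∀ {p q pos out b pos′ out′ b′ pos″ out″ N N′} → Does p pos out b pos′ out′ N → Does q pos′ out′ b′ pos″ out″ N′ →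
      Does (seq p q) pos out b′ pos″ out″ (N + N′)
    does-seq {p} {q} {b = true}  (does h) (does h′) = does (runs-then p q q h h′)
    does-seq {p} {q} {b = false} (does h) (does h′) = does (runs-else p q q h h′)

    does-then : ∀ {p q r pos out pos′ out′ b′ pos″ out″ N N′} → Does p pos out true pos′ out′ N → Does q pos′ out′ b′ pos″ out″ N′ →
      Does (ite p q r) pos out b′ pos″ out″ (N + N′)
    does-then {p} {q} {r} (does h) (does h′) = does (runs-then p q r h h′)

    does-else : ∀ {p q r pos out pos′ out′ b′ pos″ out″ N N′} → Does p pos out false pos′ out′ N → Does r pos′ out′ b′ pos″ out″ N′ →
      Does (ite p q r) pos out b′ pos″ out″ (N + N′)
    does-else {p} {q} {r} (does h) (does h′) = does (runs-else p q r h h′)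

    does-weaken : ∀ {p pos out b pos′ out′ N N′} → N ≤ N′ → Does p pos out b pos′ out′ N → Does p pos out b pos′ out′ N′
    does-weaken le (does h) = does (weaken le h)

    module _ {h guard body} (h<M : h < M) (lim N : ℕ)
      (I : ℕ → (ℕ → ℕ) → List IO → Set) (Q : (ℕ → ℕ) → List IO → Set)
      (guard-on  : ∀ j pos out → j < lim → pos h ≡ j → I j pos out → Does (op guard) pos out true pos out 1)
      (guard-off : ∀ pos out → pos h ≡ lim → I lim pos out → Does (op guard) pos out false pos out 1)
      (body-step : ∀ j pos out → j < lim → pos h ≡ j → I j pos out →
        ∃ λ b → ∃ λ pos′ → ∃ λ out′ → Does body pos out b pos′ out′ N ×
          (b ≡ true → Q pos′ out′) × (b ≡ false → pos′ h ≡ j × I (suc j) (update pos′ h (suc j)) out′))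
      where

      -- A loop rule: `I j` is the invariant with head `h` at `j`, `Q` describes an early exit, and
      -- `k` counts the remaining rounds. A body that returns `false` must leave `h` where it was,
      -- since the loop advances it.
      does-scan : ∀ k j pos out → k + j ≡ lim → pos h ≡ j → I j pos out →
        ∃ λ b → ∃ λ pos′ → ∃ λ out′ → Does (scan h guard body) pos out b pos′ out′ (scanTime k N) ×
          (b ≡ true → Q pos′ out′) × (b ≡ false → I lim pos′ out′)
      does-scan zero    j pos out refl e i with does g ← guard-off pos out e i =
        false , pos , out , does (runs-loop-end _ _ g) , (λ ()) , (λ _ → i)
      does-scan (suc k) j pos out k+j e i
        with does g ← guard-on j pos out (≤-trans (s≤s (m≤n+m j k)) (≤-reflexive k+j)) e i
           | body-step j pos out (≤-trans (s≤s (m≤n+m j k)) (≤-reflexive k+j)) e i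
      ... | true  , pos′ , out′ , d , q , _ with does d′ ← does-then {r = op (advance h)} d (does-ret {true}) =
        true , pos′ , out′ , does (weaken (enough k) (runs-loop-break _ _ g d′)) , (λ _ → q refl) , (λ ())
        where
        enough : ∀ k → 1 + (N + 1) ≤ scanTime (suc k) N
        enough k = s≤s (≤-trans (≤-reflexive (+-comm N 1)) (≤-trans (n≤1+n (suc N)) (m≤m+n (2 + N) _)))
      ... | false , pos′ , out′ , d , _ , i′ with p , i″ ← i′ refl
        with does d′ ← does-else {q = op (retO true)} d (does-advance {h} {pos′} h<M)
           | b , pos″ , out″ , does l , q , r ← does-scan k (suc j) (update pos′ h (suc j)) out′ (trans (+-suc k j) k+j) (update-same pos′ h (suc j)) i″ =
        b , pos″ , out″ ,
        does (weaken (≤-reflexive (solve 2 (λ k N → con 1 :+ ((N :+ con 1) :+ (con 1 :+ k)) := con 1 :+ ((con 2 :+ N) :+ k)) refl (k * (2 + N)) N))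
          (runs-loop-again _ _ g (subst (λ z → Runs _ _ false (tape (update pos′ h (suc z)) out′) (N + 1)) p d′) l)) ,
        q , r

-- Evaluating first-order formulae

-- De Bruijn indices as levels: the head of a variable does not change when more variables are bound.
lev : ∀ {m} → Fin m → ℕ
lev {suc m} fzero    = m
lev {suc m} (fsuc i) = lev i

lev< : ∀ {m} (i : Fin m) → lev i < m
lev< fzero    = ≤-refl
lev< (fsuc i) = m≤n⇒m≤1+n (lev< i)

_⊕ₙ_ : ∀ {m} → (ℕ → Fin m) → ℕ → ℕ → Fin (suc m)
(e ⊕ₙ x) = update (fsuc ∘ e) x fzero

module Compile (σ : Vocab) (M : ℕ) where

  open Heads M

  -- The elements of the structure are the positions of the leading block of s1 in the input.
  inRange : ℕ → Op
  inRange h = probe h (λ s _ → isS1 s)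

  equal unequal : ℕ → ℕ → Op
  equal y x   = probe y (λ _ bs → get x bs)
  unequal y x = probe y (λ _ bs → not (get x bs))

  for : ℕ → Prog → Prog
  for h body = seq (op (reset h)) (scan h (inRange h) body)

  -- Moves the head p forward by n ^ k, where n is the size of the structure.
  skip : ℕ → ℕ → ℕ → Prog
  skip p zero    h = op (advance p)
  skip p (suc k) h = for h (skip p k (suc h))

  -- Each table ends with one separator, which the single `advance` crosses.
  toTable : (τ : Vocab) → Fin (length τ) → ℕ → ℕ → Prog
  toTable (k ∷ τ) fzero    p h = op (retO false)
  toTable (k ∷ τ) (fsuc r) p h = seq (skip p k h) (seq (op (advance p)) (toTable τ r p h))

  -- Tuples are listed lexicographically, so each component contributes its value times the size of
  -- a block of shorter tuples. The head `y` counts the blocks, from 0 until it meets the head of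
  -- that component.
  seek : ∀ {k} → Vec ℕ k → ℕ → ℕ → Prog
  seek         []       p y = op (retO false)
  seek {suc k} (x ∷ xs) p y = seq (seq (op (reset y)) (scan y (unequal y x) (skip p k (suc y)))) (seek xs p y)

  query : (r : RelSym σ) → Vec ℕ (arity σ r) → ℕ → Prog
  query r xs p =
    seq (op (reset p)) (seq (skip p 1 (suc p)) (seq (op (advance p))
      -- `inRange` tests for the symbol `s1`, which is also the code of `true`; at the table entry
      -- it reads the truth value.
      (seq (toTable σ r p (suc p)) (seq (seek xs p (suc p)) (op (inRange p))))))

  compileFO : ∀ {m} → FO σ → (ℕ → Fin m) → Prog
  compileFO     (x ≐ y)    e = op (equal (lev (e x)) (lev (e y)))
  compileFO {m} (rel r xs) e = query r (Vec.map (lev ∘ e) xs) m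
  compileFO     (¬ᶠ φ)     e = ite (compileFO φ e) (op (retO false)) (op (retO true))
  compileFO     (φ ∨ᶠ ψ)   e = ite (compileFO φ e) (op (retO true)) (compileFO ψ e)
  compileFO {m} (∃ᶠ x φ)   e = for m (compileFO φ (e ⊕ₙ x))
  compileFO     ⊤ᶠ         e = op (retO true)
  compileFO     ⊥ᶠ         e = op (retO false)

  -- Heads needed beyond those of the variables in scope. A lookup takes the pointer and a head for
  -- crossing the universe block; `sum σ` bounds every arity and hence the nesting of the loops that
  -- move the pointer.
  depthFO : FO σ → ℕ
  depthFO (rel r xs) = 2 + sum σ
  depthFO (¬ᶠ φ)     = depthFO φ
  depthFO (φ ∨ᶠ ψ)   = depthFO φ + depthFO ψ
  depthFO (∃ᶠ x φ)   = suc (depthFO φ)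
  depthFO _          = 0

  forTime : ℕ → ℕ → ℕ
  forTime n N = 1 + scanTime n N

  skipTime : ℕ → ℕ → ℕ
  skipTime n zero    = 1
  skipTime n (suc k) = forTime n (skipTime n k)

  toTableTime : ℕ → (τ : Vocab) → Fin (length τ) → ℕ
  toTableTime n (k ∷ τ) fzero    = 1
  toTableTime n (k ∷ τ) (fsuc r) = skipTime n k + (1 + toTableTime n τ r)

  seekTime : ℕ → ℕ → ℕ
  seekTime n zero    = 1
  seekTime n (suc k) = forTime n (skipTime n k) + seekTime n k

  queryTime : ℕ → RelSym σ → ℕ
  queryTime n r = 1 + (skipTime n 1 + (1 + (toTableTime n σ r + (seekTime n (arity σ r) + 1))))

  timeFO : ℕ → FO σ → ℕ
  timeFO n (rel r xs) = queryTime n r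
  timeFO n (¬ᶠ φ)     = timeFO n φ + 1
  timeFO n (φ ∨ᶠ ψ)   = timeFO n φ + (1 + timeFO n ψ)
  timeFO n (∃ᶠ x φ)   = forTime n (timeFO n φ)
  timeFO n _          = 1

evalFO-cong : ∀ {σ} (A : Structure σ) φ {v v′ : FOAssign (card A)} → v ≗ v′ → evalFO A φ v ≡ evalFO A φ v′
evalFO-cong A (x ≐ y)    e = cong₂ eqFin (e x) (e y)
evalFO-cong A (rel r xs) e = cong (Structure.rel A r) (Vecₚ.map-cong e xs)
evalFO-cong A (¬ᶠ φ)     e = cong not (evalFO-cong A φ e)
evalFO-cong A (φ ∨ᶠ ψ)   e = cong₂ _∨_ (evalFO-cong A φ e) (evalFO-cong A ψ e)
evalFO-cong A (∃ᶠ x φ)   e = cong or (map-cong (λ a → evalFO-cong A φ (update-cong x a e)) (allFin (card A)))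
evalFO-cong A ⊤ᶠ         e = refl
evalFO-cong A ⊥ᶠ         e = refl

lookup-⊕ₙ : ∀ {n m} (ρ : Vec (Fin n) m) (e : ℕ → Fin m) x a y →
  Vec.lookup (a ∷ ρ) ((e ⊕ₙ x) y) ≡ update (λ y → Vec.lookup ρ (e y)) x a y
lookup-⊕ₙ ρ e x a y with x ≡ᵇ y
... | true  = refl
... | false = refl

-- Offsets in the encoded structure

index : ∀ {n k} → Vec (Fin n) k → ℕ
index             []      = 0
index {n} {suc k} (a ∷ t) = toℕ a * n ^ k + index t

length-concatMap : ∀ {A B : Set} (f : A → List B) c xs → (∀ x → length (f x) ≡ c) → length (concatMap f xs) ≡ length xs * c
length-concatMap f c []       e = refl
length-concatMap f c (x ∷ xs) e = trans (length-++ (f x)) (cong₂ _+_ (e x) (length-concatMap f c xs e))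

length-allTuples : ∀ n k → length (allTuples n k) ≡ n ^ k
length-allTuples n zero    = refl
length-allTuples n (suc k) = trans
  (length-concatMap _ (n ^ k) (allFin n) (λ a → trans (length-map (a ∷_) (allTuples n k)) (length-allTuples n k)))
  (cong (_* n ^ k) (length-tabulate (id {A = Fin n})))

-- Offsets are kept as factorisations of the list, the form in which `does-probe` asks for the cell
-- under a head.
data At {A : Set} (xs : List A) (i : ℕ) (ys : List A) : Set where
  at : ∀ pre post → xs ≡ pre ++ ys ++ post → length pre ≡ i → At xs i ys

at-shift : ∀ {A : Set} {xs ys : List A} {i j} → i ≡ j → At xs i ys → At xs j ys
at-shift refl h = h

at-map : ∀ {A B : Set} (f : A → B) {xs i ys} → At xs i ys → At (map f xs) i (map f ys)
at-map f {ys = ys} (at pre post refl refl) =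
  at (map f pre) (map f post) (trans (map-++ f pre _) (cong (map f pre ++_) (map-++ f ys post))) (length-map f pre)

at-trans : ∀ {A : Set} {xs ys zs : List A} {i j} → At xs i ys → At ys j zs → At xs (j + i) zs
at-trans {zs = zs} {i} {j} (at pre post refl refl) (at pre′ post′ refl refl) = at (pre ++ pre′) (post′ ++ post)
  (trans (cong (pre ++_) (trans (++-assoc pre′ _ post) (cong (pre′ ++_) (++-assoc zs post′ post)))) (sym (++-assoc pre pre′ _)))
  (trans (length-++ pre) (+-comm (length pre) _))

at-++ˡ : ∀ {A : Set} (us : List A) {xs i ys} → At xs i ys → At (us ++ xs) (i + length us) ys
at-++ˡ us (at pre post refl refl) = at (us ++ pre) post (sym (++-assoc us pre _)) (trans (length-++ us) (+-comm (length us) _))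

at-++ʳ : ∀ {A : Set} (us : List A) {xs i ys} → At xs i ys → At (xs ++ us) i ys
at-++ʳ us {ys = ys} (at pre post refl refl) = at pre (post ++ us)
  (trans (++-assoc pre _ us) (cong (pre ++_) (++-assoc ys post us))) refl

at-concatMap : ∀ {A B : Set} (f : A → List B) c → (∀ x → length (f x) ≡ c) → ∀ {n} (g : Fin n → A) i →
  At (concatMap f (List.tabulate g)) (toℕ i * c) (f (g i))
at-concatMap f c e g fzero    = at [] _ refl refl
at-concatMap f c e g (fsuc i) = at-shift
  (trans (cong (toℕ i * c +_) (e (g fzero))) (+-comm (toℕ i * c) c)) (at-++ˡ (f (g fzero)) (at-concatMap f c e (g ∘ fsuc) i))

at-allTuples : ∀ {n k} (t : Vec (Fin n) k) → At (allTuples n k) (index t) (t ∷ [])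
at-allTuples             []      = at [] [] refl refl
at-allTuples {n} {suc k} (a ∷ t) = at-shift (+-comm (index t) _)
  (at-trans (at-concatMap (λ a → map (a ∷_) (allTuples n k)) (n ^ k)
    (λ a → trans (length-map (a ∷_) (allTuples n k)) (length-allTuples n k)) id a) (at-map (a ∷_) (at-allTuples t)))

base : ℕ → (τ : Vocab) → Fin (length τ) → ℕ
base n (k ∷ τ) fzero    = 0
base n (k ∷ τ) (fsuc r) = base n τ r + suc (n ^ k)

table : ∀ {n k} → (Vec (Fin n) k → Bool) → List IO
table {n} {k} f = map (λ t → bit (f t)) (allTuples n k) ++ sa ∷ []

at-table : ∀ {n} (τ : Vocab) (f : (r : Fin (length τ)) → Vec (Fin n) (List.lookup τ r) → Bool) r →
  At (concatMap (λ r → table (f r)) (allFin (length τ))) (base n τ r) (table (f r))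
at-table         (k ∷ τ) f fzero    = at [] _ refl refl
at-table {n} (k ∷ τ) f (fsuc r) = subst₂ (λ xs l → At (table (f fzero) ++ xs) (base n τ r + l) (table (f (fsuc r))))
  (trans (cong List.concat (map-tabulate id (λ r → table (f (fsuc r))))) (cong List.concat (sym (map-tabulate fsuc (λ r → table (f r))))) )
  (trans (length-++ (map (λ t → bit (f fzero t)) (allTuples n k)))
    (trans (+-comm _ 1) (cong suc (trans (length-map _ (allTuples n k)) (length-allTuples n k)))))
  (at-++ˡ (table (f fzero)) (at-table τ (λ r → f (fsuc r)) r))

isS1-bit : ∀ b → isS1 (bit b) ≡ b
isS1-bit true  = refl
isS1-bit false = refl

any-∷ʳ : ∀ {A : Set} (p : A → Bool) xs x → any p (xs List.∷ʳ x) ≡ any p xs ∨ p x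
any-∷ʳ p xs x = trans (any-++ p xs (x ∷ [])) (cong (any p xs ∨_) (∨-identityʳ (p x)))

arity≤sum : ∀ (τ : Vocab) r → List.lookup τ r ≤ sum τ
arity≤sum (k ∷ τ) fzero    = m≤m+n k (sum τ)
arity≤sum (k ∷ τ) (fsuc r) = ≤-trans (arity≤sum τ r) (m≤n+m (sum τ) k)

module CorrectFO {σ : Vocab} (A : Structure σ) (M : ℕ) where

  open Heads M
  open Compile σ M

  n : ℕ
  n = card A

  inp : List IO
  inp = encStructure A

  open On inp

  tables : List IO
  tables = concatMap (λ r → table (Structure.rel A r)) (allFin (length σ))

  unary-split : ∀ k j xs → j < k → ∃ λ post → List.replicate k s1 ++ xs ≡ List.replicate j s1 ++ s1 ∷ post
  unary-split (suc k) zero    xs _        = _ , refl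
  unary-split (suc k) (suc j) xs (s≤s lt) with post , e ← unary-split k j xs lt = post , cong (s1 ∷_) e

  probe-unary : ∀ {x} → x < M → ∀ g {pos out} → pos x < n → Does (op (probe x g)) pos out (g s1 (marks M (λ y → pos y ≡ᵇ pos x))) pos out 1
  probe-unary {x} x<M g {pos} lt with post , e ← unary-split n (pos x) (sa ∷ tables) lt =
    does-probe x x<M g pos (List.replicate (pos x) s1) s1 post e (sym (length-replicate (pos x)))

  inRange-on : ∀ {h} → h < M → ∀ j pos out → j < n → pos h ≡ j → Does (op (inRange h)) pos out true pos out 1
  inRange-on h<M j pos out lt refl = probe-unary h<M _ lt

  inRange-off : ∀ {h} → h < M → ∀ pos out → pos h ≡ n → Does (op (inRange h)) pos out false pos out 1
  inRange-off {h} h<M pos out e = does-probe h h<M _ pos (List.replicate n s1) sa tables refl (trans e (sym (length-replicate n)))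

  module _ {x y} (y<M : y < M) (x<M : x < M) {pos : ℕ → ℕ} {out : List IO} (lt : pos y < n) where

    does-equal : Does (op (equal y x)) pos out (pos x ≡ᵇ pos y) pos out 1
    does-equal = subst (λ b → Does (op (equal y x)) pos out b pos out 1) (get-marks (λ z → pos z ≡ᵇ pos y) x<M) (probe-unary y<M (λ _ bs → get x bs) lt)

    does-unequal : Does (op (unequal y x)) pos out (not (pos x ≡ᵇ pos y)) pos out 1
    does-unequal = subst (λ b → Does (op (unequal y x)) pos out (not b) pos out 1) (get-marks (λ z → pos z ≡ᵇ pos y) x<M) (probe-unary y<M (λ _ bs → not (get x bs)) lt)

  Keeps : ℕ → (ℕ → ℕ) → (ℕ → ℕ) → Set
  Keeps h pos pos′ = ∀ x → x < h → pos′ x ≡ pos x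

  keeps-update : ∀ h pos v → Keeps h pos (update pos h v)
  keeps-update h pos v x lt = update-other pos h v (λ p → <⇒≢ lt (sym p))

  -- Heads from `h` on are scratch and `p` is moved on purpose; the remaining ones hold values still
  -- in use.
  KeepsExcept : ℕ → ℕ → (ℕ → ℕ) → (ℕ → ℕ) → Set
  KeepsExcept p h pos pos′ = ∀ x → x < h → x ≢ p → pos′ x ≡ pos x

  skip-correct : ∀ {p} k {h} → p < h → h + k ≤ M → ∀ pos out →
    ∃ λ pos′ → Does (skip p k h) pos out false pos′ out (skipTime n k) × pos′ p ≡ n ^ k + pos p × KeepsExcept p h pos pos′
  skip-correct {p} zero {h} p<h le pos out =
    update pos p (suc (pos p)) , does-advance (≤-trans p<h (≤-trans (m≤m+n h 0) le)) ,
    update-same pos p _ , (λ x _ x≢p → update-other pos p _ (x≢p ∘ sym))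
  skip-correct {p} (suc k) {h} p<h le pos out = finish (does-scan h<M n (skipTime n k) I (λ _ _ → ⊥) 
      (λ j pos out lt e _ → inRange-on h<M j pos out lt e) (λ pos out e _ → inRange-off h<M pos out e) body-step
      n 0 (update pos h 0) out (+-identityʳ n) (update-same pos h 0)
      (update-other pos h 0 p≢h , (λ x lt _ → keeps-update h pos 0 x lt) , refl))
    where
    h<M : h < M
    h<M = ≤-trans (s≤s (m≤m+n h k)) (≤-trans (≤-reflexive (sym (+-suc h k))) le)
    p≢h : h ≢ p
    p≢h e = <⇒≢ p<h (sym e)
    I : ℕ → (ℕ → ℕ) → List IO → Set
    I j pos′ out′ = pos′ p ≡ j * n ^ k + pos p × KeepsExcept p h pos pos′ × out′ ≡ out
    body-step : ∀ j pos′ out′ → j < n → pos′ h ≡ j → I j pos′ out′ → ∃ λ b → ∃ λ pos″ → ∃ λ out″ →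
      Does (skip p k (suc h)) pos′ out′ b pos″ out″ (skipTime n k) × (b ≡ true → ⊥) ×
      (b ≡ false → pos″ h ≡ j × I (suc j) (update pos″ h (suc j)) out″)
    body-step j pos′ out′ _ e (at-p , keeps , refl)
      with pos″ , d , moved , keeps′ ← skip-correct k (m≤n⇒m≤1+n p<h) (≤-trans (≤-reflexive (sym (+-suc h k))) le) pos′ out′ =
      false , pos″ , out′ , d , (λ ()) , λ _ →
      trans (keeps′ h ≤-refl p≢h) e ,
      trans (update-other pos″ h _ p≢h) (trans moved (trans (cong (n ^ k +_) at-p) (sym (+-assoc (n ^ k) _ _)))) ,
      (λ x lt x≢p → trans (keeps-update h pos″ (suc j) x lt) (trans (keeps′ x (m≤n⇒m≤1+n lt) x≢p) (keeps x lt x≢p))) ,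
      refl
    finish : (∃ λ b → ∃ λ pos′ → ∃ λ out′ → Does (scan h (inRange h) (skip p k (suc h))) (update pos h 0) out b pos′ out′ (scanTime n (skipTime n k)) ×
        (b ≡ true → ⊥) × (b ≡ false → I n pos′ out′)) →
      ∃ λ pos′ → Does (skip p (suc k) h) pos out false pos′ out (skipTime n (suc k)) × pos′ p ≡ n ^ suc k + pos p × KeepsExcept p h pos pos′
    finish (true  , _ , _ , _ , q , _) = ⊥-elim (q refl)
    finish (false , pos′ , out′ , d , _ , i) with at-p , keeps , refl ← i refl =
      pos′ , does-seq does-reset d , at-p , keeps

  toTable-correct : ∀ τ r {p h} → p < h → h + sum τ ≤ M → ∀ pos out →
    ∃ λ pos′ → Does (toTable τ r p h) pos out false pos′ out (toTableTime n τ r) × pos′ p ≡ base n τ r + pos p × KeepsExcept p h pos pos′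
  toTable-correct (k ∷ τ) fzero    p<h le pos out = pos , does-ret , refl , (λ _ _ _ → refl)
  toTable-correct (k ∷ τ) (fsuc r) {p} {h} p<h le pos out
    with pos₁ , d₁ , e₁ , k₁ ← skip-correct {p} k p<h (≤-trans (+-monoʳ-≤ h (m≤m+n k (sum τ))) le) pos out
    with pos₃ , d₃ , e₃ , k₃ ← toTable-correct τ r p<h (≤-trans (+-monoʳ-≤ h (m≤n+m (sum τ) k)) le) (update pos₁ p (suc (pos₁ p))) out =
    pos₃ , does-seq d₁ (does-seq (does-advance (≤-trans p<h (≤-trans (m≤m+n h _) le))) d₃) ,
    trans e₃ (trans (cong (base n τ r +_) (trans (update-same pos₁ p _) (cong suc e₁))) (sym (+-assoc (base n τ r) (suc (n ^ k)) (pos p)))) ,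
    (λ x lt ne → trans (k₃ x lt ne) (trans (update-other pos₁ p _ (ne ∘ sym)) (k₁ x lt ne)))

  seek-correct : ∀ {k} (ys : Vec ℕ k) (loc : ℕ → ℕ) (v : ℕ → Fin n) {p} → (∀ y → loc y < p) → suc p + k ≤ M → ∀ pos out →
    (∀ y → pos (loc y) ≡ toℕ (v y)) →
    ∃ λ pos′ → Does (seek (Vec.map loc ys) p (suc p)) pos out false pos′ out (seekTime n k) ×
      pos′ p ≡ index (Vec.map v ys) + pos p × KeepsExcept p p pos pos′
  seek-correct []       loc v loc< le pos out agree = pos , does-ret , refl , (λ _ _ _ → refl)
  seek-correct {suc k} (x ∷ ys) loc v {p} loc< le pos out agree =
    first (does-scan h<M (toℕ (v x)) (skipTime n k) I (λ _ _ → ⊥) guard-on guard-off body-step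
      (toℕ (v x)) 0 (update pos h 0) out (+-identityʳ _) (update-same pos h 0)
      (update-other pos h 0 (λ e → <⇒≢ (n<1+n p) (sym e)) , (λ y lt _ → keeps-update h pos 0 y (m≤n⇒m≤1+n lt)) , refl))
    where
    h = suc p
    h<M : h < M
    h<M = ≤-trans (s≤s (m≤m+n h k)) (≤-trans (≤-reflexive (sym (+-suc h k))) le)
    x<M : loc x < M
    x<M = ≤-trans (m≤n⇒m≤1+n (loc< x)) (≤-trans (n≤1+n h) h<M)
    I : ℕ → (ℕ → ℕ) → List IO → Set
    I j pos′ out′ = pos′ p ≡ j * n ^ k + pos p × KeepsExcept p p pos pos′ × out′ ≡ out
    target : ∀ j {pos′ out′} → I j pos′ out′ → pos′ (loc x) ≡ toℕ (v x)
    target j (_ , keeps , _) = trans (keeps (loc x) (loc< x) (<⇒≢ (loc< x))) (agree x)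
    guard-on : ∀ j pos′ out′ → j < toℕ (v x) → pos′ h ≡ j → I j pos′ out′ → Does (op (unequal h (loc x))) pos′ out′ true pos′ out′ 1
    guard-on j pos′ out′ lt refl i = subst (λ b → Does (op (unequal h (loc x))) pos′ out′ (not b) pos′ out′ 1)
      (≢⇒≡ᵇ-false (λ e → <⇒≢ lt (trans (sym e) (target j i)))) (does-unequal h<M x<M (≤-trans lt (<⇒≤ (Finₚ.toℕ<n (v x)))))
    guard-off : ∀ pos′ out′ → pos′ h ≡ toℕ (v x) → I (toℕ (v x)) pos′ out′ → Does (op (unequal h (loc x))) pos′ out′ false pos′ out′ 1
    guard-off pos′ out′ e i = subst (λ b → Does (op (unequal h (loc x))) pos′ out′ (not b) pos′ out′ 1)
      (trans (cong (pos′ (loc x) ≡ᵇ_) (trans e (sym (target (toℕ (v x)) i)))) (≡ᵇ-refl (pos′ (loc x))))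
      (does-unequal h<M x<M (≤-trans (s≤s (≤-reflexive e)) (Finₚ.toℕ<n (v x))))
    body-step : ∀ j pos′ out′ → j < toℕ (v x) → pos′ h ≡ j → I j pos′ out′ → ∃ λ b → ∃ λ pos″ → ∃ λ out″ →
      Does (skip p k (suc h)) pos′ out′ b pos″ out″ (skipTime n k) × (b ≡ true → ⊥) ×
      (b ≡ false → pos″ h ≡ j × I (suc j) (update pos″ h (suc j)) out″)
    body-step j pos′ out′ _ e (at-p , keeps , refl)
      with pos″ , d , moved , keeps′ ← skip-correct {p} k {suc h} (s≤s (n≤1+n p)) (≤-trans (≤-reflexive (sym (+-suc h k))) le) pos′ out′ =
      false , pos″ , out′ , d , (λ ()) , λ _ →
      trans (keeps′ h ≤-refl (λ e → <⇒≢ (n<1+n p) (sym e))) e ,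
      trans (update-other pos″ h _ (λ e → <⇒≢ (n<1+n p) (sym e))) (trans moved (trans (cong (n ^ k +_) at-p) (sym (+-assoc (n ^ k) _ _)))) ,
      (λ y lt y≢p → trans (keeps-update h pos″ (suc j) y (m≤n⇒m≤1+n lt)) (trans (keeps′ y (m≤n⇒m≤1+n (m≤n⇒m≤1+n lt)) y≢p) (keeps y lt y≢p))) ,
      refl
    first : (∃ λ b → ∃ λ pos′ → ∃ λ out′ → Does (scan h (unequal h (loc x)) (skip p k (suc h))) (update pos h 0) out b pos′ out′ (scanTime (toℕ (v x)) (skipTime n k)) ×
        (b ≡ true → ⊥) × (b ≡ false → I (toℕ (v x)) pos′ out′)) →
      ∃ λ pos′ → Does (seek (Vec.map loc (x ∷ ys)) p (suc p)) pos out false pos′ out (seekTime n (suc k)) ×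
        pos′ p ≡ index (Vec.map v (x ∷ ys)) + pos p × KeepsExcept p p pos pos′
    first (true  , _ , _ , _ , q , _) = ⊥-elim (q refl)
    first (false , pos₁ , out₁ , d₁ , _ , i) with at-p , keeps , refl ← i refl
      with pos₂ , d₂ , at-p′ , keeps′ ← seek-correct ys loc v loc< (≤-trans (+-monoʳ-≤ h (n≤1+n k)) le) pos₁ out
        (λ y → trans (keeps (loc y) (loc< y) (<⇒≢ (loc< y))) (agree y)) =
      pos₂ ,
      -- The loop makes `toℕ (v x)` rounds, fewer than `n`, and its time is rounded up to `n` rounds
      -- so that the bound depends on the size alone.
      does-seq (does-seq does-reset (does-weaken (s≤s (*-monoˡ-≤ (2 + skipTime n k) (<⇒≤ (Finₚ.toℕ<n (v x))))) d₁)) d₂ ,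
      trans at-p′ (trans (cong (index (Vec.map v ys) +_) at-p)
        (trans (sym (+-assoc (index (Vec.map v ys)) _ _)) (cong (_+ pos p) (+-comm (index (Vec.map v ys)) _)))) ,
      (λ y lt ne → trans (keeps′ y lt ne) (keeps y lt ne))

  -- The summand `suc n` skips the unary universe block and its separator.
  at-query : ∀ r (t : Vec (Fin n) (arity σ r)) → At inp (index t + (base n σ r + suc n)) (bit (Structure.rel A r t) ∷ [])
  at-query r t = at-shift (cong (λ k → index t + (base n σ r + k)) header)
    (at-trans
      (at-shift (+-assoc (base n σ r) _ _) (at-++ˡ (List.replicate n s1) (at-++ˡ (sa ∷ []) (at-table σ (Structure.rel A) r))))
      (at-++ʳ (sa ∷ []) (at-map (λ t → bit (Structure.rel A r t)) (at-allTuples t))))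
    where
    header : 1 + length (List.replicate n s1) ≡ suc n
    header = cong suc (length-replicate n)

  query-correct : ∀ r (ys : Vec ℕ (arity σ r)) (loc : ℕ → ℕ) (v : ℕ → Fin n) {p} → (∀ y → loc y < p) → p + (2 + sum σ) ≤ M → ∀ pos out →
    (∀ y → pos (loc y) ≡ toℕ (v y)) →
    ∃ λ pos′ → Does (query r (Vec.map loc ys) p) pos out (Structure.rel A r (Vec.map v ys)) pos′ out (queryTime n r) × Keeps p pos pos′
  query-correct r ys loc v {p} loc< le pos out agree
    with pos₁ , d₁ , e₁ , k₁ ← skip-correct {p} 1 {suc p} ≤-refl
           (≤-trans (≤-reflexive (sym (+-suc p 1))) (≤-trans (+-monoʳ-≤ p (m≤m+n 2 (sum σ))) le)) (update pos p 0) out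
    with pos₂ , d₂ , e₂ , k₂ ← toTable-correct σ r {p} {suc p} ≤-refl
           (≤-trans (≤-reflexive (sym (+-suc p (sum σ)))) (≤-trans (+-monoʳ-≤ p (n≤1+n _)) le)) (update pos₁ p (suc (pos₁ p))) out
    with kept ← (λ (x : ℕ) (lt : x < p) → trans (k₂ x (m≤n⇒m≤1+n lt) (<⇒≢ lt)) (trans (keeps-update p pos₁ _ x lt)
           (trans (k₁ x (m≤n⇒m≤1+n lt) (<⇒≢ lt)) (keeps-update p pos 0 x lt))))
    with pos₃ , d₃ , e₃ , k₃ ← seek-correct ys loc v {p} loc<
           (≤-trans (≤-reflexive (sym (+-suc p _))) (≤-trans (+-monoʳ-≤ p (s≤s (≤-trans (arity≤sum σ r) (n≤1+n _)))) le)) pos₂ out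
           (λ y → trans (kept (loc y) (loc< y)) (agree y))
    with at pre post e l ← at-query r (Vec.map v ys) =
    pos₃ ,
    does-seq does-reset (does-seq d₁ (does-seq (does-advance p<M) (does-seq d₂ (does-seq d₃
      (subst (λ b → Does (op (inRange p)) pos₃ out b pos₃ out 1) (isS1-bit _)
        (does-probe p p<M _ pos₃ pre _ post e (trans position (sym l)))))))) ,
    (λ x lt → trans (k₃ x lt (<⇒≢ lt)) (kept x lt))
    where
    p<M : p < M
    p<M = ≤-trans (≤-trans (m≤m+n (suc p) (1 + sum σ)) (≤-reflexive (sym (+-suc p _)))) le
    position : pos₃ p ≡ index (Vec.map v ys) + (base n σ r + suc n)
    position = trans e₃ (cong (index (Vec.map v ys) +_) (trans e₂ (cong (base n σ r +_)
      (trans (update-same pos₁ p _) (cong suc (trans e₁ (trans (cong₂ _+_ (*-identityʳ n) (update-same pos p 0)) (+-identityʳ n))))))))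

  Agree : ∀ {m} → (ℕ → ℕ) → Vec (Fin n) m → Set
  Agree {m} pos ρ = ∀ (i : Fin m) → pos (lev i) ≡ toℕ (Vec.lookup ρ i)

  agree-keeps : ∀ {m pos pos′} (ρ : Vec (Fin n) m) → Keeps m pos pos′ → Agree pos ρ → Agree pos′ ρ
  agree-keeps ρ k a i = trans (k (lev i) (lev< i)) (a i)

  agree-∷ : ∀ {m pos} (ρ : Vec (Fin n) m) a → pos m ≡ toℕ a → Agree pos ρ → Agree pos (a ∷ ρ)
  agree-∷ {pos = pos} ρ a e h fzero    = e
  agree-∷ {pos = pos} ρ a e h (fsuc i) = h i

  take-suc-allFin : ∀ j (lt : j < n) → List.take (suc j) (allFin n) ≡ List.take j (allFin n) List.∷ʳ Fin.fromℕ< lt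
  take-suc-allFin j lt = subst (λ k → List.take (suc k) (allFin n) ≡ List.take k (allFin n) List.∷ʳ Fin.fromℕ< lt)
    (Finₚ.toℕ-fromℕ< lt) (take-suc-tabulate id (Fin.fromℕ< lt))

  take-n : List.take n (allFin n) ≡ allFin n
  take-n = take-all n (allFin n) (≤-reflexive (length-tabulate (id {A = Fin n})))

  compileFO-correct : ∀ {m} φ (e : ℕ → Fin m) (ρ : Vec (Fin n) m) pos out → m + depthFO φ ≤ M → Agree pos ρ →
    ∃ λ pos′ → Does (compileFO φ e) pos out (evalFO A φ (λ y → Vec.lookup ρ (e y))) pos′ out (timeFO n φ) × Keeps m pos pos′
  compileFO-correct {m} (x ≐ y) e ρ pos out le ag = pos ,
    subst (λ b → Does (op (equal (lev (e x)) (lev (e y)))) pos out b pos out 1)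
      (trans (cong₂ _≡ᵇ_ (ag (e y)) (ag (e x))) (≡ᵇ-sym (toℕ (Vec.lookup ρ (e y))) _))
      (does-equal (below (e x)) (below (e y)) (≤-trans (s≤s (≤-reflexive (ag (e x)))) (Finₚ.toℕ<n (Vec.lookup ρ (e x))))) , (λ _ _ → refl)
    where
    below : ∀ (i : Fin m) → lev i < M
    below i = ≤-trans (lev< i) (≤-trans (m≤m+n m 0) le)
    ≡ᵇ-sym : ∀ a b → (a ≡ᵇ b) ≡ (b ≡ᵇ a)
    ≡ᵇ-sym zero    zero    = refl
    ≡ᵇ-sym zero    (suc b) = refl
    ≡ᵇ-sym (suc a) zero    = refl
    ≡ᵇ-sym (suc a) (suc b) = ≡ᵇ-sym a b
  compileFO-correct (rel r ys) e ρ pos out le ag =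
    query-correct r ys (lev ∘ e) (λ y → Vec.lookup ρ (e y)) (λ y → lev< (e y)) le pos out (λ y → ag (e y))
  compileFO-correct (¬ᶠ φ) e ρ pos out le ag with compileFO-correct φ e ρ pos out le ag
  ... | pos′ , d , k with evalFO A φ (λ y → Vec.lookup ρ (e y))
  ...   | true  = pos′ , does-then d does-ret , k
  ...   | false = pos′ , does-else d does-ret , k
  compileFO-correct {m} (φ ∨ᶠ ψ) e ρ pos out le ag
    with compileFO-correct φ e ρ pos out (≤-trans (+-monoʳ-≤ m (m≤m+n (depthFO φ) (depthFO ψ))) le) ag
  ... | pos′ , d , k with evalFO A φ (λ y → Vec.lookup ρ (e y))
  ...   | true  = pos′ , does-weaken (+-monoʳ-≤ (timeFO n φ) (m≤m+n 1 _)) (does-then d does-ret) , k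
  ...   | false with pos″ , d′ , k′ ← compileFO-correct ψ e ρ pos′ out (≤-trans (+-monoʳ-≤ m (m≤n+m (depthFO ψ) (depthFO φ))) le) (agree-keeps {pos′ = pos′} ρ k ag) =
    pos″ , does-weaken (+-monoʳ-≤ (timeFO n φ) (n≤1+n _)) (does-else d d′) , (λ x lt → trans (k′ x lt) (k x lt))
  compileFO-correct {m} (∃ᶠ x φ) e ρ pos out le ag = finish
    (does-scan m<M n (timeFO n φ) I Found (λ j pos out lt e _ → inRange-on m<M j pos out lt e) (λ pos out e _ → inRange-off m<M pos out e) body-step
      n 0 (update pos m 0) out (+-identityʳ n) (update-same pos m 0) (keeps-update m pos 0 , refl , refl))
    where
    le′ : suc m + depthFO φ ≤ M
    le′ = ≤-trans (≤-reflexive (sym (+-suc m _))) le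
    m<M : m < M
    m<M = ≤-trans (m≤m+n (suc m) (depthFO φ)) le′
    p : Fin n → Bool
    p a = evalFO A φ (λ y → Vec.lookup (a ∷ ρ) ((e ⊕ₙ x) y))
    I : ℕ → (ℕ → ℕ) → List IO → Set
    -- As long as the loop goes on, no witness has been met among the first `j` elements; `Found`
    -- describes the early exit at a witness.
    I j pos′ out′ = Keeps m pos pos′ × out′ ≡ out × any p (List.take j (allFin n)) ≡ false
    Found : (ℕ → ℕ) → List IO → Set
    Found pos′ out′ = Keeps m pos pos′ × out′ ≡ out × any p (allFin n) ≡ true
    body-step : ∀ j pos′ out′ → j < n → pos′ m ≡ j → I j pos′ out′ → ∃ λ b → ∃ λ pos″ → ∃ λ out″ →
      Does (compileFO φ (e ⊕ₙ x)) pos′ out′ b pos″ out″ (timeFO n φ) × (b ≡ true → Found pos″ out″) ×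
      (b ≡ false → pos″ m ≡ j × I (suc j) (update pos″ m (suc j)) out″)
    body-step j pos′ out′ lt at-j (k , refl , nil)
      with pos″ , d , k′ ← compileFO-correct φ (e ⊕ₙ x) (Fin.fromℕ< lt ∷ ρ) pos′ out le′
             (agree-∷ {pos = pos′} ρ (Fin.fromℕ< lt) (trans at-j (sym (Finₚ.toℕ-fromℕ< lt))) (agree-keeps {pos′ = pos′} ρ k ag)) =
      p (Fin.fromℕ< lt) , pos″ , out , d ,
      (λ hit → keeps , refl , any-∈ p (∈-allFin (Fin.fromℕ< lt)) hit) ,
      (λ miss → trans (k′ m ≤-refl) at-j , (λ x lt → trans (keeps-update m pos″ (suc j) x lt) (keeps x lt)) , refl ,
        trans (cong (any p) (take-suc-allFin j lt)) (trans (any-∷ʳ p (List.take j (allFin n)) (Fin.fromℕ< lt)) (cong₂ _∨_ nil miss)))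
      where
      keeps : Keeps m pos pos″
      keeps x lt = trans (k′ x (m≤n⇒m≤1+n lt)) (k x lt)
    value : any p (allFin n) ≡ evalFO A (∃ᶠ x φ) (λ y → Vec.lookup ρ (e y))
    value = cong or (map-cong (λ a → evalFO-cong A φ (lookup-⊕ₙ ρ e x a)) (allFin n))
    finish : (∃ λ b → ∃ λ pos′ → ∃ λ out′ → Does (scan m (inRange m) (compileFO φ (e ⊕ₙ x))) (update pos m 0) out b pos′ out′ (scanTime n (timeFO n φ)) ×
        (b ≡ true → Found pos′ out′) × (b ≡ false → I n pos′ out′)) →
      ∃ λ pos′ → Does (compileFO (∃ᶠ x φ) e) pos out (evalFO A (∃ᶠ x φ) (λ y → Vec.lookup ρ (e y))) pos′ out (timeFO n (∃ᶠ x φ)) × Keeps m pos pos′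
    finish (true  , pos′ , out′ , d , q , _) with k , refl , found ← q refl =
      pos′ , subst (λ b → Does _ pos out b pos′ out _) (trans (sym found) value) (does-seq does-reset d) , k
    finish (false , pos′ , out′ , d , _ , i) with k , refl , nil ← i refl =
      pos′ , subst (λ b → Does _ pos out b pos′ out _) (trans (sym nil) (trans (cong (any p) take-n) value)) (does-seq does-reset d) , k
  compileFO-correct ⊤ᶠ e ρ pos out le ag = pos , does-ret , (λ _ _ → refl)
  compileFO-correct ⊥ᶠ e ρ pos out le ag = pos , does-ret , (λ _ _ → refl)

-- Output generators and running time

-- The semantics of these printing programs involves neither heads nor tape, so their output can be
-- compared with the encoded formula apart from all machines.
data Gen (σ : Vocab) (m : ℕ) : Set where
  nil  : Gen σ m
  emit : IO → Gen σ m
  _▸_  : Gen σ m → Gen σ m → Gen σ m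
  each : Gen σ (suc m) → Gen σ m
  cond : FO σ → (ℕ → Fin m) → Gen σ m → Gen σ m → Gen σ m

infixr 5 _▸_

generate : ∀ {σ m} (A : Structure σ) → Gen σ m → Vec (Fin (card A)) m → List IO
generate A nil            ρ = []
generate A (emit s)       ρ = s ∷ []
generate A (g ▸ h)        ρ = generate A g ρ ++ generate A h ρ
generate A (each g)       ρ = concatMap (λ a → generate A g (a ∷ ρ)) (allFin (card A))
generate A (cond φ e g h) ρ = if evalFO A φ (λ y → Vec.lookup ρ (e y)) then generate A g ρ else generate A h ρ

module CompileGen (σ : Vocab) (M : ℕ) where

  open Heads M
  open Compile σ M

  compileGen : ∀ {m} → Gen σ m → Prog
  compileGen     nil            = op (retO false)
  compileGen     (emit s)       = op (emitO s)
  compileGen     (g ▸ h)        = seq (compileGen g) (compileGen h)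
  compileGen {m} (each g)       = for m (compileGen g)
  compileGen     (cond φ e g h) = ite (compileFO φ e) (compileGen g) (compileGen h)

  timeGen : ∀ {m} → ℕ → Gen σ m → ℕ
  timeGen n nil            = 1
  timeGen n (emit s)       = 1
  timeGen n (g ▸ h)        = timeGen n g + timeGen n h
  timeGen n (each g)       = forTime n (timeGen n g)
  timeGen n (cond φ e g h) = timeFO n φ + (timeGen n g + timeGen n h)

-- The depth has to be known before the number of heads is chosen, so it takes `depthFO` at the
-- placeholder 0; `depthFO-irrelevant` transfers the value.
depthGen : ∀ {σ m} → Gen σ m → ℕ
depthGen nil                = 0
depthGen (emit s)           = 0
depthGen (g ▸ h)            = depthGen g + depthGen h
depthGen (each g)           = suc (depthGen g)
depthGen {σ} (cond φ e g h) = Compile.depthFO σ 0 φ + (depthGen g + depthGen h)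

module CorrectGen {σ : Vocab} (A : Structure σ) (M : ℕ) where

  open Heads M
  open Compile σ M
  open CompileGen σ M
  open CorrectFO A M
  open On inp

  depthFO-irrelevant : ∀ φ → Compile.depthFO σ 0 φ ≡ depthFO φ
  depthFO-irrelevant (x ≐ y)    = refl
  depthFO-irrelevant (rel r xs) = refl
  depthFO-irrelevant (¬ᶠ φ)     = depthFO-irrelevant φ
  depthFO-irrelevant (φ ∨ᶠ ψ)   = cong₂ _+_ (depthFO-irrelevant φ) (depthFO-irrelevant ψ)
  depthFO-irrelevant (∃ᶠ x φ)   = cong suc (depthFO-irrelevant φ)
  depthFO-irrelevant ⊤ᶠ         = refl
  depthFO-irrelevant ⊥ᶠ         = refl

  -- The returned Boolean is always `false`, because `true` would break off an enclosing loop.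
  compileGen-correct : ∀ {m} (g : Gen σ m) (ρ : Vec (Fin n) m) pos out → m + depthGen g ≤ M → Agree pos ρ →
    ∃ λ pos′ → Does (compileGen g) pos out false pos′ (out ++ generate A g ρ) (timeGen n g) × Keeps m pos pos′
  compileGen-correct nil ρ pos out le ag = pos , subst (λ o → Does _ pos out false pos o 1) (sym (++-identityʳ out)) does-ret , (λ _ _ → refl)
  compileGen-correct (emit s) ρ pos out le ag = pos , does-emit , (λ _ _ → refl)
  compileGen-correct {m} (g ▸ h) ρ pos out le ag
    with pos′ , d , k ← compileGen-correct g ρ pos out (≤-trans (+-monoʳ-≤ m (m≤m+n (depthGen g) (depthGen h))) le) ag
    with pos″ , d′ , k′ ← compileGen-correct h ρ pos′ (out ++ generate A g ρ)
           (≤-trans (+-monoʳ-≤ m (m≤n+m (depthGen h) (depthGen g))) le) (agree-keeps {pos′ = pos′} ρ k ag) =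
    pos″ , subst (λ o → Does _ pos out false pos″ o _) (++-assoc out _ _) (does-seq d d′) , (λ x lt → trans (k′ x lt) (k x lt))
  compileGen-correct {m} (each g) ρ pos out le ag = finish
    (does-scan m<M n (timeGen n g) I (λ _ _ → ⊥) (λ j pos out lt e _ → inRange-on m<M j pos out lt e) (λ pos out e _ → inRange-off m<M pos out e) body-step
      n 0 (update pos m 0) out (+-identityʳ n) (update-same pos m 0) (keeps-update m pos 0 , sym (++-identityʳ out)))
    where
    le′ : suc m + depthGen g ≤ M
    le′ = ≤-trans (≤-reflexive (sym (+-suc m _))) le
    m<M : m < M
    m<M = ≤-trans (m≤m+n (suc m) (depthGen g)) le′
    f : Fin n → List IO
    f a = generate A g (a ∷ ρ)
    I : ℕ → (ℕ → ℕ) → List IO → Set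
    I j pos′ out′ = Keeps m pos pos′ × out′ ≡ out ++ concatMap f (List.take j (allFin n))
    body-step : ∀ j pos′ out′ → j < n → pos′ m ≡ j → I j pos′ out′ → ∃ λ b → ∃ λ pos″ → ∃ λ out″ →
      Does (compileGen g) pos′ out′ b pos″ out″ (timeGen n g) × (b ≡ true → ⊥) ×
      (b ≡ false → pos″ m ≡ j × I (suc j) (update pos″ m (suc j)) out″)
    body-step j pos′ out′ lt at-j (k , refl)
      with pos″ , d , k′ ← compileGen-correct g (Fin.fromℕ< lt ∷ ρ) pos′ out′ le′
             (agree-∷ {pos = pos′} ρ (Fin.fromℕ< lt) (trans at-j (sym (Finₚ.toℕ-fromℕ< lt))) (agree-keeps {pos′ = pos′} ρ k ag)) =
      false , pos″ , _ , d , (λ ()) ,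
      (λ _ → trans (k′ m ≤-refl) at-j ,
        (λ x lt → trans (keeps-update m pos″ (suc j) x lt) (trans (k′ x (m≤n⇒m≤1+n lt)) (k x lt))) ,
        trans (++-assoc out _ _) (cong (out ++_) (sym (trans (cong (concatMap f) (take-suc-allFin j lt))
          (trans (concatMap-++ f (List.take j (allFin n)) _) (cong (concatMap f (List.take j (allFin n)) ++_) (++-identityʳ _)))))))
    finish : (∃ λ b → ∃ λ pos′ → ∃ λ out′ → Does (scan m (inRange m) (compileGen g)) (update pos m 0) out b pos′ out′ (scanTime n (timeGen n g)) ×
        (b ≡ true → ⊥) × (b ≡ false → I n pos′ out′)) →
      ∃ λ pos′ → Does (compileGen (each g)) pos out false pos′ (out ++ concatMap f (allFin n)) (forTime n (timeGen n g)) × Keeps m pos pos′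
    finish (true  , _ , _ , _ , q , _) = ⊥-elim (q refl)
    finish (false , pos′ , out′ , d , _ , i) with k , e ← i refl =
      pos′ , subst (λ o → Does _ pos out false pos′ o _) (trans e (cong (λ as → out ++ concatMap f as) take-n)) (does-seq does-reset d) , k
  compileGen-correct {m} (cond φ e g h) ρ pos out le ag
    with pos′ , d , k ← compileFO-correct φ e ρ pos out
      (≤-trans (+-monoʳ-≤ m (≤-trans (≤-reflexive (sym (depthFO-irrelevant φ))) (m≤m+n _ (depthGen g + depthGen h)))) le) ag
    with evalFO A φ (λ y → Vec.lookup ρ (e y))
  ... | true with pos″ , d′ , k′ ← compileGen-correct g ρ pos′ out
        (≤-trans (+-monoʳ-≤ m (≤-trans (m≤m+n (depthGen g) (depthGen h)) (m≤n+m _ (Compile.depthFO σ 0 φ)))) le) (agree-keeps {pos′ = pos′} ρ k ag) =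
    pos″ , does-weaken (+-monoʳ-≤ (timeFO n φ) (m≤m+n _ _)) (does-then d d′) , (λ x lt → trans (k′ x lt) (k x lt))
  ... | false with pos″ , d′ , k′ ← compileGen-correct h ρ pos′ out
        (≤-trans (+-monoʳ-≤ m (≤-trans (m≤n+m (depthGen h) (depthGen g)) (m≤n+m _ (Compile.depthFO σ 0 φ)))) le) (agree-keeps {pos′ = pos′} ρ k ag) =
    pos″ , does-weaken (+-monoʳ-≤ (timeFO n φ) (m≤n+m _ _)) (does-else d d′) , (λ x lt → trans (k′ x lt) (k x lt))

-- Polynomial time bounds

record Poly (f : ℕ → ℕ) : Set where
  constructor poly
  field
    coeff  : ℕ
    degree : ℕ
    bound  : ∀ n → 1 ≤ n → f n ≤ coeff * n ^ degree

one≤^ : ∀ n k → 1 ≤ n → 1 ≤ n ^ k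
one≤^ n zero    p = ≤-refl
one≤^ n (suc k) p = *-mono-≤ p (one≤^ n k p)

poly-const : ∀ c → Poly (λ _ → c)
poly-const c = poly c 0 (λ n p → ≤-reflexive (sym (*-identityʳ c)))

poly-id : Poly id
poly-id = poly 1 1 (λ n p → ≤-reflexive (sym (trans (*-identityˡ (n * 1)) (*-identityʳ n))))

-- Adding the degrees avoids comparing them; it is sound because powers of `n` are at least 1.
poly-+ : ∀ {f g} → Poly f → Poly g → Poly (λ n → f n + g n)
poly-+ (poly c k b) (poly c′ k′ b′) = poly (c + c′) (k + k′) λ n p → ≤-trans
  (+-mono-≤ (≤-trans (b n p) (*-monoʳ-≤ c (raise-right n p))) (≤-trans (b′ n p) (*-monoʳ-≤ c′ (raise-left n p))))
  (≤-reflexive (sym (*-distribʳ-+ _ c c′)))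
  where
  raise-right : ∀ n → 1 ≤ n → n ^ k ≤ n ^ (k + k′)
  raise-right n p = ≤-trans (≤-reflexive (sym (*-identityʳ (n ^ k))))
    (≤-trans (*-monoʳ-≤ (n ^ k) (one≤^ n k′ p)) (≤-reflexive (sym (^-distribˡ-+-* n k k′))))
  raise-left : ∀ n → 1 ≤ n → n ^ k′ ≤ n ^ (k + k′)
  raise-left n p = ≤-trans (≤-reflexive (sym (*-identityˡ (n ^ k′))))
    (≤-trans (*-monoˡ-≤ (n ^ k′) (one≤^ n k p)) (≤-reflexive (sym (^-distribˡ-+-* n k k′))))

poly-* : ∀ {f g} → Poly f → Poly g → Poly (λ n → f n * g n)
poly-* (poly c k b) (poly c′ k′ b′) = poly (c * c′) (k + k′) λ n p → ≤-trans (*-mono-≤ (b n p) (b′ n p)) (≤-reflexive (begin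
  c * n ^ k * (c′ * n ^ k′)   ≡⟨ solve 4 (λ a x b y → a :* x :* (b :* y) := a :* b :* (x :* y)) refl c (n ^ k) c′ (n ^ k′) ⟩
  c * c′ * (n ^ k * n ^ k′)   ≡⟨ cong (c * c′ *_) (^-distribˡ-+-* n k k′) ⟨
  c * c′ * n ^ (k + k′)       ∎))

module PolyTime (σ : Vocab) (M : ℕ) where

  open Compile σ M
  open CompileGen σ M

  poly-for : ∀ {f} → Poly f → Poly (λ n → forTime n (f n))
  poly-for F = poly-+ (poly-const 2) (poly-* poly-id (poly-+ (poly-const 2) F))

  poly-skip : ∀ k → Poly (λ n → skipTime n k)
  poly-skip zero    = poly-const 1
  poly-skip (suc k) = poly-for (poly-skip k)

  poly-toTable : ∀ τ r → Poly (λ n → toTableTime n τ r)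
  poly-toTable (k ∷ τ) fzero    = poly-const 1
  poly-toTable (k ∷ τ) (fsuc r) = poly-+ (poly-skip k) (poly-+ (poly-const 1) (poly-toTable τ r))

  poly-seek : ∀ k → Poly (λ n → seekTime n k)
  poly-seek zero    = poly-const 1
  poly-seek (suc k) = poly-+ (poly-for (poly-skip k)) (poly-seek k)

  poly-FO : ∀ φ → Poly (λ n → timeFO n φ)
  poly-FO (x ≐ y)    = poly-const 1
  poly-FO (rel r xs) = poly-+ (poly-const 1) (poly-+ (poly-skip 1) (poly-+ (poly-const 1)
    (poly-+ (poly-toTable σ r) (poly-+ (poly-seek (arity σ r)) (poly-const 1)))))
  poly-FO (¬ᶠ φ)     = poly-+ (poly-FO φ) (poly-const 1)
  poly-FO (φ ∨ᶠ ψ)   = poly-+ (poly-FO φ) (poly-+ (poly-const 1) (poly-FO ψ))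
  poly-FO (∃ᶠ x φ)   = poly-for (poly-FO φ)
  poly-FO ⊤ᶠ         = poly-const 1
  poly-FO ⊥ᶠ         = poly-const 1

  poly-Gen : ∀ {m} (g : Gen σ m) → Poly (λ n → timeGen n g)
  poly-Gen nil            = poly-const 1
  poly-Gen (emit s)       = poly-const 1
  poly-Gen (g ▸ h)        = poly-+ (poly-Gen g) (poly-Gen h)
  poly-Gen (each g)       = poly-for (poly-Gen g)
  poly-Gen (cond φ e g h) = poly-+ (poly-FO φ) (poly-+ (poly-Gen g) (poly-Gen h))

-- The machine that runs a generator

module Compilation {σ : Vocab} (g : Gen σ 1) where

  private
    M = 1 + depthGen g

  open Heads M
  open CompileGen σ M
  open PolyTime σ M

  program : Prog
  program = seq (op markO) (compileGen g)

  open Compiled program using (machine; machine-correct; totalTime; opTime)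

  private
    N = Poly.coeff (poly-Gen g)
    d = Poly.degree (poly-Gen g)

    opBound : ℕ → ℕ
    -- The additional operation is `markO`.
    opBound l = 1 + N * l ^ d

    poly-^ : ∀ k → Poly (_^ k)
    poly-^ k = poly 1 k (λ n _ → ≤-reflexive (sym (*-identityˡ (n ^ k))))

    poly-opBound : Poly opBound
    poly-opBound = poly-+ (poly-const 1) (poly-* (poly-const N) (poly-^ d))

    poly-total : Poly (λ l → totalTime (opBound l) l l)
    poly-total = poly-+ (poly-const 1) (poly-+
      (poly-* poly-opBound (poly-+ (poly-* (poly-const 2) (poly-+ poly-id poly-opBound)) (poly-const 5)))
      (poly-+ (poly-const 1) (poly-+ poly-id (poly-const 1))))

  cells-length : ∀ pos j ss → length (cells pos j ss) ≡ length ss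
  cells-length pos j []       = refl
  cells-length pos j (s ∷ ss) = cong suc (cells-length pos (suc j) ss)

  generate-polyTime : ∀ {Y : Set} (encY : Y → List IO) (f : Structure σ → Y) →
    (∀ A → generate A g (fzero ∷ []) ≡ encY (f A)) → PolyTimeComputable encStructure encY f
  generate-polyTime encY f e = machine , Poly.coeff poly-total , Poly.degree poly-total , correct
    where
    correct : ∀ A → let fin = run machine (Poly.coeff poly-total * length (encStructure A) ^ Poly.degree poly-total + Poly.coeff poly-total)
                                (initial machine (encStructure A)) in
      T (halted machine fin) × output machine fin ≡ encY (f A)
    correct A with pos , On.does runs , _ ← CorrectGen.compileGen-correct A M g (fzero ∷ []) (λ _ → 0) [] ≤-refl (λ { fzero → refl }) =
      -- The universe is nonempty, so the encoding starts with `s1`.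
      map₂ (λ o → trans o (e A)) (machine-correct s1 (List.drop 1 inp) (cells pos 0 inp) (generate A g (fzero ∷ [])) false (opBound l)
        (weaken (s≤s (≤-trans (Poly.bound (poly-Gen g) n (s≤s z≤n)) (*-monoʳ-≤ N (^-monoˡ-≤ d n≤l))))
          (runs-else (op markO) (compileGen g) (compileGen g) (On.runs-mark inp) runs))
        _ (≤-trans (≤-reflexive (cong (totalTime (opBound l) l) (cells-length pos 0 inp)))
            (≤-trans (Poly.bound poly-total l (s≤s z≤n)) (m≤m+n _ _))))
      where
      n   = card A
      inp = encStructure A
      l   = length inp
      -- The universe is written in unary, so a polynomial in its size is bounded by one in the
      -- input length.
      n≤l : n ≤ l
      n≤l = ≤-trans (≤-reflexive (sym (length-replicate n))) (≤-trans (m≤m+n _ _) (≤-reflexive (sym (length-++ (List.replicate n s1)))))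

open Compilation using (generate-polyTime)

-- Writing the reduction

concatMap-concatMap : ∀ {A B C : Set} (f : B → List C) (g : A → List B) xs → concatMap f (concatMap g xs) ≡ concatMap (concatMap f ∘ g) xs
concatMap-concatMap f g []       = refl
concatMap-concatMap f g (x ∷ xs) = trans (concatMap-++ f (g x) _) (cong (concatMap f (g x) ++_) (concatMap-concatMap f g xs))

concatMap-singleton : ∀ {A B : Set} (f : A → B) xs → concatMap (λ x → f x ∷ []) xs ≡ map f xs
concatMap-singleton f []       = refl
concatMap-singleton f (x ∷ xs) = cong (f x ∷_) (concatMap-singleton f xs)

-- The scope m extended by k variables, which form the tuple newest.
_⊹_ : ℕ → ℕ → ℕ
zero  ⊹ m = m
suc k ⊹ m = k ⊹ suc m

older : ∀ k {m} → Fin m → Fin (k ⊹ m)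
older zero    i = i
older (suc k) i = older k (fsuc i)

newest : ∀ k {m} → Vec (Fin (k ⊹ m)) k
newest zero    = []
newest (suc k) = older k fzero ∷ newest k

extendBy : ∀ {n k m} → Vec (Fin n) k → Vec (Fin n) m → Vec (Fin n) (k ⊹ m)
extendBy []      ρ = ρ
extendBy (a ∷ t) ρ = extendBy t (a ∷ ρ)

lookup-older : ∀ {n k m} (t : Vec (Fin n) k) (ρ : Vec (Fin n) m) i → Vec.lookup (extendBy t ρ) (older k i) ≡ Vec.lookup ρ i
lookup-older []      ρ i = refl
lookup-older (a ∷ t) ρ i = lookup-older t (a ∷ ρ) (fsuc i)

lookup-newest : ∀ {n k m} (t : Vec (Fin n) k) (ρ : Vec (Fin n) m) → Vec.map (Vec.lookup (extendBy t ρ)) (newest k) ≡ t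
lookup-newest []      ρ = refl
lookup-newest (a ∷ t) ρ = cong₂ _∷_ (lookup-older t (a ∷ ρ) fzero) (lookup-newest t (a ∷ ρ))

encClauses : TwoSAT → List IO
encClauses = concatMap encClause2

-- A block of clauses that a sum operator appends to every disjunct of its body.
data Frame (σ : Vocab) (m : ℕ) : Set where
  chooseᶠ : Word → Bool → Q σ → Word → Frame σ m
  pickᶠ   : Word → Fin m → Frame σ m
  tautsᶠ  : ℕ → Word → Frame σ m

weakenᶠ : ∀ {σ m} → Frame σ m → Frame σ (suc m)
weakenᶠ (chooseᶠ w b β u) = chooseᶠ w b β u
weakenᶠ (pickᶠ w i)       = pickᶠ w (fsuc i)
weakenᶠ (tautsᶠ k w)      = tautsᶠ k w

frameClauses : ∀ {σ n m} → Vec (Fin n) m → Frame σ m → TwoSAT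
frameClauses {n = n} ρ (chooseᶠ w b β u) = units (choose n w b β u)
frameClauses         ρ (pickᶠ w i)       = units (pick w (Vec.lookup ρ i))
frameClauses {n = n} ρ (tautsᶠ k w)      = tauts n k w

framesClauses : ∀ {σ n m} → Vec (Fin n) m → List (Frame σ m) → TwoSAT
framesClauses ρ = concatMap (frameClauses ρ)

framesClauses-weaken : ∀ {σ n m} a (ρ : Vec (Fin n) m) (fs : List (Frame σ m)) → framesClauses (a ∷ ρ) (map weakenᶠ fs) ≡ framesClauses ρ fs
framesClauses-weaken         a ρ []       = refl
framesClauses-weaken {σ} {n} {m} a ρ (f ∷ fs) = cong₂ _++_ (weaken₁ f) (framesClauses-weaken a ρ fs)
  where
  weaken₁ : ∀ (f : Frame σ m) → frameClauses (a ∷ ρ) (weakenᶠ f) ≡ frameClauses ρ f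
  weaken₁ (chooseᶠ w b β u) = refl
  weaken₁ (pickᶠ w i)       = refl
  weaken₁ (tautsᶠ k w)      = refl

module _ {σ : Vocab} where

  eachTuple : ∀ k {m} → Gen σ (k ⊹ m) → Gen σ m
  eachTuple zero    g = g
  eachTuple (suc k) g = each (eachTuple k g)

  -- An equality formula with its own naming: 0 is the newest variable, 1 is the variable `i`.
  ifNewestIs : ∀ {m} → Fin m → Gen σ (suc m) → Gen σ (suc m) → Gen σ (suc m)
  ifNewestIs i = cond (0 ≐ 1) (λ { zero → fzero ; (suc _) → fsuc i })

  gBits : ∀ {m} → Word → Gen σ m
  gBits []      = nil
  gBits (b ∷ w) = emit (bit b) ▸ gBits w

  gHots : ∀ {m k} → Vec (Fin m) k → Gen σ m
  gHots []       = nil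
  gHots (i ∷ is) = each (ifNewestIs i (emit s1) (emit s0)) ▸ gHots is

  -- The `s1` in the middle is the bit `true` that `vn` puts between the word and the one-hot codes.
  gLit : ∀ {m k} → Bool → Word → Vec (Fin m) k → Gen σ m
  gLit s w is = emit (bit s) ▸ (gBits w ▸ emit s1 ▸ gHots is) ▸ emit sa

  gUnit : ∀ {m k} → Bool → Word → Vec (Fin m) k → Gen σ m
  gUnit s w is = gLit s w is ▸ emit sb

  gNegs : ∀ {m} → Q σ → Word → Gen σ m
  gNegs (leaf φ)     w = nil
  gNegs (plus α β)   w = gUnit false w [] ▸ gNegs α (w ++ false ∷ false ∷ []) ▸ gNegs β (w ++ false ∷ true ∷ [])
  gNegs (sumF x α)   w = each (gUnit false w (fzero ∷ [])) ▸ gNegs α (w ++ false ∷ [])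
  gNegs (sumS k X α) w = eachTuple k (gUnit false w (newest k)) ▸ gNegs α (w ++ false ∷ [])

  gFrame : ∀ {m} → Frame σ m → Gen σ m
  gFrame (chooseᶠ w b β u) = gUnit b w [] ▸ gNegs β u
  gFrame (pickᶠ w i)       = each (ifNewestIs i (gUnit true w (fzero ∷ [])) (gUnit false w (fzero ∷ [])))
  gFrame (tautsᶠ k w)      = eachTuple k (gLit true w (newest k) ▸ gLit false w (newest k) ▸ emit sb)

  gFrames : ∀ {m} → List (Frame σ m) → Gen σ m
  gFrames []       = nil
  gFrames (f ∷ fs) = gFrame f ▸ gFrames fs

  gWLit : ∀ {m} → (ℕ → Fin m) → WLit → Gen σ m
  gWLit e (wlit s w xs) = gLit s w (Vec.map e xs)

  gLits : ∀ {m} → (ℕ → Fin m) → Lits → Gen σ m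
  gLits e none         = emit sb
  gLits e (single l)   = gWLit e l ▸ emit sb
  gLits e (double l k) = gWLit e l ▸ gWLit e k ▸ emit sb

  gClauses : ∀ {m} → Env → (ℕ → Fin m) → List (Clause σ) → Gen σ m
  gClauses E e []       = nil
  gClauses E e (C ∷ Cs) = cond (proj₁ (split E C)) e nil (gLits e (proj₂ (split E C))) ▸ gClauses E e Cs

  gForall : ∀ {m} → Env → (ℕ → Fin m) → List ℕ → List (Clause σ) → Gen σ m
  gForall E e []       Cs = gClauses E e Cs
  gForall E e (x ∷ xs) Cs = each (gForall E (e ⊕ₙ x) xs Cs)

  gExists : ∀ {m} → Env → (ℕ → Fin m) → List (Frame σ m) → List ℕ → List ℕ → List (Clause σ) → Gen σ m
  gExists E e fs []       ys Cs = (gForall E e ys Cs ▸ gFrames fs) ▸ emit sc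
  gExists E e fs (x ∷ xs) ys Cs = each (gExists E (e ⊕ₙ x) (map weakenᶠ fs) xs ys Cs)

  -- Operators append blocks to disjuncts that are printed only at the leaves, so the pending blocks
  -- are passed down in `fs`, innermost first.
  gDisj : ∀ {m} → Q σ → Env → Word → (ℕ → Fin m) → List (Frame σ m) → Gen σ m
  gDisj (leaf φ)     E w e fs = gExists E e fs (Σ₂2SAT.exVars φ) (Σ₂2SAT.allVars φ) (Σ₂2SAT.clauses φ)
  gDisj (plus α β)   E w e fs =
    gDisj α E (w ++ false ∷ false ∷ []) e (chooseᶠ w true  β (w ++ false ∷ true ∷ []) ∷ fs) ▸
    gDisj β E (w ++ false ∷ true ∷ [])  e (chooseᶠ w false α (w ++ false ∷ false ∷ []) ∷ fs)
  gDisj (sumF x α)   E w e fs = each (gDisj α E (w ++ false ∷ []) (e ⊕ₙ x) (pickᶠ w fzero ∷ map weakenᶠ fs))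
  gDisj (sumS k X α) E w e fs = gDisj α (extend E k X w) (w ++ false ∷ []) e (tautsᶠ k w ∷ fs)

  module _ (A : Structure σ) where

    private n = card A

    eachTuple-generate : ∀ k {m} (g : Gen σ (k ⊹ m)) ρ → generate A (eachTuple k g) ρ ≡ concatMap (λ t → generate A g (extendBy t ρ)) (allTuples n k)
    eachTuple-generate zero    g ρ = sym (++-identityʳ _)
    eachTuple-generate (suc k) g ρ = trans
      (concatMap-cong (λ a → trans (eachTuple-generate k g (a ∷ ρ)) (sym (concatMap-map _ (a ∷_) (allTuples n k)))) (allFin n))
      (sym (concatMap-concatMap (λ t → generate A g (extendBy t ρ)) (λ a → map (a ∷_) (allTuples n k)) (allFin n)))

    gBits-generate : ∀ {m} w (ρ : Vec (Fin n) m) → generate A (gBits w) ρ ≡ map bit w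
    gBits-generate []      ρ = refl
    gBits-generate (b ∷ w) ρ = cong (bit b ∷_) (gBits-generate w ρ)

    gHots-generate : ∀ {m k} (is : Vec (Fin m) k) (ρ : Vec (Fin n) m) → generate A (gHots is) ρ ≡ map bit (hots (Vec.map (Vec.lookup ρ) is))
    gHots-generate []       ρ = refl
    gHots-generate {m} (i ∷ is) ρ = trans (cong₂ _++_ hot-generate (gHots-generate is ρ)) (sym (map-++ bit (hot c) _))
      where
      c = Vec.lookup ρ i
      digit : ∀ b → (if b then List.[ s1 ] else List.[ s0 ]) ≡ List.[ bit b ]
      digit true  = refl
      digit false = refl
      hot-generate : concatMap (λ a → if eqFin a c then s1 ∷ [] else s0 ∷ []) (allFin n) ≡ map bit (hot c)
      hot-generate = begin
        concatMap (λ a → if eqFin a c then s1 ∷ [] else s0 ∷ []) (allFin n)  ≡⟨ concatMap-cong (λ a → digit (eqFin a c)) (allFin n) ⟩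
        concatMap (λ a → bit (eqFin a c) ∷ []) (allFin n)                    ≡⟨ concatMap-singleton (λ a → bit (eqFin a c)) (allFin n) ⟩
        map (λ a → bit (eqFin a c)) (allFin n)                               ≡⟨ map-∘ (allFin n) ⟩
        map bit (hot c)                                                      ∎

    gLit-generate : ∀ {m k} s w (is : Vec (Fin m) k) (ρ : Vec (Fin n) m) {t} → Vec.map (Vec.lookup ρ) is ≡ t →
      generate A (gLit s w is) ρ ≡ encPLit (s , vn w t)
    gLit-generate s w is ρ refl = cong (λ ds → bit s ∷ ds ++ sa ∷ []) (begin
      generate A (gBits w) ρ ++ s1 ∷ generate A (gHots is) ρ  ≡⟨ cong₂ (λ u v → u ++ s1 ∷ v) (gBits-generate w ρ) (gHots-generate is ρ) ⟩
      map bit w ++ map bit (true ∷ hots t)                    ≡⟨ map-++ bit w _ ⟨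
      map bit (w ++ true ∷ hots t)                            ≡⟨ digits-nm (w ++ true ∷ hots t) ⟨
      digitsᵇ (ℕᵇ.fromℕ (vn w t))                             ∎)
      where t = Vec.map (Vec.lookup ρ) is

    gUnit-generate : ∀ {m k} s w (is : Vec (Fin m) k) (ρ : Vec (Fin n) m) {t} → Vec.map (Vec.lookup ρ) is ≡ t →
      generate A (gUnit s w is) ρ ≡ encClause2 (one (s , vn w t))
    gUnit-generate s w is ρ e = cong (_++ sb ∷ []) (gLit-generate s w is ρ e)

    encClauses-map : ∀ {I : Set} (c : I → Clause2) (g : I → List IO) → (∀ i → g i ≡ encClause2 (c i)) → ∀ is → concatMap g is ≡ encClauses (map c is)
    encClauses-map c g e []       = refl
    encClauses-map c g e (i ∷ is) = cong₂ _++_ (e i) (encClauses-map c g e is)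

    encClauses-++ : ∀ c d → encClauses (c ++ d) ≡ encClauses c ++ encClauses d
    encClauses-++ c d = concatMap-++ encClause2 c d

    encNegs-++ : ∀ xs ys → encClauses (units (map neg (xs ++ ys))) ≡ encClauses (units (map neg xs)) ++ encClauses (units (map neg ys))
    encNegs-++ xs ys = trans (cong (encClauses ∘ units) (map-++ neg xs ys))
      (trans (cong encClauses (map-++ one (map neg xs) (map neg ys))) (encClauses-++ (units (map neg xs)) _))

    encNegs-map : ∀ {I : Set} (f : I → ℕ) is → encClauses (map (λ i → one (neg (f i))) is) ≡ encClauses (units (map neg (map f is)))
    encNegs-map f is = cong encClauses (trans (map-∘ is) (trans (cong (map one) (map-∘ is)) refl))

    gNegs-generate : ∀ {m} β w (ρ : Vec (Fin n) m) → generate A (gNegs β w) ρ ≡ encClauses (units (map neg (vars n β w)))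
    gNegs-generate (leaf φ)     w ρ = refl
    gNegs-generate (plus α β)   w ρ = cong₂ _++_ (gUnit-generate false w [] ρ refl)
      (trans (cong₂ _++_ (gNegs-generate α _ ρ) (gNegs-generate β _ ρ)) (sym (encNegs-++ (vars n α _) (vars n β _))))
    gNegs-generate (sumF x α)   w ρ = trans
      (cong₂ _++_
        (trans (encClauses-map (λ a → one (neg (vn w (a ∷ [])))) (λ a → generate A (gUnit false w (fzero ∷ [])) (a ∷ ρ))
            (λ a → gUnit-generate false w (fzero ∷ []) (a ∷ ρ) refl) (allFin n))
          (encNegs-map (λ a → vn w (a ∷ [])) (allFin n)))
        (gNegs-generate α _ ρ))
      (sym (encNegs-++ (map (λ a → vn w (a ∷ [])) (allFin n)) (vars n α _)))
    gNegs-generate (sumS k X α) w ρ = trans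
      (cong₂ _++_
        (trans (eachTuple-generate k (gUnit false w (newest k)) ρ)
          (trans (encClauses-map (λ t → one (neg (vn w t))) (λ t → generate A (gUnit false w (newest k)) (extendBy t ρ))
              (λ t → gUnit-generate false w (newest k) (extendBy t ρ) (lookup-newest t ρ)) (allTuples n k))
            (encNegs-map (vn w) (allTuples n k))))
        (gNegs-generate α _ ρ))
      (sym (encNegs-++ (map (vn w) (allTuples n k)) (vars n α _)))

    gFrame-generate : ∀ {m} (f : Frame σ m) (ρ : Vec (Fin n) m) → generate A (gFrame f) ρ ≡ encClauses (frameClauses ρ f)
    gFrame-generate (chooseᶠ w b β u) ρ = cong₂ _++_ (gUnit-generate b w [] ρ refl) (gNegs-generate β u ρ)
    gFrame-generate (pickᶠ w i)       ρ = trans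
      (encClauses-map (λ a → one (eqFin a (Vec.lookup ρ i) , vn w (a ∷ [])))
        (λ a → if eqFin a (Vec.lookup ρ i) then generate A (gUnit true w (fzero ∷ [])) (a ∷ ρ) else generate A (gUnit false w (fzero ∷ [])) (a ∷ ρ))
        (λ a → value a (eqFin a (Vec.lookup ρ i))) (allFin n))
      (cong encClauses (map-∘ {g = one} {f = λ a → eqFin a (Vec.lookup ρ i) , vn w (a ∷ [])} (allFin n)))
      where
      value : ∀ a b → (if b then generate A (gUnit true w (fzero ∷ [])) (a ∷ ρ) else generate A (gUnit false w (fzero ∷ [])) (a ∷ ρ)) ≡
        encClause2 (one (b , vn w (a ∷ [])))
      value a true  = gUnit-generate true w (fzero ∷ []) (a ∷ ρ) refl
      value a false = gUnit-generate false w (fzero ∷ []) (a ∷ ρ) refl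
    gFrame-generate (tautsᶠ k w)      ρ = trans (eachTuple-generate k _ ρ)
      (encClauses-map (λ t → two (true , vn w t) (false , vn w t)) _ (λ t → cong₂ _++_
        (gLit-generate true w (newest k) (extendBy t ρ) (lookup-newest t ρ))
        (cong (_++ sb ∷ []) (gLit-generate false w (newest k) (extendBy t ρ) (lookup-newest t ρ)))) (allTuples n k))

    gFrames-generate : ∀ {m} (fs : List (Frame σ m)) (ρ : Vec (Fin n) m) → generate A (gFrames fs) ρ ≡ encClauses (framesClauses ρ fs)
    gFrames-generate []       ρ = refl
    gFrames-generate (f ∷ fs) ρ = trans (cong₂ _++_ (gFrame-generate f ρ) (gFrames-generate fs ρ)) (sym (encClauses-++ (frameClauses ρ f) _))

    _⊨_≗_ : ∀ {m} → Vec (Fin n) m → (ℕ → Fin m) → FOAssign n → Set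
    ρ ⊨ e ≗ v = ∀ y → Vec.lookup ρ (e y) ≡ v y

    ⊨-⊕ₙ : ∀ {m} {ρ : Vec (Fin n) m} {e v} x a → ρ ⊨ e ≗ v → (a ∷ ρ) ⊨ (e ⊕ₙ x) ≗ update v x a
    ⊨-⊕ₙ {ρ = ρ} {e} x a h y = trans (lookup-⊕ₙ ρ e x a y) (update-cong x a h y)

    gWLit-generate : ∀ {m} {ρ : Vec (Fin n) m} {e v} → ρ ⊨ e ≗ v → ∀ l → generate A (gWLit e l) ρ ≡ encPLit (instLit v l)
    gWLit-generate {ρ = ρ} {e} h (wlit s w xs) = gLit-generate s w (Vec.map e xs) ρ (trans (sym (Vecₚ.map-∘ (Vec.lookup ρ) e xs)) (Vecₚ.map-cong h xs))

    gLits-generate : ∀ {m} {ρ : Vec (Fin n) m} {e v} → ρ ⊨ e ≗ v → ∀ ls → generate A (gLits e ls) ρ ≡ encClause2 (inst v ls)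
    gLits-generate h none         = refl
    gLits-generate h (single l)   = cong (_++ sb ∷ []) (gWLit-generate h l)
    gLits-generate h (double l k) = cong₂ _++_ (gWLit-generate h l) (cong (_++ sb ∷ []) (gWLit-generate h k))

    gClauses-generate : ∀ {m} {ρ : Vec (Fin n) m} {e v} E → ρ ⊨ e ≗ v → ∀ Cs → generate A (gClauses E e Cs) ρ ≡ encClauses (concatMap (instClause A E v) Cs)
    gClauses-generate E h []       = refl
    gClauses-generate {ρ = ρ} {e} {v} E h (C ∷ Cs) = trans
      (cong₂ _++_ clause (gClauses-generate E h Cs))
      (sym (encClauses-++ (instClause A E v C) _))
      where
      ψ  = proj₁ (split E C)
      ls = proj₂ (split E C)
      clause : generate A (cond ψ e nil (gLits e ls)) ρ ≡ encClauses (instClause A E v C)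
      clause rewrite evalFO-cong A ψ h with evalFO A ψ v
      ... | true  = refl
      ... | false = trans (gLits-generate h ls) (sym (++-identityʳ _))

    gForall-generate : ∀ {m} {ρ : Vec (Fin n) m} {e v} E → ρ ⊨ e ≗ v → ∀ xs Cs →
      generate A (gForall E e xs Cs) ρ ≡ encClauses (overVars xs v (λ v → concatMap (instClause A E v) Cs))
    gForall-generate E h []       Cs = gClauses-generate E h Cs
    gForall-generate {v = v} E h (x ∷ xs) Cs = trans
      (concatMap-cong (λ a → gForall-generate E (⊨-⊕ₙ x a h) xs Cs) (allFin n))
      (sym (concatMap-concatMap encClause2 (λ a → overVars xs (update v x a) (λ v → concatMap (instClause A E v) Cs)) (allFin n)))

    gExists-generate : ∀ {m} {ρ : Vec (Fin n) m} {e v} E fs → ρ ⊨ e ≗ v → ∀ xs ys Cs →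
      generate A (gExists E e fs xs ys Cs) ρ ≡
      concatMap (λ d → encTwoSAT (d ++ framesClauses ρ fs)) (overVars xs v (λ v → overVars ys v (λ v → concatMap (instClause A E v) Cs) ∷ []))
    gExists-generate {ρ = ρ} {v = v} E fs h [] ys Cs = trans
      (cong (_++ sc ∷ []) (trans (cong₂ _++_ (gForall-generate E h ys Cs) (gFrames-generate fs ρ)) (sym (encClauses-++ (overVars ys v (λ v → concatMap (instClause A E v) Cs)) _))))
      (sym (++-identityʳ _))
    gExists-generate {ρ = ρ} {v = v} E fs h (x ∷ xs) ys Cs = trans
      (concatMap-cong (λ a → trans (gExists-generate E (map weakenᶠ fs) (⊨-⊕ₙ x a h) xs ys Cs)
        (concatMap-cong (λ d → cong (λ c → encTwoSAT (d ++ c)) (framesClauses-weaken a ρ fs)) (ds a))) (allFin n))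
      (sym (concatMap-concatMap (λ d → encTwoSAT (d ++ framesClauses ρ fs)) ds (allFin n)))
      where ds = λ a → overVars xs (update v x a) (λ v → overVars ys v (λ v → concatMap (instClause A E v) Cs) ∷ [])

    append-append : ∀ (u c : TwoSAT) ds → concatMap (λ d → encTwoSAT (d ++ (u ++ c))) ds ≡ concatMap (λ d → encTwoSAT (d ++ c)) (map (_++ u) ds)
    append-append u c ds = trans (concatMap-cong (λ d → cong encTwoSAT (sym (++-assoc d u c))) ds) (sym (concatMap-map (λ d → encTwoSAT (d ++ c)) (_++ u) ds))

    -- General `fs` are needed because every sum operator adds its frame before the recursive call;
    -- associativity of `++` turns that frame into the block that `D` appends.
    gDisj-generate : ∀ {m} {ρ : Vec (Fin n) m} {e v} α E w fs → ρ ⊨ e ≗ v →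
      generate A (gDisj α E w e fs) ρ ≡ concatMap (λ d → encTwoSAT (d ++ framesClauses ρ fs)) (D A α E w v)
    gDisj-generate (leaf φ)   E w fs h = gExists-generate E fs h (Σ₂2SAT.exVars φ) (Σ₂2SAT.allVars φ) (Σ₂2SAT.clauses φ)
    gDisj-generate {ρ = ρ} {v = v} (plus α β) E w fs h = trans
      (cong₂ _++_
        (trans (gDisj-generate α E wα _ h) (append-append (units (choose n w true β wβ)) _ (D A α E wα v)))
        (trans (gDisj-generate β E wβ _ h) (append-append (units (choose n w false α wα)) _ (D A β E wβ v))))
      (sym (concatMap-++ _ (map (_++ units (choose n w true β wβ)) (D A α E wα v)) _))
      where
      wα = w ++ false ∷ false ∷ []
      wβ = w ++ false ∷ true ∷ []
    gDisj-generate {ρ = ρ} {v = v} (sumF x α) E w fs h = trans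
      (concatMap-cong (λ a → trans (gDisj-generate α E (w ++ false ∷ []) _ (⊨-⊕ₙ x a h))
        (trans (concatMap-cong (λ d → cong (λ c → encTwoSAT (d ++ (units (pick w a) ++ c))) (framesClauses-weaken a ρ fs)) (Dα a))
          (append-append (units (pick w a)) (framesClauses ρ fs) (Dα a)))) (allFin n))
      (sym (concatMap-concatMap (λ d → encTwoSAT (d ++ framesClauses ρ fs)) (λ a → map (_++ units (pick w a)) (Dα a)) (allFin n)))
      where Dα = λ a → D A α E (w ++ false ∷ []) (update v x a)
    gDisj-generate {ρ = ρ} {v = v} (sumS k X α) E w fs h = trans
      (gDisj-generate α (extend E k X w) (w ++ false ∷ []) _ h)
      (append-append (tauts n k w) (framesClauses ρ fs) (D A α (extend E k X w) (w ++ false ∷ []) v))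

  -- The single variable in scope belongs to a head that stays at position 0. All names refer to it
  -- at first, which gives the assignment `λ _ → fzero` of `count`.
  generator : ΣQSO σ → Gen σ 1
  generator α = gDisj (desugar α) (λ _ _ → nothing) [] (λ _ → fzero) []

  generator-correct : ∀ α A → generate A (generator α) (fzero ∷ []) ≡ encDisj2 (reduce A α)
  generator-correct α A = trans (gDisj-generate A (desugar α) (λ _ _ → nothing) [] [] (λ _ → refl))
    (concatMap-cong (λ d → cong encTwoSAT (++-identityʳ d)) (reduce A α))

theorem2 : (σ : Vocab) (α : ΣQSO σ) → Sentence α →
    Σ[ h ∈ (Structure σ → Disj2) ]
    (PolyTimeComputable encStructure encDisj2 h
    × ((A : Structure σ) → count α A ≡ #Disj2Sat (h A)))
theorem2 σ α _ =
  (λ A → reduce A α) ,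
  generate-polyTime (generator α) encDisj2 (λ A → reduce A α) (generator-correct α) ,
  (λ A → reduce-correct A α)
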